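{- Let $p$ be a prime and let $A,\Gamma\subset\mathbb{F}_p^*$ be two multiplicative subgroups with $|A|<\sqrt p$ and $|\Gamma|<p^{3/4}$. Suppose that $A'\subseteq A+s$ for some $s\in\mathbb{F}_p$, and that $A'-A'\subseteq\xi\Gamma\sqcup\{0\}$ for some $\xi\in\mathbb{F}_p^*$. Then $$|A'|^6\ll|A|^4|\Gamma|^{2/3}\log|A|.$$ In particular, if $A-A\subseteq\xi\Gamma\sqcup\{0\}$ then $|A|\ll|\Gamma|^{1/3}\log^{1/2}|\Gamma|$.
   Context: $X\ll Y$ means $X\le cY$ with an absolute constant $c>0$.
   Formalization: The first bound is proved for |A| > 1 and the second for |Γ| > 1; when |A| = 1 (respectively |Γ| = 1) the logarithm is zero and the literal bound fails, e.g. for A = A' = Γ = {1}. -}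

module Defs where

open import Algebra.Definitions.RawSemiring using () renaming (_^_ to pow)
open import Data.Fin using (Fin; toℕ)
open import Data.Fin.Subset using (Subset; _∈_; _∉_)
open import Data.Integer using (+_) renaming (∣_∣ to abs)
open import Data.Nat using (ℕ; NonZero; _+_; _*_; _∸_; _^_) renaming (_≤_ to _≤ℕ_)
open import Data.Nat.DivMod using (_mod_)
open import Data.Product using (_×_; ∃-syntax)
open import Data.Rational using (ℚ; 0ℚ; _≤_; _/_; ↥_; ↧ₙ_; +-*-rawSemiring) renaming (_*_ to _*ℚ_)
open import Level using (0ℓ)
open import Relation.Binary.PropositionalEquality using (_≡_)
open import Relation.Unary using (Pred)

-- Fin p with arithmetic modulo p is the field 𝔽ₚ when p is prime.

module _ {p : ℕ} .{{_ : NonZero p}} where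

  infixl 6 _+ₚ_ _-ₚ_
  infixl 7 _*ₚ_

  0ₚ 1ₚ : Fin p
  0ₚ = 0 mod p
  1ₚ = 1 mod p

  _+ₚ_ _-ₚ_ _*ₚ_ : Fin p → Fin p → Fin p
  x +ₚ y = (toℕ x + toℕ y) mod p
  x -ₚ y = (toℕ x + (p ∸ toℕ y)) mod p
  x *ₚ y = (toℕ x * toℕ y) mod p

  record IsMultiplicativeSubgroup (G : Subset p) : Set where
    field
      0∉        : 0ₚ ∉ G
      1∈        : 1ₚ ∈ G
      *-closed  : ∀ {x y} → x ∈ G → y ∈ G → x *ₚ y ∈ G
      ⁻¹-closed : ∀ {x} → x ∈ G → ∃[ y ] (y ∈ G × x *ₚ y ≡ 1ₚ)

  infixl 6 _+ˢ_ _-ˢ_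
  infixl 7 _*ˢ_

  _+ˢ_ : Subset p → Fin p → Pred (Fin p) 0ℓ
  (A +ˢ s) x = ∃[ a ] (a ∈ A × x ≡ a +ₚ s)

  _-ˢ_ : Subset p → Subset p → Pred (Fin p) 0ℓ
  (A -ˢ B) x = ∃[ a ] ∃[ b ] (a ∈ A × b ∈ B × x ≡ a -ₚ b)

  _*ˢ_ : Fin p → Subset p → Pred (Fin p) 0ℓ
  (ξ *ˢ G) x = ∃[ g ] (g ∈ G × x ≡ ξ *ₚ g)

-- A nonnegative real x is represented by a set of rationals whose infimum
-- is x.  The infimum itself may or may not belong to the set, so two
-- representations of the same real need not have the same elements; _≤ᴿ_
-- below depends only on the infimum.

UpperReal : Set₁
UpperReal = Pred ℚ 0ℓ

⌜_⌝ : ℕ → UpperReal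
⌜ n ⌝ q = + n / 1 ≤ q

infixl 7 _·_

_·_ : UpperReal → UpperReal → UpperReal
(x · y) q = ∃[ u ] ∃[ v ] (x u × y v × u *ℚ v ≤ q)

-- x^(1/m), for m ≥ 1.

root : ℕ → UpperReal → UpperReal
root m x q = 0ℚ ≤ q × x (pow +-*-rawSemiring q m)

-- For n ≥ 1 and q = a/b ≥ 0 with b ≥ 1:  log₂ n ≤ a/b  iff  n^b ≤ 2^a.
-- The choice of base only affects absolute constants.

log₂ : ℕ → UpperReal
log₂ n q = 0ℚ ≤ q × n ^ ↧ₙ q ≤ℕ 2 ^ abs (↥ q)

infix 4 _≤ᴿ_

_≤ᴿ_ : ℕ → UpperReal → Set
n ≤ᴿ y = ∀ q → y q → + n / 1 ≤ q

-- Fix o ∈ A′.  For distinct b, c ∈ A′ other than o the ratio r = (o - b) / (o - c)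
-- satisfies r ∈ Γ and 1 - r ∈ Γ, and the points u = (b - s) / (o - s) and v = (c - s) / (o - s)
-- of A satisfy 1 - u = r (1 - v).  So if N(r) counts the solutions of this equation
-- with v ≠ 1 in A, then |A′|² ≪ Σ N(r) over r ∈ Γ ∩ (1 - Γ), and Cauchy–Schwarz leaves two estimates:
-- |Γ ∩ (1 - Γ)| ≪ |Γ|^(2/3) and Σ N(r)² ≪ |A|² log |A|.
--
-- Both follow from Stepanov's method: the number of z for which (z ^ t , (1 - z) ^ t) is one
-- of h given pairs is ≪ (h t)^(2/3).  The first estimate is the case h = 1.  For the
-- second, r ↦ r / (r - 1) sends the r with N(r) ≥ τ into the union of h such classes, each with
-- at least τ elements, which gives #{r : N(r) ≥ τ} ≪ |A|² / τ²; then sum over dyadic τ.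
-- This yields |A′|⁴ ≪ |A|² |Γ|^(2/3) log |A|, and |A′| ≤ |A| gives the sixth power.

module Submission where

-- With B² coefficient polynomials of degree below A, vanishing to order D on h classes costs about
-- h D (A + D) linear conditions against A B² unknowns, while the degree is about 2 t B. For A B ≈ t
-- and D a fixed fraction of A, a solution exists once D³ is about t² / h with a small constant, and
-- the number of points is then at most about t B / D ≈ (h t)^(2/3).
--
-- The obstacle is to show that a nonzero solution gives a nonzero polynomial. Differentiation at 0
-- proves it if A B ≤ t and t B ≤ p. The second condition is where the sizes of the subgroups enter:
-- it asks for h t⁴ ≤ p³, that is |Γ| < p^(3/4) when h = 1, and |A| < √p suffices for every h <
-- |A|².
--
-- Orders of vanishing are taken with respect to X (1 - X) d/dX. It keeps the exponents of X and 1 -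
-- X in place, so that they stay multiples of t and become constants on a class, and it raises the
-- degree of the coefficients by only 1 each time.
--
-- All estimates are inequalities between natural numbers, in squared or cubed form; roots and
-- logarithms appear only in the final translation to rationals.

-- From inequalities between natural numbers to upper reals.

module UpperReals where

  open import Defs
  open import Algebra.Definitions.RawSemiring using () renaming (_^_ to pow)
  open import Data.Integer using (+_)
  open import Data.Nat using (ℕ; suc)
  open import Data.Product using (_,_)
  open import Data.Rational
  open import Data.Rational.Properties
  open import Data.Rational.Solver using (module +-*-Solver)
  open import Relation.Nullary using (yes; no; contradiction)
  open import Relation.Binary.PropositionalEquality hiding ([_]; J)
  import Data.Integer as ℤ
  import Data.Integer.Properties as ℤ
  import Data.Nat as ℕ
  import Data.Nat.Coprimality as Coprime
  import Data.Nat.Properties as ℕ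
  import Data.Rational.Unnormalised as ℚᵘ
  import Data.Rational.Unnormalised.Properties as ℚᵘ

  ι : ℕ → ℚ
  ι n = + n / 1

  natural : ℕ → ℚ
  natural n = mkℚ (+ n) 0 (Coprime.sym (Coprime.1-coprimeTo n))

  -- `_/_` divides by a gcd that does not compute for a variable `n`; `natural n` is the same
  -- rational given in lowest terms, on which order and product do compute.
  ι≡natural : ∀ n → ι n ≡ natural n
  ι≡natural n = ↥p/↧p≡p (natural n)

  ι-* : ∀ m n → ι (m ℕ.* n) ≡ ι m * ι n
  ι-* m n = trans (cong (λ i → i / 1) (ℤ.pos-* m n)) (sym (cong₂ _*_ (ι≡natural m) (ι≡natural n)))

  ι-mono : ∀ {m n} → m ℕ.≤ n → ι m ≤ ι n
  ι-mono {m} {n} m≤n = subst₂ _≤_ (sym (ι≡natural m)) (sym (ι≡natural n))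
    (*≤* (ℤ.*-monoʳ-≤-nonNeg (+ 1) (ℤ.+≤+ m≤n)))

  0≤ι : ∀ n → 0ℚ ≤ ι n
  0≤ι n = ι-mono {0} {n} ℕ.z≤n

  0≤* : ∀ {x y} → 0ℚ ≤ x → 0ℚ ≤ y → 0ℚ ≤ x * y
  0≤* {x} {y} 0≤x 0≤y = nonNegative⁻¹ (x * y) {{nonNeg*nonNeg⇒nonNeg x {{nonNegative 0≤x}} y {{nonNegative 0≤y}}}}

  *-mono-≤ : ∀ {w x y z} → 0ℚ ≤ w → 0ℚ ≤ y → w ≤ x → y ≤ z → w * y ≤ x * z
  *-mono-≤ {w} {x} {y} {z} 0≤w 0≤y w≤x y≤z = ≤-trans (*-monoʳ-≤-nonNeg y {{nonNegative 0≤y}} w≤x)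
    (*-monoˡ-≤-nonNeg x {{nonNegative (≤-trans 0≤w w≤x)}} y≤z)

  square-cancel : ∀ {x y} → 0ℚ ≤ y → x * x ≤ y * y → x ≤ y
  square-cancel {x} {y} 0≤y le with x ≤? y
  ... | yes x≤y = x≤y
  ... | no  x≰y = contradiction (<-≤-trans (≤-<-trans (*-monoˡ-≤-nonNeg y {{nonNegative 0≤y}} (<⇒≤ y<x))
    (*-monoˡ-<-pos x {{positive (≤-<-trans 0≤y y<x)}} y<x)) le) (<-irrefl refl)
    where
    y<x = ≰⇒> x≰y

  cube-cancelℚ : ∀ {x y} → 0ℚ ≤ y → x * (x * x) ≤ y * (y * y) → x ≤ y
  cube-cancelℚ {x} {y} 0≤y le with x ≤? y
  ... | yes x≤y = x≤y
  ... | no  x≰y = contradiction (<-≤-trans (≤-<-trans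
    (*-monoˡ-≤-nonNeg y {{nonNegative 0≤y}} (*-mono-≤ 0≤y 0≤y (<⇒≤ y<x) (<⇒≤ y<x)))
    (*-monoˡ-<-pos (x * x) {{pos*pos⇒pos x {{0<x}} x {{0<x}}}} y<x)) le) (<-irrefl refl)
    where
    y<x = ≰⇒> x≰y
    0<x = positive (≤-<-trans 0≤y y<x)

  power-cancel : ∀ m n → 2 ℕ.^ m ℕ.≤ 2 ℕ.^ n → m ℕ.≤ n
  power-cancel m n le = ℕ.≮⇒≥ (λ n<m → ℕ.<⇒≱ (ℕ.^-monoʳ-< 2 (ℕ.s≤s (ℕ.s≤s ℕ.z≤n)) n<m) le)

  -- For l = N / d the hypothesis is g ^ d ≤ 2 ^ N. Raising 2 ^ j ≤ g ^ m to the power d gives 2 ^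
  -- (j d) ≤ 2 ^ (m N), and the exponents can be compared.
  log₂-lower : ∀ j g m l → log₂ g l → 2 ℕ.^ j ℕ.≤ g ℕ.^ m → ι j ≤ ι m * l
  log₂-lower j g m l@(mkℚ (+ N) d-1 _) (0≤l , g^d≤2^N) 2^j≤g^m =
    subst₂ (λ x y → x ≤ y * l) (sym (ι≡natural j)) (sym (ι≡natural m))
      (toℚᵘ-cancel-≤ (ℚᵘ.≤-trans (ℚᵘ.*≤* (subst₂ ℤ._≤_ left right (ℤ.+≤+ jd≤mN)))
        (ℚᵘ.≤-reflexive (ℚᵘ.≃-sym (toℚᵘ-homo-* (natural m) l)))))
    where
    open ℕ.≤-Reasoning
    d = suc d-1
    jd≤mN : j ℕ.* d ℕ.≤ m ℕ.* N
    jd≤mN = power-cancel (j ℕ.* d) (m ℕ.* N) (begin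
      2 ℕ.^ (j ℕ.* d)      ≡⟨ ℕ.^-*-assoc 2 j d ⟨
      (2 ℕ.^ j) ℕ.^ d      ≤⟨ ℕ.^-monoˡ-≤ d 2^j≤g^m ⟩
      (g ℕ.^ m) ℕ.^ d      ≡⟨ ℕ.^-*-assoc g m d ⟩
      g ℕ.^ (m ℕ.* d)      ≡⟨ cong (g ℕ.^_) (ℕ.*-comm m d) ⟩
      g ℕ.^ (d ℕ.* m)      ≡⟨ ℕ.^-*-assoc g d m ⟨
      (g ℕ.^ d) ℕ.^ m      ≤⟨ ℕ.^-monoˡ-≤ m g^d≤2^N ⟩
      (2 ℕ.^ N) ℕ.^ m      ≡⟨ ℕ.^-*-assoc 2 N m ⟩
      2 ℕ.^ (N ℕ.* m)      ≡⟨ cong (2 ℕ.^_) (ℕ.*-comm N m) ⟩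
      2 ℕ.^ (m ℕ.* N)      ∎)
    left : + (j ℕ.* d) ≡ + j ℤ.* + (1 ℕ.* d)
    left = trans (ℤ.pos-* j d) (cong (λ e → + j ℤ.* + e) (sym (ℕ.*-identityˡ d)))
    right : + (m ℕ.* N) ≡ (+ m ℤ.* + N) ℤ.* + 1
    right = trans (ℤ.pos-* m N) (sym (ℤ.*-identityʳ _))
  log₂-lower j g m (mkℚ ℤ.-[1+ N ] d-1 _) (*≤* () , _) _

  -- A rational in the product dominates a product of rationals above the factors: w with w³ ≥ g²,
  -- and l above the logarithm. The constant is C K because K ≤ K³ turns x³ ≤ K g² into x ≤ K w,
  -- with no cube root of K.
  sixth-power-bound : ∀ C K n t g x j → 1 ℕ.≤ K →
    n ℕ.^ 6 ℕ.≤ C ℕ.* (t ℕ.^ 4 ℕ.* (x ℕ.* j)) → x ℕ.* (x ℕ.* x) ℕ.≤ K ℕ.* g ℕ.^ 2 → 2 ℕ.^ j ℕ.≤ t →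
    n ℕ.^ 6 ≤ᴿ ⌜ C ℕ.* K ⌝ · ⌜ t ℕ.^ 4 ⌝ · root 3 ⌜ g ℕ.^ 2 ⌝ · log₂ t
  sixth-power-bound C K n t g x j 1≤K n⁶≤ x³≤ 2^j≤t q
    (u , l , (u₁ , w , (c , t₄ , ck≤c , t⁴≤t₄ , ct₄≤u₁) , (0≤w , g²≤w³) , u₁w≤u) , log@(0≤l , _) , ul≤q) = begin
      ι (n ℕ.^ 6)                                  ≤⟨ ι-mono n⁶≤ ⟩
      ι (C ℕ.* (t ℕ.^ 4 ℕ.* (x ℕ.* j)))            ≡⟨ trans (ι-* C (t ℕ.^ 4 ℕ.* (x ℕ.* j))) (cong (ι C *_) (trans (ι-* (t ℕ.^ 4) (x ℕ.* j)) (cong (ι (t ℕ.^ 4) *_) (ι-* x j)))) ⟩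
      ι C * (ι (t ℕ.^ 4) * (ι x * ι j))            ≤⟨ *-mono-≤ (0≤ι C) (0≤* (0≤ι (t ℕ.^ 4)) (0≤* (0≤ι x) (0≤ι j))) ≤-refl
                                                        (*-mono-≤ (0≤ι (t ℕ.^ 4)) (0≤* (0≤ι x) (0≤ι j)) ≤-refl (*-mono-≤ (0≤ι x) (0≤ι j) x≤Kw j≤l)) ⟩
      ι C * (ι (t ℕ.^ 4) * ((ι K * w) * l))        ≡⟨ solve 5 (λ c k t w l → c :* (t :* ((k :* w) :* l)) := c :* k :* t :* w :* l) refl (ι C) (ι K) (ι (t ℕ.^ 4)) w l ⟩
      ι C * ι K * ι (t ℕ.^ 4) * w * l              ≡⟨ cong (λ e → e * ι (t ℕ.^ 4) * w * l) (sym (ι-* C K)) ⟩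
      ι (C ℕ.* K) * ι (t ℕ.^ 4) * w * l            ≤⟨ *-mono-≤ (0≤* 0≤ct 0≤w) 0≤l (≤-trans (*-mono-≤ 0≤ct 0≤w (≤-trans
                                                        (*-mono-≤ (0≤ι (C ℕ.* K)) (0≤ι (t ℕ.^ 4)) ck≤c t⁴≤t₄) ct₄≤u₁) ≤-refl) u₁w≤u) ≤-refl ⟩
      u * l                                        ≤⟨ ul≤q ⟩
      q                                            ∎
    where
    open ≤-Reasoning
    open +-*-Solver
    0≤ct : 0ℚ ≤ ι (C ℕ.* K) * ι (t ℕ.^ 4)
    0≤ct = 0≤* (0≤ι (C ℕ.* K)) (0≤ι (t ℕ.^ 4))
    j≤l : ι j ≤ l
    j≤l = ≤-trans (log₂-lower j t 1 l log (ℕ.≤-trans 2^j≤t (ℕ.≤-reflexive (sym (ℕ.*-identityʳ t))))) (≤-reflexive (*-identityˡ l))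
    x≤Kw : ι x ≤ ι K * w
    x≤Kw = cube-cancelℚ (0≤* (0≤ι K) 0≤w) (begin
      ι x * (ι x * ι x)                    ≡⟨ trans (ι-* x (x ℕ.* x)) (cong (ι x *_) (ι-* x x)) ⟨
      ι (x ℕ.* (x ℕ.* x))                  ≤⟨ ι-mono x³≤ ⟩
      ι (K ℕ.* g ℕ.^ 2)                    ≡⟨ ι-* K (g ℕ.^ 2) ⟩
      ι K * ι (g ℕ.^ 2)                    ≤⟨ *-mono-≤ (0≤ι K) (0≤ι (g ℕ.^ 2)) (ι-mono K≤K³) g²≤w³ ⟩
      ι (K ℕ.* (K ℕ.* K)) * pow +-*-rawSemiring w 3
        ≡⟨ cong₂ _*_ (trans (ι-* K (K ℕ.* K)) (cong (ι K *_) (ι-* K K))) (cong (λ e → w * (w * e)) (*-identityʳ w)) ⟩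
      ι K * (ι K * ι K) * (w * (w * w))
        ≡⟨ solve 2 (λ k w → k :* (k :* k) :* (w :* (w :* w)) := (k :* w) :* ((k :* w) :* (k :* w))) refl (ι K) w ⟩
      ι K * w * (ι K * w * (ι K * w)) ∎)
      where
      K≤K³ : K ℕ.≤ K ℕ.* (K ℕ.* K)
      K≤K³ = ℕ.m≤m*n K (K ℕ.* K) {{ℕ.>-nonZero (ℕ.*-mono-≤ 1≤K 1≤K)}}

  -- Here w bounds the cube root of g itself, so x³ ≤ K g² gives x ≤ K w², and 2 ^ j ≤ g² gives j ≤
  -- 2 v². Hence t² ≤ D (w v)² with D = 2 C K, and D ≤ D² avoids the square root of D.
  square-bound : ∀ C K t g x j → 1 ℕ.≤ C → 1 ℕ.≤ K →
    t ℕ.* t ℕ.≤ C ℕ.* (x ℕ.* j) → x ℕ.* (x ℕ.* x) ℕ.≤ K ℕ.* (g ℕ.* g) → 2 ℕ.^ j ℕ.≤ g ℕ.^ 2 →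
    t ≤ᴿ ⌜ 2 ℕ.* (C ℕ.* K) ⌝ · root 3 ⌜ g ⌝ · root 2 (log₂ g)
  square-bound C K t g x j 1≤C 1≤K t²≤ x³≤ 2^j≤g² q
    (u , v , (c , w , D≤c , (0≤w , g≤w³) , cw≤u) , (0≤v , log) , uv≤q) = ≤-trans t≤ (≤-trans (*-mono-≤ (0≤* (0≤ι D) 0≤w) 0≤v
      (≤-trans (*-mono-≤ (0≤ι D) 0≤w D≤c ≤-refl) cw≤u) ≤-refl) uv≤q)
    where
    open ≤-Reasoning
    open +-*-Solver
    D = 2 ℕ.* (C ℕ.* K)
    D≤D² : D ℕ.≤ D ℕ.* D
    D≤D² = ℕ.m≤m*n D D {{ℕ.>-nonZero (ℕ.*-mono-≤ {1} {2} {1} (ℕ.s≤s ℕ.z≤n) (ℕ.*-mono-≤ 1≤C 1≤K))}}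
    K≤K³ : K ℕ.≤ K ℕ.* (K ℕ.* K)
    K≤K³ = ℕ.m≤m*n K (K ℕ.* K) {{ℕ.>-nonZero (ℕ.*-mono-≤ 1≤K 1≤K)}}
    cubed : ι g ≤ w * (w * w)
    cubed = ≤-trans g≤w³ (≤-reflexive (cong (λ e → w * (w * e)) (*-identityʳ w)))
    j≤2v² : ι j ≤ ι 2 * (v * v)
    j≤2v² = ≤-trans (log₂-lower j g 2 _ log 2^j≤g²) (≤-reflexive (cong (λ e → ι 2 * (v * e)) (*-identityʳ v)))
    x≤Kw² : ι x ≤ ι K * (w * w)
    x≤Kw² = cube-cancelℚ (0≤* (0≤ι K) (0≤* 0≤w 0≤w)) (begin
      ι x * (ι x * ι x)                    ≡⟨ trans (ι-* x (x ℕ.* x)) (cong (ι x *_) (ι-* x x)) ⟨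
      ι (x ℕ.* (x ℕ.* x))                  ≤⟨ ι-mono x³≤ ⟩
      ι (K ℕ.* (g ℕ.* g))                  ≡⟨ trans (ι-* K (g ℕ.* g)) (cong (ι K *_) (ι-* g g)) ⟩
      ι K * (ι g * ι g)                    ≤⟨ *-mono-≤ (0≤ι K) (0≤* (0≤ι g) (0≤ι g)) (ι-mono K≤K³) (*-mono-≤ (0≤ι g) (0≤ι g) cubed cubed) ⟩
      ι (K ℕ.* (K ℕ.* K)) * ((w * (w * w)) * (w * (w * w)))
        ≡⟨ cong (_* ((w * (w * w)) * (w * (w * w)))) (trans (ι-* K (K ℕ.* K)) (cong (ι K *_) (ι-* K K))) ⟩
      ι K * (ι K * ι K) * ((w * (w * w)) * (w * (w * w)))
        ≡⟨ solve 2 (λ k w → k :* (k :* k) :* ((w :* (w :* w)) :* (w :* (w :* w))) :=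
             (k :* (w :* w)) :* ((k :* (w :* w)) :* (k :* (w :* w)))) refl (ι K) w ⟩
      ι K * (w * w) * (ι K * (w * w) * (ι K * (w * w))) ∎)
    t≤ : ι t ≤ ι D * w * v
    t≤ = square-cancel (0≤* (0≤* (0≤ι D) 0≤w) 0≤v) (begin
      ι t * ι t                                        ≡⟨ ι-* t t ⟨
      ι (t ℕ.* t)                                      ≤⟨ ι-mono t²≤ ⟩
      ι (C ℕ.* (x ℕ.* j))                              ≡⟨ trans (ι-* C (x ℕ.* j)) (cong (ι C *_) (ι-* x j)) ⟩
      ι C * (ι x * ι j)                                ≤⟨ *-mono-≤ (0≤ι C) (0≤* (0≤ι x) (0≤ι j)) ≤-refl (*-mono-≤ (0≤ι x) (0≤ι j) x≤Kw² j≤2v²) ⟩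
      ι C * ((ι K * (w * w)) * (ι 2 * (v * v)))        ≡⟨ solve 5 (λ c k z w v → c :* ((k :* (w :* w)) :* (z :* (v :* v))) :=
                                                            (z :* (c :* k)) :* ((w :* v) :* (w :* v))) refl (ι C) (ι K) (ι 2) w v ⟩
      (ι 2 * (ι C * ι K)) * ((w * v) * (w * v))        ≡⟨ cong (_* ((w * v) * (w * v))) (trans (ι-* 2 (C ℕ.* K)) (cong (ι 2 *_) (ι-* C K))) ⟨
      ι D * ((w * v) * (w * v))                        ≤⟨ *-mono-≤ (0≤ι D) (0≤* (0≤* 0≤w 0≤v) (0≤* 0≤w 0≤v)) (ι-mono D≤D²) ≤-refl ⟩
      ι (D ℕ.* D) * ((w * v) * (w * v))                ≡⟨ cong (_* ((w * v) * (w * v))) (ι-* D D) ⟩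
      (ι D * ι D) * ((w * v) * (w * v))                ≡⟨ solve 3 (λ d w v → (d :* d) :* ((w :* v) :* (w :* v)) := (d :* w :* v) :* (d :* w :* v)) refl (ι D) w v ⟩
      (ι D * w * v) * (ι D * w * v)                    ∎)

-- Arithmetic of the parameters in Stepanov's method.

module NaturalBounds where

  open import Data.Nat
  open import Data.Nat.Properties
  open import Data.Nat.Solver using (module +-*-Solver)
  open import Data.Product using (_,_; proj₁; proj₂; ∃-syntax; _×_)
  open import Relation.Nullary using (¬_; yes; no; contradiction)
  open import Relation.Unary using (Decidable)
  open import Relation.Binary.PropositionalEquality
  open +-*-Solver

  -- A downward search. It replaces the rounding of a real parameter: the inequality holds at d and
  -- fails at d + 1 ≤ 2 d, which pins the parameter down to a constant factor.
  last-true : ∀ {P : ℕ → Set} → Decidable P → ∀ n → P 1 → ¬ P (suc n) → ∃[ d ] (1 ≤ d × P d × ¬ P (suc d))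
  last-true P? zero    P1 ¬P = contradiction P1 ¬P
  last-true P? (suc n) P1 ¬P with P? (suc n)
  ... | yes Pn = suc n , s≤s z≤n , Pn , ¬P
  ... | no ¬Pn = last-true P? n P1 ¬Pn

  square-mono : ∀ {m n} → m ≤ n → m * m ≤ n * n
  square-mono m≤n = *-mono-≤ m≤n m≤n

  cube : ℕ → ℕ
  cube n = n * (n * n)

  cube-mono : ∀ {m n} → m ≤ n → cube m ≤ cube n
  cube-mono m≤n = *-mono-≤ m≤n (square-mono m≤n)

  cube-cancel : ∀ {m n} → cube m ≤ cube n → m ≤ n
  cube-cancel {m} {n} le with m ≤? n
  ... | yes m≤n = m≤n
  ... | no  m≰n = contradiction le (<⇒≱ (*-mono-< (≰⇒> m≰n) (*-mono-< (≰⇒> m≰n) (≰⇒> m≰n))))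

  -- A Stepanov polynomial with parameters D = d, A = a d, B ≈ t / A and d ≈ (t² / Q h)^(1/3) has
  -- (t B)³ ≤ (8 Q / a³) h t⁴, so a must be large enough for the rounding losses not to exceed p³.
  module Parameters (a : ℕ) (1≤a : 1 ≤ a) (27≤a³ : 27 ≤ cube a) (8Q≤a³ : 8 * (4 * a * (a + 1)) ≤ cube a) where

    private instance
      a≢0 : NonZero a
      a≢0 = >-nonZero 1≤a

    -- Multiplied by `4 * a * d`, the inequality `count` of `Choice` becomes an upper bound of
    -- `Q * h * cube d` by (2 A B)²; this dictates `Q`. The square in `K` comes from using t² ≤ 8 Q
    -- h d³ twice in `outcome`.
    Q K : ℕ
    Q = 4 * a * (a + 1)
    K = (8 * Q) * (8 * Q)

    1≤Q : 1 ≤ Q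
    1≤Q = *-mono-≤ {1} {4 * a} {1} (*-mono-≤ {1} {4} {1} (s≤s z≤n) 1≤a) (m≤n+m 1 a)

    -- The bound for τ³ when the number of classes is at the limit of the method. It also dominates
    -- `K` and `Q`, so that one constant serves all cases of the level estimate.
    M : ℕ
    M = 2 * (K * Q)

    1≤K : 1 ≤ K
    1≤K = *-mono-≤ {1} {8 * Q} {1} (*-mono-≤ {1} {8} {1} (s≤s z≤n) 1≤Q) (*-mono-≤ {1} {8} {1} (s≤s z≤n) 1≤Q)

    K≤M : K ≤ M
    K≤M = ≤-trans (m≤m*n K Q {{>-nonZero 1≤Q}}) (m≤n*m (K * Q) 2)

    Q≤M : Q ≤ M
    Q≤M = ≤-trans (m≤n*m Q K {{>-nonZero 1≤K}}) (m≤n*m (K * Q) 2)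

    -- Here s is the size of a union of h classes with at least τ points each. From s² n τ² ≤ s³ τ²
    -- ≤ K T (h τ)² ≤ K T s² the number of classes disappears.
    scale-out : ∀ s h τ n T → cube s ≤ K * (h * h * T) → h * τ ≤ s → n ≤ s → n * (τ * τ) ≤ K * T
    scale-out zero      h τ n T _   _    n≤s rewrite n≤0⇒n≡0 n≤s = z≤n
    scale-out s@(suc _) h τ n T s³≤ hτ≤s n≤s = *-cancelˡ-≤ (s * s) (begin
      s * s * (n * (τ * τ))        ≤⟨ *-monoʳ-≤ (s * s) (*-monoˡ-≤ (τ * τ) n≤s) ⟩
      s * s * (s * (τ * τ))        ≡⟨ solve 2 (λ s t → s :* s :* (s :* (t :* t)) := s :* (s :* s) :* (t :* t)) refl s τ ⟩
      cube s * (τ * τ)                 ≤⟨ *-monoˡ-≤ (τ * τ) s³≤ ⟩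
      K * (h * h * T) * (τ * τ)  ≡⟨ solve 4 (λ k h u t → k :* (h :* h :* u) :* (t :* t) := (h :* t) :* (h :* t) :* (k :* u)) refl K h T τ ⟩
      (h * τ) * (h * τ) * (K * T) ≤⟨ *-monoˡ-≤ (K * T) (square-mono hτ≤s) ⟩
      s * s * (K * T)                ∎)
      where open ≤-Reasoning

    -- If h is as large as T up to a constant, the same data bound τ itself: (h τ)³ ≤ s³ ≤ K h² T ≤
    -- M h³.
    scale-small : ∀ s h τ T → cube s ≤ K * (h * h * T) → h * τ ≤ s → 1 ≤ h → T ≤ 2 * (Q * h) → τ ≤ M
    scale-small s h zero      T _   _    _   _     = z≤n
    scale-small s h τ@(suc _) T s³≤ hτ≤s 1≤h T≤2Qh = ≤-trans (m≤m*n τ (τ * τ))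
      (*-cancelˡ-≤ (h * (h * h)) {{m*n≢0 h (h * h) {{h≢0}} {{m*n≢0 h h {{h≢0}} {{h≢0}}}}}} (begin
        h * (h * h) * cube τ               ≡⟨ solve 2 (λ h t → h :* (h :* h) :* (t :* (t :* t)) := (h :* t) :* ((h :* t) :* (h :* t))) refl h τ ⟩
        cube (h * τ)                           ≤⟨ cube-mono hτ≤s ⟩
        cube s                                   ≤⟨ s³≤ ⟩
        K * (h * h * T)                    ≤⟨ *-monoʳ-≤ K (*-monoʳ-≤ (h * h) T≤2Qh) ⟩
        K * (h * h * (2 * (Q * h)))    ≡⟨ solve 3 (λ k q h → k :* (h :* h :* (con 2 :* (q :* h))) := h :* (h :* h) :* (con 2 :* (k :* q))) refl K Q h ⟩
        h * (h * h) * M                    ∎))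
      where
      open ≤-Reasoning
      h≢0 = >-nonZero 1≤h

    opaque
      -- 512 = 8² * 2 * 4: the 8 is that of n² ≤ 8 k (k - 1), the 2 that of j + 1 ≤ 2 j, and the 4
      -- is the loss in the dyadic sum. Opaque, so that the product with the literal is not
      -- unfolded.
      C : ℕ
      C = 512 * M

      C-def : C ≡ 512 * M
      C-def = refl

      1≤C : 1 ≤ C
      1≤C = *-mono-≤ {1} {512} {1} (s≤s z≤n) (≤-trans 1≤K K≤M)

    -- `A` bounds the degrees of the coefficient polynomials, `B` is the number of exponents of X
    -- and of 1 - X, and `D` is the order of vanishing. `count` compares conditions with unknowns,
    -- and `outcome` turns the degree bound into an estimate for s points.
    record Choice (t h p : ℕ) : Set where
      field
        A B D   : ℕ
        A≤t     : A ≤ t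
        AB≤t    : A * B ≤ t
        tB≤p    : t * B ≤ p
        D≤A     : D ≤ A
        count   : h * (D * (A + D)) < B * (B * A)
        outcome : ∀ s → s * D ≤ t * B + (t * B + A) → cube s ≤ K * (h * h * (t * t))

    choice : ∀ t h p → 1 ≤ h → Q * h < t * t → h * (t * t * (t * t)) ≤ cube p → Choice t h p
    choice t h p 1≤h Qh<t² ht⁴≤p³ = record
      { A = A ; B = B ; D = d ; A≤t = A≤t ; AB≤t = AB≤t ; tB≤p = tB≤p
      ; D≤A = m≤n*m d a ; count = count ; outcome = outcome }
      where
      open ≤-Reasoning
      instance
        h≢0 : NonZero h
        h≢0 = >-nonZero 1≤h
        Q≢0 : NonZero Q
        Q≢0 = >-nonZero 1≤Q

      -- The hypothesis Q h < t² is the case d = 1, so the order of vanishing is at least 1. The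
      -- search starts at t², where the inequality already fails for the successor.
      d-spec : ∃[ d ] (1 ≤ d × Q * h * cube d < t * t × ¬ (Q * h * cube (suc d) < t * t))
      d-spec = last-true {λ d → Q * h * cube d < t * t} (λ d → Q * h * cube d <? t * t) (t * t)
        (≤-<-trans (≤-reflexive (*-identityʳ (Q * h))) Qh<t²)
        (≤⇒≯ (begin
          t * t                        ≤⟨ n≤1+n (t * t) ⟩
          suc (t * t)                  ≤⟨ m≤m*n (suc (t * t)) (suc (t * t) * suc (t * t)) ⟩
          cube (suc (t * t))           ≤⟨ m≤n*m (cube (suc (t * t))) (Q * h) {{m*n≢0 Q h}} ⟩
          Q * h * cube (suc (t * t))   ∎))

      d : ℕ
      d = proj₁ d-spec

      1≤d : 1 ≤ d
      1≤d = proj₁ (proj₂ d-spec)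

      Qhd³<t² : Q * h * cube d < t * t
      Qhd³<t² = proj₁ (proj₂ (proj₂ d-spec))

      instance
        d≢0 : NonZero d
        d≢0 = >-nonZero 1≤d

      t²≤8Qhd³ : t * t ≤ 8 * (Q * h * cube d)
      t²≤8Qhd³ = begin
        t * t                      ≤⟨ ≮⇒≥ (proj₂ (proj₂ (proj₂ d-spec))) ⟩
        Q * h * cube (1 + d)       ≤⟨ *-monoʳ-≤ (Q * h) (cube-mono (+-monoˡ-≤ d 1≤d)) ⟩
        Q * h * cube (d + d)       ≡⟨ solve 2 (λ q d → q :* ((d :+ d) :* ((d :+ d) :* (d :+ d))) := con 8 :* (q :* (d :* (d :* d)))) refl (Q * h) d ⟩
        8 * (Q * h * cube d)       ∎

      A : ℕ
      A = a * d

      A≤t : A ≤ t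
      A≤t = ≮⇒≥ λ t<A → <⇒≱ Qhd³<t² (begin
        t * t                        ≤⟨ square-mono (<⇒≤ t<A) ⟩
        A * A                        ≡⟨ solve 2 (λ a d → (a :* d) :* (a :* d) := a :* a :* (d :* d)) refl a d ⟩
        a * a * (d * d)              ≤⟨ *-mono-≤ a²≤Q (m≤n*m (d * d) d) ⟩
        Q * cube d                   ≤⟨ *-monoˡ-≤ (cube d) (m≤m*n Q h) ⟩
        Q * h * cube d               ∎)
        where
        a²≤Q : a * a ≤ Q
        a²≤Q = *-mono-≤ (m≤n*m a 4) (m≤m+n a 1)

      B-spec : ∃[ B ] (1 ≤ B × A * B ≤ t × ¬ (A * suc B ≤ t))
      B-spec = last-true {λ B → A * B ≤ t} (λ B → A * B ≤? t) t
        (≤-trans (≤-reflexive (*-identityʳ A)) A≤t)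
        (<⇒≱ (m≤n*m (suc t) A {{m*n≢0 a d}}))

      B : ℕ
      B = proj₁ B-spec

      1≤B : 1 ≤ B
      1≤B = proj₁ (proj₂ B-spec)

      AB≤t : A * B ≤ t
      AB≤t = proj₁ (proj₂ (proj₂ B-spec))

      t≤2AB : t ≤ 2 * (A * B)
      t≤2AB = begin
        t               ≤⟨ <⇒≤ (≰⇒> (proj₂ (proj₂ (proj₂ B-spec)))) ⟩
        A * (1 + B)     ≤⟨ *-monoʳ-≤ A (+-monoˡ-≤ B 1≤B) ⟩
        A * (B + B)     ≡⟨ solve 2 (λ a b → a :* (b :+ b) := con 2 :* (a :* b)) refl A B ⟩
        2 * (A * B)     ∎

      count : h * (d * (A + d)) < B * (B * A)
      count = *-cancelˡ-< (4 * a * d) _ _ (begin-strict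
        4 * a * d * (h * (d * (a * d + d)))
          ≡⟨ solve 3 (λ a d h → con 4 :* a :* d :* (h :* (d :* (a :* d :+ d))) :=
               con 4 :* a :* (a :+ con 1) :* h :* (d :* (d :* d))) refl a d h ⟩
        Q * h * cube d
          <⟨ Qhd³<t² ⟩
        t * t
          ≤⟨ square-mono t≤2AB ⟩
        2 * (a * d * B) * (2 * (a * d * B))
          ≡⟨ solve 3 (λ a d b → con 2 :* (a :* d :* b) :* (con 2 :* (a :* d :* b)) :=
               con 4 :* a :* d :* (b :* (b :* (a :* d)))) refl a d B ⟩
        4 * a * d * (B * (B * A)) ∎)

      instance
        a³≢0 : NonZero (cube a)
        a³≢0 = m*n≢0 a (a * a) {{a≢0}} {{m*n≢0 a a}}
        d³≢0 : NonZero (cube d)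
        d³≢0 = m*n≢0 d (d * d) {{d≢0}} {{m*n≢0 d d}}

      tBA≤t² : t * B * A ≤ t * t
      tBA≤t² = begin
        t * B * A    ≡⟨ solve 3 (λ t a b → t :* b :* a := t :* (a :* b)) refl t A B ⟩
        t * (A * B)  ≤⟨ *-monoʳ-≤ t AB≤t ⟩
        t * t        ∎

      -- As t B A ≤ t², its cube is at most t² t⁴ ≤ 8 Q h d³ t⁴ ≤ 8 Q d³ p³, and 8 Q ≤ a³ makes this
      -- at most A³ p³.
      tB≤p : t * B ≤ p
      tB≤p = cube-cancel (≤-trans (*-cancelˡ-≤ (cube a * cube d) {{m*n≢0 (cube a) (cube d)}} (begin
        cube a * cube d * cube (t * B)
          ≡⟨ solve 3 (λ a d x → a :* (a :* a) :* (d :* (d :* d)) :* (x :* (x :* x)) :=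
               (x :* (a :* d)) :* ((x :* (a :* d)) :* (x :* (a :* d)))) refl a d (t * B) ⟩
        cube (t * B * A)
          ≤⟨ cube-mono tBA≤t² ⟩
        t * t * (t * t * (t * t))
          ≤⟨ *-monoˡ-≤ (t * t * (t * t)) t²≤8Qhd³ ⟩
        8 * (Q * h * cube d) * (t * t * (t * t))
          ≡⟨ solve 4 (λ q h d t → con 8 :* (q :* h :* d) :* t := con 8 :* q :* d :* (h :* t)) refl Q h (cube d) (t * t * (t * t)) ⟩
        8 * Q * cube d * (h * (t * t * (t * t)))
          ≤⟨ *-monoˡ-≤ (h * (t * t * (t * t))) (*-monoˡ-≤ (cube d) 8Q≤a³) ⟩
        cube a * cube d * (h * (t * t * (t * t))) ∎)) ht⁴≤p³)

      -- s d A ≤ 3 t² is cubed, and two of the three factors t² are replaced by 8 Q h d³, so that d⁶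
      -- cancels; 27 is absorbed by a³.
      outcome : ∀ s → s * d ≤ t * B + (t * B + A) → cube s ≤ K * (h * h * (t * t))
      outcome s le = *-cancelˡ-≤ (cube a * (cube d * cube d))
        {{m*n≢0 (cube a) (cube d * cube d) {{a³≢0}} {{m*n≢0 (cube d) (cube d)}}}} (begin
          cube a * (cube d * cube d) * cube s
            ≡⟨ solve 3 (λ a d s → a :* (a :* a) :* (d :* (d :* d) :* (d :* (d :* d))) :* (s :* (s :* s)) :=
                 (s :* d :* (a :* d)) :* ((s :* d :* (a :* d)) :* (s :* d :* (a :* d)))) refl a d s ⟩
          cube (s * d * A)
            ≤⟨ cube-mono sdA≤3t² ⟩
          cube (3 * (t * t))
            ≡⟨ solve 1 (λ x → (con 3 :* x) :* ((con 3 :* x) :* (con 3 :* x)) := con 27 :* (x :* (x :* x))) refl (t * t) ⟩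
          27 * (t * t * (t * t * (t * t)))
            ≤⟨ *-mono-≤ 27≤a³ (*-monoʳ-≤ (t * t) (square-mono t²≤8Qhd³)) ⟩
          cube a * (t * t * (8 * (Q * h * cube d) * (8 * (Q * h * cube d))))
            ≡⟨ solve 5 (λ a t q h d → a :* (t :* (con 8 :* (q :* h :* d) :* (con 8 :* (q :* h :* d)))) :=
                 a :* (d :* d) :* ((con 8 :* q) :* (con 8 :* q) :* (h :* h :* t))) refl (cube a) (t * t) Q h (cube d) ⟩
          cube a * (cube d * cube d) * (K * (h * h * (t * t))) ∎)
        where
        A≤tB : A ≤ t * B
        A≤tB = ≤-trans A≤t (m≤m*n t B {{>-nonZero 1≤B}})
        sdA≤3t² : s * d * A ≤ 3 * (t * t)
        sdA≤3t² = begin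
          s * d * A                          ≤⟨ *-monoˡ-≤ A (≤-trans le (+-monoʳ-≤ (t * B) (+-monoʳ-≤ (t * B) A≤tB))) ⟩
          (t * B + (t * B + t * B)) * A      ≡⟨ solve 2 (λ x a → (x :+ (x :+ x)) :* a := con 3 :* (x :* a)) refl (t * B) A ⟩
          3 * (t * B * A)                    ≤⟨ *-monoʳ-≤ 3 tBA≤t² ⟩
          3 * (t * t)                        ∎

-- Counting with duplicate-free lists, Cauchy-Schwarz and dyadic summation.

module FiniteLists where

  open import Data.Nat using (ℕ; zero; suc; _+_; _*_; _≤_; _<_; _^_; z≤n; _≤?_)
  open import Data.Nat.Properties
  open import Data.Nat.Solver using (module +-*-Solver)
  open import Data.Fin using (Fin; zero; suc)
  import Data.Fin.Properties as Fin
  open import Data.Fin.Subset using (Subset; ∣_∣; inside; outside) renaming (_∈_ to _∈ˢ_)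
  open import Data.Vec using ([]; _∷_; here; there)
  open import Data.List using (List; []; _∷_; length; map; filter; concatMap; _++_; cartesianProduct)
  open import Data.Nat.ListAction using (sum)
  open import Data.List.Properties using (length-++; length-map)
  open import Data.List.Membership.Propositional using (_∈_)
  open import Data.List.Membership.Propositional.Properties
  open import Data.List.Relation.Unary.Any using (here; there)
  open import Data.List.Relation.Unary.All as All using (All; []; _∷_)
  import Data.List.Relation.Unary.All.Properties as All
  open import Data.List.Relation.Unary.AllPairs using ([]; _∷_)
  open import Data.List.Relation.Unary.Unique.Propositional using (Unique)
  import Data.List.Relation.Unary.Unique.Propositional.Properties as Unique
  open import Data.List.Relation.Binary.Permutation.Propositional using (_↭_; prep; ↭-refl; ↭-trans)
  open import Data.List.Relation.Binary.Permutation.Propositional.Properties using (shift; ↭-length; ∈-resp-↭)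
  open import Data.List.Relation.Binary.Disjoint.Propositional using (Disjoint)
  open import Data.Product using (_,_; ∃-syntax)
  open import Data.Sum using (inj₁; inj₂)
  open import Relation.Nullary using (Dec; yes; no; contradiction; ¬?)
  open import Relation.Unary using (Decidable)
  open import Relation.Binary.Definitions using (DecidableEquality)
  open import Relation.Binary.PropositionalEquality hiding ([_]; J)
  open +-*-Solver

  private
    variable
      I I′ : Set

  elements : ∀ {n} → Subset n → List (Fin n)
  elements []            = []
  elements (inside  ∷ S) = zero ∷ map suc (elements S)
  elements (outside ∷ S) = map suc (elements S)

  length-elements : ∀ {n} (S : Subset n) → length (elements S) ≡ ∣ S ∣
  length-elements []            = refl
  length-elements (inside  ∷ S) = cong suc (trans (length-map suc (elements S)) (length-elements S))
  length-elements (outside ∷ S) = trans (length-map suc (elements S)) (length-elements S)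

  ∈-elements⁺ : ∀ {n} {S : Subset n} {x} → x ∈ˢ S → x ∈ elements S
  ∈-elements⁺ {S = inside  ∷ S} here       = here refl
  ∈-elements⁺ {S = inside  ∷ S} (there x∈) = there (∈-map⁺ suc (∈-elements⁺ x∈))
  ∈-elements⁺ {S = outside ∷ S} (there x∈) = ∈-map⁺ suc (∈-elements⁺ x∈)

  ∈-elements⁻ : ∀ {n} {S : Subset n} {x} → x ∈ elements S → x ∈ˢ S
  ∈-elements⁻ {S = inside  ∷ S} (here refl) = here
  ∈-elements⁻ {S = inside  ∷ S} (there x∈) with ∈-map⁻ suc x∈
  ... | y , y∈ , refl = there (∈-elements⁻ y∈)
  ∈-elements⁻ {S = outside ∷ S} x∈ with ∈-map⁻ suc x∈
  ... | y , y∈ , refl = there (∈-elements⁻ y∈)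

  elements-unique : ∀ {n} (S : Subset n) → Unique (elements S)
  elements-unique []            = []
  elements-unique (inside  ∷ S) =
    All.map⁺ (All.tabulate (λ _ ())) ∷ Unique.map⁺ Fin.suc-injective (elements-unique S)
  elements-unique (outside ∷ S) = Unique.map⁺ Fin.suc-injective (elements-unique S)

  -- The remainder `zs` is kept for two uses: forgetting it compares the lengths, and if the lengths
  -- agree it is empty and `ys` is a rearrangement of `xs`.
  unique-⊆-↭ : ∀ {xs ys : List I} → Unique xs → (∀ {x} → x ∈ xs → x ∈ ys) → ∃[ zs ] ys ↭ xs ++ zs
  unique-⊆-↭ {xs = []} {ys} _ _ = ys , ↭-refl
  unique-⊆-↭ {xs = x ∷ xs} {ys} (x≢ ∷ u) sub with ∈-∃++ (sub (here refl))
  ... | us , vs , refl with unique-⊆-↭ {ys = us ++ vs} u sub′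
    where
    sub′ : ∀ {y} → y ∈ xs → y ∈ us ++ vs
    sub′ {y} y∈ with ∈-resp-↭ (shift x us vs) (sub (there y∈))
    ... | here refl = contradiction refl (All.lookup x≢ y∈)
    ... | there y∈′ = y∈′
  ... | zs , p = zs , ↭-trans (shift x us vs) (prep x p)

  unique-⊆-length : ∀ {xs ys : List I} → Unique xs → (∀ {x} → x ∈ xs → x ∈ ys) → length xs ≤ length ys
  unique-⊆-length {xs = xs} u sub with unique-⊆-↭ u sub
  ... | zs , p = ≤-trans (≤-trans (m≤m+n (length xs) (length zs)) (≤-reflexive (sym (length-++ xs))))
    (≤-reflexive (sym (↭-length p)))

  map-unique : ∀ {f : I → I′} {xs} → Unique xs →
    (∀ {x y} → x ∈ xs → y ∈ xs → f x ≡ f y → x ≡ y) → Unique (map f xs)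
  map-unique [] inj = []
  map-unique (x≢ ∷ u) inj =
    All.map⁺ (All.tabulate (λ y∈ e → All.lookup x≢ y∈ (inj (here refl) (there y∈) e))) ∷
    map-unique u (λ x∈ y∈ → inj (there x∈) (there y∈))

  length-concatMap : ∀ (f : I → List I′) xs → length (concatMap f xs) ≡ sum (map (λ x → length (f x)) xs)
  length-concatMap f []       = refl
  length-concatMap f (x ∷ xs) = trans (length-++ (f x)) (cong (length (f x) +_) (length-concatMap f xs))

  concatMap-unique : ∀ {f : I → List I′} {xs} → Unique xs → (∀ {x} → x ∈ xs → Unique (f x)) →
    (∀ {x y z} → x ∈ xs → y ∈ xs → z ∈ f x → z ∈ f y → x ≡ y) → Unique (concatMap f xs)
  concatMap-unique {xs = []}     _        _ _ = []
  concatMap-unique {f = f} {x ∷ xs} (x≢ ∷ u) unique disjoint = Unique.++⁺ (unique (here refl))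
    (concatMap-unique u (λ x∈ → unique (there x∈)) (λ x∈ y∈ → disjoint (there x∈) (there y∈))) apart
    where
    open import Data.List.Membership.Propositional using (find)
    apart : Disjoint (f x) (concatMap f xs)
    apart (z∈ , z∈′) with find (∈-concatMap⁻ f z∈′)
    ... | y , y∈ , z∈y = All.lookup x≢ y∈ (disjoint (here refl) (there y∈) z∈ z∈y)

  -- Every double count below takes this form. Disjointness is phrased as recovery of the index from
  -- a common element, which is what an injectivity argument delivers.
  disjoint-union-length : ∀ (f : I → List I′) {xs ys} → Unique xs → (∀ {x} → x ∈ xs → Unique (f x)) →
    (∀ {x y z} → x ∈ xs → y ∈ xs → z ∈ f x → z ∈ f y → x ≡ y) →
    (∀ {x z} → x ∈ xs → z ∈ f x → z ∈ ys) → sum (map (λ x → length (f x)) xs) ≤ length ys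
  disjoint-union-length f {xs} {ys} u unique disjoint sub =
    ≤-trans (≤-reflexive (sym (length-concatMap f xs)))
      (unique-⊆-length (concatMap-unique u unique disjoint) sub′)
    where
    open import Data.List.Membership.Propositional using (find)
    sub′ : ∀ {z} → z ∈ concatMap f xs → z ∈ ys
    sub′ z∈ with find (∈-concatMap⁻ f z∈)
    ... | x , x∈ , z∈x = sub x∈ z∈x

  sum-lower : ∀ (f : I → ℕ) τ xs → (∀ {x} → x ∈ xs → τ ≤ f x) → length xs * τ ≤ sum (map f xs)
  sum-lower f τ []       h = z≤n
  sum-lower f τ (x ∷ xs) h = +-mono-≤ (h (here refl)) (sum-lower f τ xs (λ x∈ → h (there x∈)))

  sum-mono : ∀ (f g : I → ℕ) xs → (∀ {x} → x ∈ xs → f x ≤ g x) → sum (map f xs) ≤ sum (map g xs)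
  sum-mono f g []       h = z≤n
  sum-mono f g (x ∷ xs) h = +-mono-≤ (h (here refl)) (sum-mono f g xs (λ x∈ → h (there x∈)))

  length-cartesianProduct : ∀ (xs : List I) (ys : List I′) → length (cartesianProduct xs ys) ≡ length xs * length ys
  length-cartesianProduct []       ys = refl
  length-cartesianProduct (x ∷ xs) ys = trans (length-++ (map (x ,_) ys))
    (cong₂ _+_ (length-map (x ,_) ys) (length-cartesianProduct xs ys))

  2mn≤m²+n² : ∀ m n → 2 * (m * n) ≤ m * m + n * n
  2mn≤m²+n² m n with ≤-total m n
  ... | inj₁ m≤n with k , refl ← m≤n⇒∃[o]m+o≡n m≤n = ≤-trans (m≤m+n _ (k * k)) (≤-reflexive
    (solve 2 (λ m k → con 2 :* (m :* (m :+ k)) :+ k :* k := m :* m :+ (m :+ k) :* (m :+ k)) refl m k))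
  ... | inj₂ n≤m with k , refl ← m≤n⇒∃[o]m+o≡n n≤m = ≤-trans (m≤m+n _ (k * k)) (≤-reflexive
    (solve 2 (λ n k → con 2 :* ((n :+ k) :* n) :+ k :* k := (n :+ k) :* (n :+ k) :+ n :* n) refl n k))

  -- Induction on the list. Adding a to the sum s produces the cross term 2 a s, and 2 (l a) s ≤ (l
  -- a)² + s² divided by the length l bounds it by l a² + q. For l = 0 the sum s is 0.
  cauchy-schwarz : ∀ (f : I → ℕ) xs →
    sum (map f xs) * sum (map f xs) ≤ length xs * sum (map (λ x → f x * f x) xs)
  cauchy-schwarz f []       = z≤n
  cauchy-schwarz f (x ∷ xs) = begin
    (a + s) * (a + s)
      ≡⟨ solve 2 (λ a s → (a :+ s) :* (a :+ s) := a :* a :+ (con 2 :* (a :* s) :+ s :* s)) refl a s ⟩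
    a * a + (2 * (a * s) + s * s)
      ≤⟨ +-monoʳ-≤ (a * a) (+-mono-≤ (cross (length xs) q (cauchy-schwarz f xs)) (cauchy-schwarz f xs)) ⟩
    a * a + ((length xs * (a * a) + q) + length xs * q)
      ≡⟨ solve 3 (λ a l q → a :* a :+ ((l :* (a :* a) :+ q) :+ l :* q) := (con 1 :+ l) :* (a :* a :+ q)) refl a (length xs) q ⟩
    suc (length xs) * (a * a + q) ∎
    where
    open ≤-Reasoning
    a = f x
    s = sum (map f xs)
    q = sum (map (λ x → f x * f x) xs)
    cross : ∀ l q → s * s ≤ l * q → 2 * (a * s) ≤ l * (a * a) + q
    cross zero    q s²≤0 with m*n≡0⇒m≡0∨n≡0 s {s} (n≤0⇒n≡0 s²≤0)
    ... | inj₁ s≡0 rewrite s≡0 | *-zeroʳ a = z≤n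
    ... | inj₂ s≡0 rewrite s≡0 | *-zeroʳ a = z≤n
    cross l@(suc _) q s²≤lq = *-cancelˡ-≤ l (begin
      l * (2 * (a * s))                ≡⟨ solve 3 (λ l a s → l :* (con 2 :* (a :* s)) := con 2 :* ((l :* a) :* s)) refl l a s ⟩
      2 * ((l * a) * s)                ≤⟨ 2mn≤m²+n² (l * a) s ⟩
      (l * a) * (l * a) + s * s        ≤⟨ +-monoʳ-≤ ((l * a) * (l * a)) s²≤lq ⟩
      (l * a) * (l * a) + l * q        ≡⟨ solve 3 (λ l a q → (l :* a) :* (l :* a) :+ l :* q := l :* (l :* (a :* a) :+ q)) refl l a q ⟩
      l * (l * (a * a) + q)            ∎)

  infix 5 _if_plus_
  -- The decision is an explicit argument, so that a proof can split on it without abstracting over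
  -- the surrounding term.
  _if_plus_ : ∀ {P : Set} → ℕ → Dec P → ℕ → ℕ
  c if yes _ plus n = c + n
  c if no  _ plus n = n

  sum-if : ∀ {P : I → Set} (P? : Decidable P) c g xs →
    sum (map (λ x → c if P? x plus g x) xs) ≡ length (filter P? xs) * c + sum (map g xs)
  sum-if P? c g []       = refl
  sum-if P? c g (x ∷ xs) with P? x
  ... | yes _ = trans (cong (c + g x +_) (sum-if P? c g xs))
    (solve 4 (λ a m l s → (a :+ m) :+ (l :* a :+ s) := (con 1 :+ l) :* a :+ (m :+ s)) refl
      c (g x) (length (filter P? xs)) (sum (map g xs)))
  ... | no  _ = trans (cong (g x +_) (sum-if P? c g xs))
    (solve 3 (λ m l s → m :+ (l :+ s) := l :+ (m :+ s)) refl (g x) (length (filter P? xs) * c) (sum (map g xs)))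

  -- f² is at most the sum of 4 * 4 ^ j over the j < k with 2 ^ j ≤ f, since the largest such j has
  -- f < 2 * 2 ^ j. Exchanging the summations, each of the k levels contributes at most 4 C.
  dyadic : ∀ (f : I → ℕ) C xs k → (∀ {x} → x ∈ xs → f x < 2 ^ k) →
    (∀ j → length (filter (λ x → 2 ^ j ≤? f x) xs) * (2 ^ j * 2 ^ j) ≤ C) →
    sum (map (λ x → f x * f x) xs) ≤ k * (4 * C)
  dyadic {I} f C xs k small level =
    ≤-trans (sum-mono (λ x → f x * f x) (majorant k) xs (λ x∈ → pointwise k (small x∈))) (total k xs level)
    where
    open ≤-Reasoning
    majorant : ℕ → I → ℕ
    majorant zero    x = 0
    majorant (suc j) x = 4 * (2 ^ j * 2 ^ j) if 2 ^ j ≤? f x plus majorant j x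

    pointwise : ∀ k {x} → f x < 2 ^ k → f x * f x ≤ majorant k x
    pointwise zero {x} fx<1 rewrite n<1⇒n≡0 fx<1 = z≤n
    pointwise (suc j) {x} fx< = add (2 ^ j ≤? f x)
      where
      add : (2^j≤fx? : Dec (2 ^ j ≤ f x)) → f x * f x ≤ 4 * (2 ^ j * 2 ^ j) if 2^j≤fx? plus majorant j x
      add (no  ≰) = pointwise j (≰⇒> ≰)
      add (yes _) = ≤-trans (begin
        f x * f x                      ≤⟨ *-mono-≤ (<⇒≤ fx<) (<⇒≤ fx<) ⟩
        (2 * 2 ^ j) * (2 * 2 ^ j)      ≡⟨ solve 1 (λ a → (con 2 :* a) :* (con 2 :* a) := con 4 :* (a :* a)) refl (2 ^ j) ⟩
        4 * (2 ^ j * 2 ^ j)            ∎) (m≤m+n _ _)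

    total : ∀ k xs → (∀ j → length (filter (λ x → 2 ^ j ≤? f x) xs) * (2 ^ j * 2 ^ j) ≤ C) →
      sum (map (majorant k) xs) ≤ k * (4 * C)
    total zero    xs level = ≤-trans (≤-reflexive (zeros xs)) z≤n
      where
      zeros : ∀ xs → sum (map (majorant 0) xs) ≡ 0
      zeros []       = refl
      zeros (x ∷ xs) = zeros xs
    total (suc j) xs level = ≤-trans (≤-reflexive (sum-if (λ x → 2 ^ j ≤? f x) (4 * (2 ^ j * 2 ^ j)) (majorant j) xs)) (+-mono-≤ (begin
      length (filter (λ x → 2 ^ j ≤? f x) xs) * (4 * (2 ^ j * 2 ^ j))
        ≡⟨ solve 2 (λ l a → l :* (con 4 :* a) := con 4 :* (l :* a)) refl (length (filter (λ x → 2 ^ j ≤? f x) xs)) (2 ^ j * 2 ^ j) ⟩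
      4 * (length (filter (λ x → 2 ^ j ≤? f x) xs) * (2 ^ j * 2 ^ j))
        ≤⟨ *-monoʳ-≤ 4 (level j) ⟩
      4 * C ∎) (total j xs level))

  module _ (_≟_ : DecidableEquality I) where

    remove : I → List I → List I
    remove a = filter (λ x → ¬? (x ≟ a))

    length-remove : ∀ a xs → Unique xs → length xs ≤ suc (length (remove a xs))
    length-remove a xs u = unique-⊆-length {ys = a ∷ remove a xs} u sub
      where
      sub : ∀ {x} → x ∈ xs → x ∈ a ∷ remove a xs
      sub {x} x∈ with x ≟ a
      ... | yes refl = here refl
      ... | no  x≢a  = there (∈-filter⁺ (λ x → ¬? (x ≟ a)) x∈ x≢a)

open import Algebra.Bundles using (CommutativeRing)
open import Data.Nat using (ℕ; zero; suc; _≤_; _<_; z≤n; s≤s)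
open import Level using (0ℓ)
import Data.Integer as ℤ
import Data.Integer.Properties as ℤ
import Data.Nat as ℕ
import Data.Nat.Properties as ℕ
open import Data.Maybe using (Maybe; just; nothing)
open import Relation.Nullary using (yes; no; ¬_)
import Algebra.Solver.Ring as RingSolver
import Algebra.Solver.Ring.AlmostCommutativeRing as ACR
import Relation.Binary.PropositionalEquality as ≡
open ≡ using (_≡_)
open import Data.Product using (_,_; proj₁; ∃-syntax) renaming (_×_ to _∧_)
open import Algebra.Structures using (IsCommutativeRing)
open import Algebra.Morphism.Structures using (IsRingMonomorphism; IsRingHomomorphism)
import Algebra.Morphism.RingMonomorphism as RingMonomorphism
open import Data.Unit using (⊤; tt)
open import Data.Fin using (Fin; zero; suc; toℕ)
open import Data.Empty using (⊥-elim)
open import Data.List using ([]; _∷_; length)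
open import Data.List.Relation.Unary.All as All using (All; []; _∷_)
open import Data.List.Relation.Unary.AllPairs using (AllPairs; []; _∷_)
import Data.Fin.Properties as Fin
import Algebra.Properties.Semiring.Mult

-- Normalisation in commutative rings.

module IntegerSolver (R : CommutativeRing 0ℓ 0ℓ) where
  open CommutativeRing R
  open import Algebra.Properties.Ring ring
  open import Algebra.Properties.AbelianGroup +-abelianGroup using (⁻¹-∙-comm)
  open import Algebra.Properties.Semiring.Mult.TCOptimised semiring
  open import Relation.Binary.Reasoning.Setoid setoid

  private
    ⟦_⟧ᶻ : ℤ.ℤ → Carrier
    ⟦ ℤ.+ n ⟧ᶻ      = n × 1#
    ⟦ ℤ.-[1+ n ] ⟧ᶻ = - (suc n × 1#)

    ⊖-homo : ∀ m n → ⟦ m ℤ.⊖ n ⟧ᶻ ≈ m × 1# - n × 1#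
    ⊖-homo m zero = sym (trans (+-congˡ -0#≈0#) (+-identityʳ _))
    ⊖-homo zero (suc n) = sym (+-identityˡ _)
    ⊖-homo (suc m) (suc n) = begin
      ⟦ suc m ℤ.⊖ suc n ⟧ᶻ               ≡⟨ ≡.cong ⟦_⟧ᶻ (ℤ.[1+m]⊖[1+n]≡m⊖n m n) ⟩
      ⟦ m ℤ.⊖ n ⟧ᶻ                       ≈⟨ ⊖-homo m n ⟩
      m × 1# - n × 1#                    ≈⟨ +-congʳ (+-identityˡ _) ⟨
      0# + m × 1# - n × 1#               ≈⟨ +-congʳ (+-congʳ (-‿inverseʳ 1#)) ⟨
      1# - 1# + m × 1# - n × 1#          ≈⟨ +-congʳ (+-assoc _ _ _) ⟩
      1# + (- 1# + m × 1#) - n × 1#      ≈⟨ +-congʳ (+-congˡ (+-comm _ _)) ⟩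
      1# + (m × 1# - 1#) - n × 1#        ≈⟨ +-congʳ (+-assoc _ _ _) ⟨
      1# + m × 1# - 1# - n × 1#          ≈⟨ +-assoc _ _ _ ⟩
      1# + m × 1# + (- 1# - n × 1#)      ≈⟨ +-congˡ (⁻¹-∙-comm _ _) ⟩
      1# + m × 1# - (1# + n × 1#)        ≈⟨ +-cong (1+× m 1#) (-‿cong (1+× n 1#)) ⟨
      suc m × 1# - suc n × 1#            ∎

    -homo : ∀ i → ⟦ ℤ.- i ⟧ᶻ ≈ - ⟦ i ⟧ᶻ
    -homo (ℤ.+ zero)   = sym -0#≈0#
    -homo (ℤ.+ suc n)  = refl
    -homo ℤ.-[1+ n ]   = sym (-‿involutive _)

    +-homo : ∀ i j → ⟦ i ℤ.+ j ⟧ᶻ ≈ ⟦ i ⟧ᶻ + ⟦ j ⟧ᶻ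
    +-homo (ℤ.+ m) (ℤ.+ n) = ×-homo-+ 1# m n
    +-homo (ℤ.+ m) ℤ.-[1+ n ] = ⊖-homo m (suc n)
    +-homo ℤ.-[1+ m ] (ℤ.+ n) = trans (⊖-homo n (suc m)) (+-comm _ _)
    +-homo ℤ.-[1+ m ] ℤ.-[1+ n ] = trans
      (-‿cong (trans (reflexive (≡.cong (_× 1#) (≡.cong suc (≡.sym (ℕ.+-suc m n))))) (×-homo-+ 1# (suc m) (suc n))))
      (sym (⁻¹-∙-comm _ _))

    *-homo-+ : ∀ m j → ⟦ ℤ.+ m ℤ.* j ⟧ᶻ ≈ m × 1# * ⟦ j ⟧ᶻ
    *-homo-+ m (ℤ.+ n) = trans (reflexive (≡.cong ⟦_⟧ᶻ (≡.sym (ℤ.pos-* m n)))) (×1-homo-* m n)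
    *-homo-+ m ℤ.-[1+ n ] = begin
      ⟦ ℤ.+ m ℤ.* (ℤ.- (ℤ.+ suc n)) ⟧ᶻ ≡⟨ ≡.cong ⟦_⟧ᶻ (ℤ.neg-distribʳ-* (ℤ.+ m) (ℤ.+ suc n)) ⟨
      ⟦ ℤ.- (ℤ.+ m ℤ.* (ℤ.+ suc n)) ⟧ᶻ ≈⟨ -homo (ℤ.+ m ℤ.* (ℤ.+ suc n)) ⟩
      - ⟦ ℤ.+ m ℤ.* (ℤ.+ suc n) ⟧ᶻ     ≈⟨ -‿cong (*-homo-+ m (ℤ.+ suc n)) ⟩
      - (m × 1# * (suc n × 1#))        ≈⟨ -‿distribʳ-* _ _ ⟩
      m × 1# * - (suc n × 1#)          ∎

    *-homo : ∀ i j → ⟦ i ℤ.* j ⟧ᶻ ≈ ⟦ i ⟧ᶻ * ⟦ j ⟧ᶻ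
    *-homo (ℤ.+ m) j = *-homo-+ m j
    *-homo ℤ.-[1+ m ] j = begin
      ⟦ (ℤ.- (ℤ.+ suc m)) ℤ.* j ⟧ᶻ ≡⟨ ≡.cong ⟦_⟧ᶻ (ℤ.neg-distribˡ-* (ℤ.+ suc m) j) ⟨
      ⟦ ℤ.- (ℤ.+ suc m ℤ.* j) ⟧ᶻ   ≈⟨ -homo (ℤ.+ suc m ℤ.* j) ⟩
      - ⟦ ℤ.+ suc m ℤ.* j ⟧ᶻ       ≈⟨ -‿cong (*-homo-+ (suc m) j) ⟩
      - (suc m × 1# * ⟦ j ⟧ᶻ)      ≈⟨ -‿distribˡ-* _ _ ⟩
      - (suc m × 1#) * ⟦ j ⟧ᶻ      ∎

    almostCommutativeRing : ACR.AlmostCommutativeRing 0ℓ 0ℓ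
    almostCommutativeRing = ACR.fromCommutativeRing R

    morphism : ℤ.+-*-rawRing ACR.-Raw-AlmostCommutative⟶ almostCommutativeRing
    morphism = record
      { ⟦_⟧    = ⟦_⟧ᶻ
      ; +-homo = +-homo
      ; *-homo = *-homo
      ; -‿homo = -homo
      ; 0-homo = refl
      ; 1-homo = refl
      }

    -- Integer coefficients have decidable equality, so cancellation such as a - a = 0 is recognised
    -- even if the equality of the ring itself is not decided, as for polynomials.
    _coeff≟_ : ∀ i j → Maybe (⟦ i ⟧ᶻ ≈ ⟦ j ⟧ᶻ)
    i coeff≟ j with i ℤ.≟ j
    ... | yes i≡j = just (reflexive (≡.cong ⟦_⟧ᶻ i≡j))
    ... | no  _   = nothing

  open RingSolver ℤ.+-*-rawRing almostCommutativeRing morphism _coeff≟_ using (Polynomial; con)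
  open RingSolver ℤ.+-*-rawRing almostCommutativeRing morphism _coeff≟_ public
    using (solve; _:=_; _:+_; _:*_; _:-_; :-_)

  :0 :1 : ∀ {n} → Polynomial n
  :0 = con (ℤ.+ 0)
  :1 = con (ℤ.+ 1)

-- Formal power series, derivatives and truncated evaluation.

module PowerSeries (K : CommutativeRing 0ℓ 0ℓ) where
  open CommutativeRing K
  open import Algebra.Properties.Ring ring using (-0#≈0#)
  open import Algebra.Properties.Semiring.Mult semiring using (_×_; ×-comm-*)
  open import Algebra.Properties.CommutativeMonoid.Mult +-commutativeMonoid using (×-distrib-+)
  open import Relation.Binary.Reasoning.Setoid setoid
  open IntegerSolver K

  Series : Set
  Series = ℕ → Carrier

  infix 4 _≈ˢ_
  infixl 6 _+ˢ_
  infixl 7 _*ˢ_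

  _≈ˢ_ : Series → Series → Set
  f ≈ˢ g = ∀ n → f n ≈ g n

  tail : Series → Series
  tail f n = f (suc n)

  -- The product recurses along f = f 0 + X * tail f rather than summing over i + j = n; the ring
  -- laws and the Leibniz rule become inductions.
  _+ˢ_ _*ˢ_ : Series → Series → Series
  (f +ˢ g) n = f n + g n
  (f *ˢ g) zero    = f 0 * g 0
  (f *ˢ g) (suc n) = f 0 * g (suc n) + (tail f *ˢ g) n

  -ˢ_ : Series → Series
  (-ˢ f) n = - f n

  constant : Carrier → Series
  constant c zero    = c
  constant c (suc n) = 0#

  0ˢ 1ˢ : Series
  0ˢ n = 0#
  1ˢ = constant 1#

  *ˢ-cong : ∀ {f f′ g g′} → f ≈ˢ f′ → g ≈ˢ g′ → f *ˢ g ≈ˢ f′ *ˢ g′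
  *ˢ-cong p q zero    = *-cong (p 0) (q 0)
  *ˢ-cong p q (suc n) = +-cong (*-cong (p 0) (q (suc n))) (*ˢ-cong (λ i → p (suc i)) q n)

  *ˢ-zeroˡ : ∀ {f} g → f ≈ˢ 0ˢ → f *ˢ g ≈ˢ 0ˢ
  *ˢ-zeroˡ g f≈0 zero    = trans (*-congʳ (f≈0 0)) (zeroˡ _)
  *ˢ-zeroˡ g f≈0 (suc n) = trans
    (+-cong (trans (*-congʳ (f≈0 0)) (zeroˡ _)) (*ˢ-zeroˡ g (λ i → f≈0 (suc i)) n))
    (+-identityˡ 0#)

  -- The mirror image of the defining recursion; commutativity follows by comparing the two.
  *ˢ-suc : ∀ f g n → (f *ˢ g) (suc n) ≈ (f *ˢ tail g) n + f (suc n) * g 0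
  *ˢ-suc f g zero    = refl
  *ˢ-suc f g (suc n) = trans (+-congˡ (*ˢ-suc (tail f) g n)) (sym (+-assoc _ _ _))

  *ˢ-comm : ∀ f g → f *ˢ g ≈ˢ g *ˢ f
  *ˢ-comm f g zero    = *-comm _ _
  *ˢ-comm f g (suc n) = begin
    f 0 * g (suc n) + (tail f *ˢ g) n  ≈⟨ +-cong (*-comm _ _) (*ˢ-comm (tail f) g n) ⟩
    g (suc n) * f 0 + (g *ˢ tail f) n  ≈⟨ +-comm _ _ ⟩
    (g *ˢ tail f) n + g (suc n) * f 0  ≈⟨ *ˢ-suc g f n ⟨
    (g *ˢ f) (suc n)                   ∎

  *ˢ-distribʳ : ∀ h f g → (f +ˢ g) *ˢ h ≈ˢ f *ˢ h +ˢ g *ˢ h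
  *ˢ-distribʳ h f g zero    = distribʳ _ _ _
  *ˢ-distribʳ h f g (suc n) = trans
    (+-cong (distribʳ _ _ _) (*ˢ-distribʳ h (tail f) (tail g) n))
    (solve 4 (λ a b c d → (a :+ b) :+ (c :+ d) := (a :+ c) :+ (b :+ d)) refl _ _ _ _)

  *ˢ-distribˡ : ∀ h f g → h *ˢ (f +ˢ g) ≈ˢ h *ˢ f +ˢ h *ˢ g
  *ˢ-distribˡ h f g n = trans (*ˢ-comm h (f +ˢ g) n)
    (trans (*ˢ-distribʳ h f g n) (+-cong (*ˢ-comm f h n) (*ˢ-comm g h n)))

  scale : Carrier → Series → Series
  scale c f n = c * f n

  *ˢ-scaleˡ : ∀ c f g → scale c f *ˢ g ≈ˢ scale c (f *ˢ g)
  *ˢ-scaleˡ c f g zero    = *-assoc _ _ _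
  *ˢ-scaleˡ c f g (suc n) = trans
    (+-cong (*-assoc _ _ _) (*ˢ-scaleˡ c (tail f) g n)) (sym (distribˡ _ _ _))

  *ˢ-assoc : ∀ f g h → (f *ˢ g) *ˢ h ≈ˢ f *ˢ (g *ˢ h)
  *ˢ-assoc f g h zero    = *-assoc _ _ _
  *ˢ-assoc f g h (suc n) = begin
    f 0 * g 0 * h (suc n) + ((scale (f 0) (tail g) +ˢ tail f *ˢ g) *ˢ h) n
      ≈⟨ +-congˡ (*ˢ-distribʳ h (scale (f 0) (tail g)) (tail f *ˢ g) n) ⟩
    f 0 * g 0 * h (suc n) + ((scale (f 0) (tail g) *ˢ h) n + ((tail f *ˢ g) *ˢ h) n)
      ≈⟨ +-congˡ (+-cong (*ˢ-scaleˡ (f 0) (tail g) h n) (*ˢ-assoc (tail f) g h n)) ⟩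
    f 0 * g 0 * h (suc n) + (f 0 * (tail g *ˢ h) n + (tail f *ˢ (g *ˢ h)) n)
      ≈⟨ solve 5 (λ a b c d e → a :* b :* c :+ (a :* d :+ e) := a :* (b :* c :+ d) :+ e) refl _ _ _ _ _ ⟩
    f 0 * (g 0 * h (suc n) + (tail g *ˢ h) n) + (tail f *ˢ (g *ˢ h)) n ∎

  constant-* : ∀ c f → constant c *ˢ f ≈ˢ scale c f
  constant-* c f zero    = refl
  constant-* c f (suc n) = trans (+-congˡ (*ˢ-zeroˡ f (λ _ → refl) n)) (+-identityʳ _)

  *ˢ-identityˡ : ∀ f → 1ˢ *ˢ f ≈ˢ f
  *ˢ-identityˡ f n = trans (constant-* 1# f n) (*-identityˡ _)

  isCommutativeRingˢ : IsCommutativeRing _≈ˢ_ _+ˢ_ _*ˢ_ -ˢ_ 0ˢ 1ˢ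
  isCommutativeRingˢ = record
    { isRing = record
      { +-isAbelianGroup = record
        { isGroup = record
          { isMonoid = record
            { isSemigroup = record
              { isMagma = record
                { isEquivalence = record
                  { refl = λ n → refl ; sym = λ p n → sym (p n) ; trans = λ p q n → trans (p n) (q n) }
                ; ∙-cong = λ p q n → +-cong (p n) (q n)
                }
              ; assoc = λ f g h n → +-assoc _ _ _
              }
            ; identity = (λ f n → +-identityˡ _) , (λ f n → +-identityʳ _)
            }
          ; inverse = (λ f n → -‿inverseˡ _) , (λ f n → -‿inverseʳ _)
          ; ⁻¹-cong = λ p n → -‿cong (p n)
          }
        ; comm = λ f g n → +-comm _ _
        }
      ; *-cong = *ˢ-cong
      ; *-assoc = *ˢ-assoc
      ; *-identity = *ˢ-identityˡ , (λ f n → trans (*ˢ-comm f 1ˢ n) (*ˢ-identityˡ f n))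
      ; distrib = *ˢ-distribˡ , *ˢ-distribʳ
      }
    ; *-comm = *ˢ-comm
    }

  derivative : Series → Series
  derivative f n = suc n × f (suc n)

  derivative-+ : ∀ f g → derivative (f +ˢ g) ≈ˢ derivative f +ˢ derivative g
  derivative-+ f g n = ×-distrib-+ (f (suc n)) (g (suc n)) (suc n)

  -- The tail of `derivative f` is `tail (tail f)` plus `derivative (tail f)`. The first summand
  -- absorbs the extra copy of `tail f *ˢ g` that appears when the integer factor grows by one.
  derivative-* : ∀ f g → derivative (f *ˢ g) ≈ˢ derivative f *ˢ g +ˢ f *ˢ derivative g
  derivative-* f g zero = solve 4
    (λ a b c d → (a :* b :+ c :* d) :+ :0 := (c :+ :0) :* d :+ a :* (b :+ :0))
    refl (f 0) (g 1) (f 1) (g 0)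
  derivative-* f g (suc m) = begin
    suc (suc m) × (f 0 * g (suc (suc m)) + (tail f *ˢ g) (suc m))
      ≈⟨ ×-distrib-+ _ _ (suc (suc m)) ⟩
    suc (suc m) × (f 0 * g (suc (suc m))) + ((tail f *ˢ g) (suc m) + derivative (tail f *ˢ g) m)
      ≈⟨ +-cong (sym (×-comm-* (suc (suc m)) _ _)) (+-congˡ (derivative-* (tail f) g m)) ⟩
    f 0 * derivative g (suc m) +
      ((f 1 * g (suc m) + (tail (tail f) *ˢ g) m) +
       ((derivative (tail f) *ˢ g) m + (tail f *ˢ derivative g) m))
      ≈⟨ solve 5 (λ a b c d e → a :+ ((b :+ c) :+ (d :+ e)) := (b :+ (c :+ d)) :+ (a :+ e)) refl _ _ _ _ _ ⟩
    (f 1 * g (suc m) + ((tail (tail f) *ˢ g) m + (derivative (tail f) *ˢ g) m)) +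
      (f 0 * derivative g (suc m) + (tail f *ˢ derivative g) m)
      ≈⟨ +-congʳ (+-cong (*-congʳ (sym (+-identityʳ _)))
           (sym (*ˢ-distribʳ g (tail (tail f)) (derivative (tail f)) m))) ⟩
    (derivative f 0 * g (suc m) + (tail (derivative f) *ˢ g) m) +
      (f 0 * derivative g (suc m) + (tail f *ˢ derivative g) m) ∎

  DegBelow OrdFrom : ℕ → Series → Set
  DegBelow N f = ∀ n → N ≤ n → f n ≈ 0#
  OrdFrom  N f = ∀ n → n < N → f n ≈ 0#

  deg-tail : ∀ {N f} → DegBelow (suc N) f → DegBelow N (tail f)
  deg-tail d n N≤n = d (suc n) (s≤s N≤n)

  deg-mono : ∀ {M N f} → M ≤ N → DegBelow M f → DegBelow N f
  deg-mono M≤N d n N≤n = d n (ℕ.≤-trans M≤N N≤n)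

  deg-+ : ∀ {N f g} → DegBelow N f → DegBelow N g → DegBelow N (f +ˢ g)
  deg-+ df dg n N≤n = trans (+-cong (df n N≤n) (dg n N≤n)) (+-identityˡ 0#)

  deg-neg : ∀ {N f} → DegBelow N f → DegBelow N (-ˢ f)
  deg-neg df n N≤n = trans (-‿cong (df n N≤n)) -0#≈0#

  deg-* : ∀ {M N f g} → DegBelow M f → DegBelow N g → DegBelow (M ℕ.+ N) (f *ˢ g)
  deg-* {zero}          df dg n       _       = *ˢ-zeroˡ _ (λ i → df i z≤n) n
  deg-* {suc M} {N} {f} df dg (suc n) (s≤s p) = trans
    (+-cong (trans (*-congˡ (dg (suc n) (ℕ.≤-trans (ℕ.m≤n+m N M) (ℕ.m≤n⇒m≤1+n p)))) (zeroʳ _))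
            (deg-* (deg-tail {f = f} df) dg n p))
    (+-identityˡ 0#)

  deg-constant : ∀ c → DegBelow 1 (constant c)
  deg-constant c (suc n) _ = refl

  ×-zero : ∀ n {x} → x ≈ 0# → n × x ≈ 0#
  ×-zero zero    x≈0 = refl
  ×-zero (suc n) x≈0 = trans (+-cong x≈0 (×-zero n x≈0)) (+-identityˡ 0#)

  deg-derivative : ∀ {N f} → DegBelow (suc N) f → DegBelow N (derivative f)
  deg-derivative df n N≤n = ×-zero (suc n) (df (suc n) (s≤s N≤n))

  X : Series
  X 1 = 1#
  X _ = 0#

  deg-X : DegBelow 2 X
  deg-X (suc zero) (s≤s ())
  deg-X (suc (suc n)) _ = refl

  X-*-suc : ∀ f n → (X *ˢ f) (suc n) ≈ f n
  X-*-suc f n = begin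
    0# * f (suc n) + (tail X *ˢ f) n  ≈⟨ +-cong (zeroˡ _) (*ˢ-cong tail-X (λ _ → refl) n) ⟩
    0# + (1ˢ *ˢ f) n                  ≈⟨ +-identityˡ _ ⟩
    (1ˢ *ˢ f) n                       ≈⟨ *ˢ-identityˡ f n ⟩
    f n                               ∎
    where
    tail-X : tail X ≈ˢ 1ˢ
    tail-X zero    = refl
    tail-X (suc n) = refl

  -- Only a truncation of a series has a value at z; by `horner-unique` the cut-off is immaterial
  -- once it is a degree bound.
  horner : Carrier → ℕ → Series → Carrier
  horner z zero    f = 0#
  horner z (suc N) f = f 0 + z * horner z N (tail f)

  horner-cong : ∀ z N {f g} → f ≈ˢ g → horner z N f ≈ horner z N g
  horner-cong z zero    f≈g = refl
  horner-cong z (suc N) f≈g = +-cong (f≈g 0) (*-congˡ (horner-cong z N (λ n → f≈g (suc n))))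

  horner-0 : ∀ z N {f} → f ≈ˢ 0ˢ → horner z N f ≈ 0#
  horner-0 z zero    f≈0 = refl
  horner-0 z (suc N) f≈0 = trans
    (+-cong (f≈0 0) (trans (*-congˡ (horner-0 z N (λ n → f≈0 (suc n)))) (zeroʳ z)))
    (+-identityˡ 0#)

  horner-unique : ∀ z M N {f} → DegBelow M f → DegBelow N f → horner z M f ≈ horner z N f
  horner-unique z zero    N       dM dN = sym (horner-0 z N (λ n → dM n z≤n))
  horner-unique z (suc M) zero    dM dN = horner-0 z (suc M) (λ n → dN n z≤n)
  horner-unique z (suc M) (suc N) {f} dM dN =
    +-congˡ (*-congˡ (horner-unique z M N (deg-tail {f = f} dM) (deg-tail {f = f} dN)))

  horner-+ : ∀ z N f g → horner z N (f +ˢ g) ≈ horner z N f + horner z N g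
  horner-+ z zero    f g = sym (+-identityˡ 0#)
  horner-+ z (suc N) f g = trans (+-congˡ (*-congˡ (horner-+ z N (tail f) (tail g))))
    (solve 5 (λ a b z u v → (a :+ b) :+ z :* (u :+ v) := (a :+ z :* u) :+ (b :+ z :* v)) refl _ _ _ _ _)

  horner-scale : ∀ z c N f → horner z N (scale c f) ≈ c * horner z N f
  horner-scale z c zero    f = sym (zeroʳ c)
  horner-scale z c (suc N) f = trans (+-congˡ (*-congˡ (horner-scale z c N (tail f))))
    (solve 4 (λ c a z u → c :* a :+ z :* (c :* u) := c :* (a :+ z :* u)) refl _ _ _ _)

  horner-* : ∀ z M N {f g} → DegBelow M f → DegBelow N g →
             horner z (M ℕ.+ N) (f *ˢ g) ≈ horner z M f * horner z N g
  horner-* z zero    N {f} {g} df dg =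
    trans (horner-0 z N (*ˢ-zeroˡ g (λ n → df n z≤n))) (sym (zeroˡ _))
  horner-* z (suc M) N {f} {g} df dg = begin
    f 0 * g 0 + z * horner z (M ℕ.+ N) (scale (f 0) (tail g) +ˢ tail f *ˢ g)
      ≈⟨ +-congˡ (*-congˡ (horner-+ z (M ℕ.+ N) _ _)) ⟩
    f 0 * g 0 + z * (horner z (M ℕ.+ N) (scale (f 0) (tail g)) + horner z (M ℕ.+ N) (tail f *ˢ g))
      ≈⟨ +-congˡ (*-congˡ (+-cong (horner-scale z (f 0) (M ℕ.+ N) (tail g))
           (horner-* z M N (deg-tail {f = f} df) dg))) ⟩
    f 0 * g 0 + z * (f 0 * horner z (M ℕ.+ N) (tail g) + horner z M (tail f) * horner z N g)
      ≈⟨ solve 6 (λ a b z u v w → a :* b :+ z :* (a :* u :+ v :* w) := a :* (b :+ z :* u) :+ z :* v :* w)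
           refl _ _ _ _ _ _ ⟩
    f 0 * horner z (suc (M ℕ.+ N)) g + z * horner z M (tail f) * horner z N g
      ≈⟨ +-congʳ (*-congˡ (horner-unique z (suc (M ℕ.+ N)) N
           (deg-mono {f = g} (ℕ.m≤n⇒m≤1+n (ℕ.m≤n+m N M)) dg) dg)) ⟩
    f 0 * horner z N g + z * horner z M (tail f) * horner z N g
      ≈⟨ distribʳ _ _ _ ⟨
    (f 0 + z * horner z M (tail f)) * horner z N g ∎

record IsDerivation (R : CommutativeRing 0ℓ 0ℓ)
  (δ : CommutativeRing.Carrier R → CommutativeRing.Carrier R) : Set where
  open CommutativeRing R
  field
    δ-cong : ∀ {x y} → x ≈ y → δ x ≈ δ y
    δ-+    : ∀ x y → δ (x + y) ≈ δ x + δ y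
    δ-*    : ∀ x y → δ (x * y) ≈ δ x * y + x * δ y

-- Polynomials as series with a degree bound, and division by X - z.

module Polynomials (K : CommutativeRing 0ℓ 0ℓ) where
  open CommutativeRing K
  open PowerSeries K
  open IntegerSolver K
  open import Algebra.Properties.Ring ring using (-0#≈0#)
  open import Algebra.Properties.Semiring.Mult semiring using (×-congʳ)
  open import Relation.Binary.Reasoning.Setoid setoid

  -- Equality ignores the stored bound, so an operation only has to supply some bound, not the
  -- degree.
  record Polynomial : Set where
    constructor polynomial
    field
      coef  : Series
      bound : ℕ
      deg   : DegBelow bound coef
  open Polynomial public

  infix 4 _≈ᵖ_
  infixl 6 _+ᵖ_
  infixl 7 _*ᵖ_

  -- A record, so that `f` and `g` can be inferred from the type of a proof, which the pointwise
  -- equation would not allow.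
  record _≈ᵖ_ (f g : Polynomial) : Set where
    constructor coefwise
    field at : coef f ≈ˢ coef g
  open _≈ᵖ_ public

  opaque
    _+ᵖ_ _*ᵖ_ : Polynomial → Polynomial → Polynomial
    f +ᵖ g = polynomial (coef f +ˢ coef g) (bound f ℕ.⊔ bound g)
      (deg-+ {f = coef f} {g = coef g}
        (deg-mono {f = coef f} (ℕ.m≤m⊔n _ _) (deg f)) (deg-mono {f = coef g} (ℕ.m≤n⊔m (bound f) _) (deg g)))
    f *ᵖ g = polynomial (coef f *ˢ coef g) (bound f ℕ.+ bound g) (deg-* (deg f) (deg g))

    -ᵖ_ : Polynomial → Polynomial
    -ᵖ f = polynomial (-ˢ coef f) (bound f) (deg-neg {f = coef f} (deg f))

    constantᵖ : Carrier → Polynomial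
    constantᵖ c = polynomial (constant c) 1 (deg-constant c)

    0ᵖ Xᵖ : Polynomial
    0ᵖ = polynomial 0ˢ 0 (λ _ _ → refl)
    Xᵖ = polynomial X 2 deg-X

    coef-isRingMonomorphism : IsRingMonomorphism
      (record { _≈_ = _≈ᵖ_ ; _+_ = _+ᵖ_ ; _*_ = _*ᵖ_ ; -_ = -ᵖ_ ; 0# = 0ᵖ ; 1# = constantᵖ 1# })
      (record { _≈_ = _≈ˢ_ ; _+_ = _+ˢ_ ; _*_ = _*ˢ_ ; -_ = -ˢ_ ; 0# = 0ˢ ; 1# = 1ˢ }) coef
    coef-isRingMonomorphism = record
      { isRingHomomorphism = record
        { isSemiringHomomorphism = record
          { isNearSemiringHomomorphism = record
            { +-isMonoidHomomorphism = record
              { isMagmaHomomorphism = record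
                { isRelHomomorphism = record { cong = at }
                ; homo = λ _ _ _ → refl
                }
              ; ε-homo = λ _ → refl
              }
            ; *-homo = λ _ _ _ → refl
            }
          ; 1#-homo = λ _ → refl
          }
        ; -‿homo = λ _ _ → refl
        }
      ; injective = coefwise
      }

  polynomialRing : CommutativeRing 0ℓ 0ℓ
  polynomialRing = record
    { isCommutativeRing = RingMonomorphism.isCommutativeRing coef-isRingMonomorphism isCommutativeRingˢ }

  opaque
    unfolding _+ᵖ_

    coef-+ : ∀ f g n → coef (f +ᵖ g) n ≈ coef f n + coef g n
    coef-+ f g n = refl

    coef-neg : ∀ f n → coef (-ᵖ f) n ≈ - coef f n
    coef-neg f n = refl

    coef-* : ∀ f g → coef (f *ᵖ g) ≈ˢ coef f *ˢ coef g
    coef-* f g n = refl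

    coef-X : coef Xᵖ ≈ˢ X
    coef-X n = refl

    coef-0 : coef 0ᵖ ≈ˢ 0ˢ
    coef-0 n = refl

    coef-constant : ∀ c → coef (constantᵖ c) ≈ˢ constant c
    coef-constant c n = refl

    derivativeᵖ : Polynomial → Polynomial
    derivativeᵖ f = polynomial (derivative (coef f)) (bound f)
      (deg-derivative {f = coef f} (deg-mono {f = coef f} (ℕ.n≤1+n _) (deg f)))

    coef-derivative : ∀ f → coef (derivativeᵖ f) ≈ˢ derivative (coef f)
    coef-derivative f n = refl

    derivativeᵖ-isDerivation : IsDerivation polynomialRing derivativeᵖ
    derivativeᵖ-isDerivation = record
      { δ-cong = λ p → coefwise (λ n → ×-congʳ (suc n) (at p (suc n)))
      ; δ-+    = λ f g → coefwise (derivative-+ (coef f) (coef g))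
      ; δ-*    = λ f g → coefwise (derivative-* (coef f) (coef g))
      }

    derivativeᵖ-X : derivativeᵖ Xᵖ ≈ᵖ constantᵖ 1#
    derivativeᵖ-X = coefwise λ where
      zero    → +-identityʳ 1#
      (suc n) → ×-zero (suc (suc n)) refl

    derivativeᵖ-constant : ∀ c → derivativeᵖ (constantᵖ c) ≈ᵖ 0ᵖ
    derivativeᵖ-constant c = coefwise (λ n → ×-zero (suc n) refl)

    evaluate : Carrier → Polynomial → Carrier
    evaluate z f = horner z (bound f) (coef f)

    evaluate-bound : ∀ z N f → DegBelow N (coef f) → evaluate z f ≈ horner z N (coef f)
    evaluate-bound z N f d = horner-unique z (bound f) N (deg f) d

    evaluate-cong : ∀ z {f g} → f ≈ᵖ g → evaluate z f ≈ evaluate z g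
    evaluate-cong z {f} {g} f≈g = trans
      (evaluate-bound z (bound g) f (λ n p → trans (at f≈g n) (deg g n p)))
      (horner-cong z (bound g) (at f≈g))

    evaluate-+ : ∀ z f g → evaluate z (f +ᵖ g) ≈ evaluate z f + evaluate z g
    evaluate-+ z f g = trans (horner-+ z (bound f ℕ.⊔ bound g) (coef f) (coef g))
      (sym (+-cong
        (evaluate-bound z _ f (deg-mono {f = coef f} (ℕ.m≤m⊔n _ _) (deg f)))
        (evaluate-bound z _ g (deg-mono {f = coef g} (ℕ.m≤n⊔m (bound f) _) (deg g)))))

    evaluate-* : ∀ z f g → evaluate z (f *ᵖ g) ≈ evaluate z f * evaluate z g
    evaluate-* z f g = horner-* z (bound f) (bound g) (deg f) (deg g)

    evaluate-neg : ∀ z f → evaluate z (-ᵖ f) ≈ - evaluate z f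
    evaluate-neg z f = begin
      evaluate z (-ᵖ f)
        ≈⟨ solve 2 (λ a b → a := (a :+ b) :- b) refl _ _ ⟩
      (evaluate z (-ᵖ f) + evaluate z f) - evaluate z f
        ≈⟨ +-congʳ (evaluate-+ z (-ᵖ f) f) ⟨
      evaluate z ((-ᵖ f) +ᵖ f) - evaluate z f
        ≈⟨ +-congʳ (evaluate-cong z {(-ᵖ f) +ᵖ f} {0ᵖ} (coefwise (λ n → -‿inverseˡ _))) ⟩
      0# - evaluate z f
        ≈⟨ +-identityˡ _ ⟩
      - evaluate z f ∎

    evaluate-constant : ∀ z c → evaluate z (constantᵖ c) ≈ c
    evaluate-constant z c = trans (+-congˡ (zeroʳ z)) (+-identityʳ c)

    evaluate-X : ∀ z → evaluate z Xᵖ ≈ z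
    evaluate-X z = solve 1 (λ z → :0 :+ z :* (:1 :+ z :* :0) := z) refl z

    evaluate-isRingHomomorphism : ∀ z →
      IsRingHomomorphism (CommutativeRing.rawRing polynomialRing) rawRing (evaluate z)
    evaluate-isRingHomomorphism z = record
      { isSemiringHomomorphism = record
        { isNearSemiringHomomorphism = record
          { +-isMonoidHomomorphism = record
            { isMagmaHomomorphism = record
              { isRelHomomorphism = record { cong = λ {f} {g} → evaluate-cong z {f} {g} }
              ; homo = evaluate-+ z
              }
            ; ε-homo = refl
            }
          ; *-homo = evaluate-* z
          }
        ; 1#-homo = evaluate-constant z 1#
        }
      ; -‿homo = evaluate-neg z
      }

  module _ (z : Carrier) (f : Polynomial) where
    opaque
      unfolding evaluate

      shifted : ℕ → Series
      shifted n i = coef f (i ℕ.+ n)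

      shifted-horner : ∀ n →
        horner z (bound f) (shifted n) ≈ coef f n + z * horner z (bound f) (shifted (suc n))
      shifted-horner n = trans
        (horner-unique z (bound f) (suc (bound f))
          (λ i p → deg f (i ℕ.+ n) (ℕ.≤-trans p (ℕ.m≤m+n i n)))
          (λ i p → deg f (i ℕ.+ n) (ℕ.≤-trans (ℕ.<⇒≤ p) (ℕ.m≤m+n i n))))
        (+-congˡ (*-congˡ (horner-cong z (bound f)
          (λ i → reflexive (≡.cong (coef f) (≡.sym (ℕ.+-suc i n)))))))

      shifted-deg : ∀ N → DegBelow (suc N) (coef f) → DegBelow N (λ n → horner z (bound f) (shifted (suc n)))
      shifted-deg N d n N≤n = horner-0 z (bound f)
        (λ i → d (i ℕ.+ suc n) (ℕ.≤-trans (s≤s N≤n) (ℕ.m≤n+m (suc n) i)))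

      -- Synthetic division: coefficient n of the quotient is the value at z of f shifted down by n
      -- + 1, and `shifted-horner` is the relation between consecutive coefficients of the quotient
      -- that multiplication by X - z requires.
      quotient : Polynomial
      quotient = polynomial (λ n → horner z (bound f) (shifted (suc n))) (bound f)
        (shifted-deg (bound f) (deg-mono {f = coef f} (ℕ.n≤1+n _) (deg f)))

      factor : evaluate z f ≈ 0# → f ≈ᵖ (Xᵖ +ᵖ (-ᵖ constantᵖ z)) *ᵖ quotient
      factor fz≈0 = coefwise (λ n → trans (lemma n) (sym (*ˢ-distribʳ (coef quotient) X (-ˢ constant z) n)))
        where
        negative : ∀ n → ((-ˢ constant z) *ˢ coef quotient) n ≈ - (z * coef quotient n)
        negative n = trans
          (*ˢ-cong {g = coef quotient} -constant (λ _ → refl) n)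
          (trans (constant-* (- z) (coef quotient) n)
            (solve 2 (λ a b → (:- a) :* b := :- (a :* b)) refl z _))
          where
          -constant : (-ˢ constant z) ≈ˢ constant (- z)
          -constant zero    = refl
          -constant (suc n) = -0#≈0#
        lemma : ∀ n → coef f n ≈ (X *ˢ coef quotient) n + ((-ˢ constant z) *ˢ coef quotient) n
        lemma zero = begin
          coef f 0
            ≈⟨ solve 2 (λ a b → a := (a :+ b) :+ :- b) refl _ _ ⟩
          (coef f 0 + z * coef quotient 0) - z * coef quotient 0
            ≈⟨ +-congʳ (shifted-horner 0) ⟨
          horner z (bound f) (shifted 0) - z * coef quotient 0
            ≈⟨ +-congʳ (horner-cong z (bound f)
                 (λ i → reflexive (≡.cong (coef f) (ℕ.+-identityʳ i)))) ⟩
          evaluate z f - z * coef quotient 0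
            ≈⟨ +-cong (trans fz≈0 (sym (zeroˡ _))) (sym (negative 0)) ⟩
          0# * coef quotient 0 + ((-ˢ constant z) *ˢ coef quotient) 0 ∎
        lemma (suc n) = begin
          coef f (suc n)
            ≈⟨ solve 2 (λ a b → a := (a :+ b) :+ :- b) refl _ _ ⟩
          (coef f (suc n) + z * coef quotient (suc n)) - z * coef quotient (suc n)
            ≈⟨ +-cong (sym (shifted-horner (suc n))) (sym (negative (suc n))) ⟩
          coef quotient n + ((-ˢ constant z) *ˢ coef quotient) (suc n)
            ≈⟨ +-congʳ (X-*-suc (coef quotient) n) ⟨
          (X *ˢ coef quotient) (suc n) + ((-ˢ constant z) *ˢ coef quotient) (suc n) ∎

      deg-quotient : ∀ N → DegBelow (suc N) (coef f) → DegBelow N (coef quotient)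
      deg-quotient = shifted-deg

-- Derivations and orders of vanishing.

module Derivations (P : CommutativeRing 0ℓ 0ℓ) (δ : CommutativeRing.Carrier P → CommutativeRing.Carrier P)
  (δ-isDerivation : IsDerivation P δ) where
  open CommutativeRing P
  open IsDerivation δ-isDerivation public
  open IntegerSolver P
  open import Algebra.Properties.CommutativeMonoid.Sum +-commutativeMonoid using (sum)
  open import Relation.Binary.Reasoning.Setoid setoid

  δ-0 : δ 0# ≈ 0#
  δ-0 = begin
    δ 0#                    ≈⟨ solve 1 (λ a → a := (a :+ a) :- a) refl _ ⟩
    (δ 0# + δ 0#) - δ 0#    ≈⟨ +-congʳ (δ-+ 0# 0#) ⟨
    δ (0# + 0#) - δ 0#      ≈⟨ +-congʳ (δ-cong (+-identityˡ 0#)) ⟩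
    δ 0# - δ 0#             ≈⟨ -‿inverseʳ _ ⟩
    0#                      ∎

  δ-neg : ∀ x → δ (- x) ≈ - δ x
  δ-neg x = begin
    δ (- x)                ≈⟨ solve 2 (λ a b → a := (a :+ b) :- b) refl _ _ ⟩
    (δ (- x) + δ x) - δ x  ≈⟨ +-congʳ (δ-+ (- x) x) ⟨
    δ (- x + x) - δ x      ≈⟨ +-congʳ (δ-cong (-‿inverseˡ x)) ⟩
    δ 0# - δ x             ≈⟨ +-congʳ δ-0 ⟩
    0# - δ x               ≈⟨ +-identityˡ _ ⟩
    - δ x                  ∎

  δ-1 : δ 1# ≈ 0#
  δ-1 = begin
    δ 1#                            ≈⟨ solve 1 (λ a → a := (a :* :1 :+ :1 :* a) :- a) refl _ ⟩
    (δ 1# * 1# + 1# * δ 1#) - δ 1#  ≈⟨ +-congʳ (δ-* 1# 1#) ⟨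
    δ (1# * 1#) - δ 1#              ≈⟨ +-congʳ (δ-cong (*-identityˡ 1#)) ⟩
    δ 1# - δ 1#                     ≈⟨ -‿inverseʳ _ ⟩
    0#                              ∎

  δ-sum : ∀ {n} (f : Fin n → Carrier) → δ (sum f) ≈ sum (λ i → δ (f i))
  δ-sum {zero}  f = δ-0
  δ-sum {suc n} f = trans (δ-+ _ _) (+-congˡ (δ-sum (λ i → f (suc i))))

  scaled-isDerivation : ∀ w → IsDerivation P (λ x → w * δ x)
  scaled-isDerivation w = record
    { δ-cong = λ p → *-congˡ (δ-cong p)
    ; δ-+    = λ x y → trans (*-congˡ (δ-+ x y)) (distribˡ _ _ _)
    ; δ-*    = λ x y → trans (*-congˡ (δ-* x y))
        (solve 5 (λ w x y a b → w :* (a :* y :+ x :* b) := w :* a :* y :+ x :* (w :* b)) refl w x y (δ x) (δ y))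
    }

-- Vanishing orders are measured by iterating a derivation δ; this detects the
-- powers of x dividing f as long as δ x and the relevant integers do not vanish at the point.
module VanishingOrder (P K : CommutativeRing 0ℓ 0ℓ)
  (δ : CommutativeRing.Carrier P → CommutativeRing.Carrier P) (δ-isDerivation : IsDerivation P δ)
  (ev : CommutativeRing.Carrier P → CommutativeRing.Carrier K)
  (ev-isHom : IsRingHomomorphism (CommutativeRing.rawRing P) (CommutativeRing.rawRing K) ev)
  where
  private module K = CommutativeRing K
  open CommutativeRing P
  open Derivations P δ δ-isDerivation
  open IntegerSolver P
  open IsRingHomomorphism ev-isHom using (+-homo; *-homo) renaming (⟦⟧-cong to ev-cong)
  open import Algebra.Properties.Semiring.Mult semiring using (_×_)
  open import Relation.Binary.Reasoning.Setoid setoid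

  Vanishes : ℕ → Carrier → Set
  Vanishes zero    f = ⊤
  Vanishes (suc k) f = ev f K.≈ K.0# ∧ Vanishes k (δ f)

  vanishes-cong : ∀ k {f g} → f ≈ g → Vanishes k f → Vanishes k g
  vanishes-cong zero    p _       = tt
  vanishes-cong (suc k) p (v , V) = K.trans (K.sym (ev-cong p)) v , vanishes-cong k (δ-cong p) V

  vanishes-pred : ∀ k {f} → Vanishes (suc k) f → Vanishes k f
  vanishes-pred zero    _       = tt
  vanishes-pred (suc k) (v , V) = v , vanishes-pred k V

  vanishes-+ : ∀ k {f g} → Vanishes k f → Vanishes k g → Vanishes k (f + g)
  vanishes-+ zero    _       _       = tt
  vanishes-+ (suc k) (v , V) (w , W) =
    K.trans (+-homo _ _) (K.trans (K.+-cong v w) (K.+-identityˡ _)) ,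
    vanishes-cong k (sym (δ-+ _ _)) (vanishes-+ k V W)

  vanishes-* : ∀ k g {f} → Vanishes k f → Vanishes k (g * f)
  vanishes-* zero    g _ = tt
  vanishes-* (suc k) g V@(v , V′) =
    K.trans (*-homo _ _) (K.trans (K.*-congˡ v) (K.zeroʳ _)) ,
    vanishes-cong k (sym (δ-* _ _))
      (vanishes-+ k (vanishes-* k (δ g) (vanishes-pred k V)) (vanishes-* k g V′))

  vanishes-cancel-+ : ∀ k {f g} → Vanishes k f → Vanishes k (f + g) → Vanishes k g
  vanishes-cancel-+ k {f} {g} V W = vanishes-cong k
    (solve 2 (λ f g → (:- :1) :* f :+ (f :+ g) := g) refl f g)
    (vanishes-+ k (vanishes-* k (- 1#) V) W)

  module _ (no-zero-divisors : ∀ {x y} → x K.* y K.≈ K.0# → ¬ (x K.≈ K.0#) → y K.≈ K.0#) where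

    -- By induction f already vanishes to the order below, hence so does δ g * f. Subtracting it
    -- from δ (g * f) leaves g * δ f, to which the induction applies again.
    vanishes-cancel-* : ∀ k g {f} → ¬ (ev g K.≈ K.0#) → Vanishes k (g * f) → Vanishes k f
    vanishes-cancel-* zero    g g≢0 _ = tt
    vanishes-cancel-* (suc k) g {f} g≢0 V@(v , V′) =
      no-zero-divisors (K.trans (K.sym (*-homo g f)) v) g≢0 ,
      vanishes-cancel-* k g g≢0
        (vanishes-cancel-+ k
          (vanishes-* k (δ g) (vanishes-cancel-* k g g≢0 (vanishes-pred k {g * f} V)))
          (vanishes-cong k (δ-* g f) V′))

    -- Only m = 0 is needed below, but the derivative of the
    -- hypothesis has the same shape with m + 1 in place of m.
    vanishes-root : ∀ k m x {f} → ev x K.≈ K.0# → ¬ (ev (δ x) K.≈ K.0#) →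
      (∀ j → suc j ≤ m ℕ.+ k → ¬ (ev (suc j × 1#) K.≈ K.0#)) →
      Vanishes k ((suc m × 1#) * (δ x * f) + x * δ f) → Vanishes k f
    vanishes-root zero m x x≈0 δx≢0 char V = tt
    vanishes-root (suc k) m x {f} x≈0 δx≢0 char V@(v , V′) =
      root , vanishes-root k (suc m) x x≈0 δx≢0
        (λ j p → char j (≡.subst (suc j ≤_) (≡.sym (ℕ.+-suc m k)) p))
        (vanishes-cancel-+ k (vanishes-* k ((suc m × 1#) * δ (δ x)) previous)
          (vanishes-cong k split V′))
      where
      previous : Vanishes k f
      previous = vanishes-root k m x x≈0 δx≢0
        (λ j p → char j (ℕ.≤-trans p (ℕ.+-monoʳ-≤ m (ℕ.n≤1+n k)))) (vanishes-pred k V)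
      -- At the point the term with x drops out, leaving (m + 1) * δ x * f, whose first two factors
      -- are nonzero.
      root : ev f K.≈ K.0#
      root = no-zero-divisors (no-zero-divisors
        (K.trans (K.sym (K.trans (+-homo _ _)
          (K.trans (K.+-cong (K.trans (*-homo _ _) (K.*-congˡ (*-homo _ _)))
                             (K.trans (*-homo _ _) (K.trans (K.*-congʳ x≈0) (K.zeroˡ _))))
            (K.+-identityʳ _)))) v)
        (char m (ℕ.≤-trans (ℕ.≤-reflexive (ℕ.+-comm 1 m)) (ℕ.+-monoʳ-≤ m (s≤s z≤n))))) δx≢0
      δ-multiple : ∀ n → δ (n × 1#) ≈ 0#
      δ-multiple zero    = δ-0
      δ-multiple (suc n) = trans (δ-+ _ _) (trans (+-cong δ-1 (δ-multiple n)) (+-identityˡ 0#))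
      split : δ ((suc m × 1#) * (δ x * f) + x * δ f) ≈
              (suc m × 1#) * δ (δ x) * f + ((suc (suc m) × 1#) * (δ x * δ f) + x * δ (δ f))
      split = begin
        δ ((suc m × 1#) * (δ x * f) + x * δ f)
          ≈⟨ δ-+ _ _ ⟩
        δ ((suc m × 1#) * (δ x * f)) + δ (x * δ f)
          ≈⟨ +-cong (trans (δ-* _ _) (+-cong (*-congʳ (δ-multiple (suc m))) (*-congˡ (δ-* _ _)))) (δ-* _ _) ⟩
        (0# * (δ x * f) + (suc m × 1#) * (δ (δ x) * f + δ x * δ f)) + (δ x * δ f + x * δ (δ f))
          ≈⟨ solve 7 (λ m d f e g x h →
               (:0 :* (d :* f) :+ m :* (e :* f :+ d :* g)) :+ (d :* g :+ x :* h) :=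
               m :* e :* f :+ ((:1 :+ m) :* (d :* g) :+ x :* h)) refl
               (suc m × 1#) (δ x) f (δ (δ x)) (δ f) x (δ (δ f)) ⟩
        (suc m × 1#) * δ (δ x) * f + ((suc (suc m) × 1#) * (δ x * δ f) + x * δ (δ f)) ∎

    -- δ (x * f) = δ x * f + x * δ f is the hypothesis of `vanishes-root` for m = 0. A simple zero
    -- thus uses up exactly one order.
    vanishes-factor : ∀ k x {f} → ev x K.≈ K.0# → ¬ (ev (δ x) K.≈ K.0#) →
      (∀ j → suc j ≤ k → ¬ (ev (suc j × 1#) K.≈ K.0#)) →
      Vanishes (suc k) (x * f) → Vanishes k f
    vanishes-factor k x {f} x≈0 δx≢0 char (_ , V) = vanishes-root k 0 x x≈0 δx≢0 char
      (vanishes-cong k (trans (δ-* x f) (+-congʳ (sym (trans (*-congʳ (+-identityʳ 1#)) (*-identityˡ _))))) V)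

-- Counting zeros with multiplicity by the degree.

module RootCounting (K : CommutativeRing 0ℓ 0ℓ)
  (no-zero-divisors : ∀ {x y} → CommutativeRing._≈_ K (CommutativeRing._*_ K x y) (CommutativeRing.0# K) →
    ¬ CommutativeRing._≈_ K x (CommutativeRing.0# K) → CommutativeRing._≈_ K y (CommutativeRing.0# K))
  where
  open CommutativeRing K
  open PowerSeries K using (DegBelow)
  open Polynomials K
  open import Algebra.Properties.Semiring.Mult semiring using (_×_)
  open import Algebra.Properties.Group +-group using (x∙y⁻¹≈ε⇒x≈y)
  private
    module P = CommutativeRing polynomialRing
    open import Algebra.Properties.Semiring.Mult P.semiring using () renaming (_×_ to _×ᵖ_)
    module SP = IntegerSolver polynomialRing

  w : P.Carrier
  w = Xᵖ P.* (P.1# P.- Xᵖ)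

  -- The factor `w` vanishes at 0 and 1, so these points are excluded from every count; at any other
  -- z the value of θ (X - z) is nonzero, as dividing out zeros requires.
  θ : P.Carrier → P.Carrier
  θ f = w P.* derivativeᵖ f

  θ-isDerivation : IsDerivation polynomialRing θ
  θ-isDerivation = Derivations.scaled-isDerivation polynomialRing derivativeᵖ derivativeᵖ-isDerivation w

  module Order (z : Carrier) =
    VanishingOrder polynomialRing K θ θ-isDerivation (evaluate z) (evaluate-isRingHomomorphism z)
  open Order public using (Vanishes)

  evaluate-sub : ∀ z f g → evaluate z (f P.- g) ≈ evaluate z f - evaluate z g
  evaluate-sub z f g = trans (evaluate-+ z f (P.- g)) (+-congˡ (evaluate-neg z g))

  evaluate-linear : ∀ z z₀ → evaluate z (Xᵖ P.- constantᵖ z₀) ≈ z - z₀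
  evaluate-linear z z₀ = trans (evaluate-sub z Xᵖ (constantᵖ z₀))
    (+-cong (evaluate-X z) (-‿cong (evaluate-constant z z₀)))

  evaluate-w : ∀ z → evaluate z w ≈ z * (1# - z)
  evaluate-w z = trans (evaluate-* z Xᵖ (P.1# P.- Xᵖ)) (*-cong (evaluate-X z)
    (trans (evaluate-sub z P.1# Xᵖ) (+-cong (evaluate-constant z 1#) (-‿cong (evaluate-X z)))))

  evaluate-θ-linear : ∀ z z₀ → evaluate z (θ (Xᵖ P.- constantᵖ z₀)) ≈ z * (1# - z)
  evaluate-θ-linear z z₀ = trans (evaluate-cong z θ-linear) (evaluate-w z)
    where
    open Derivations polynomialRing derivativeᵖ derivativeᵖ-isDerivation
    θ-linear : θ (Xᵖ P.- constantᵖ z₀) P.≈ w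
    θ-linear = P.trans
      (P.*-congˡ (P.trans (δ-+ Xᵖ (P.- constantᵖ z₀))
        (P.+-cong derivativeᵖ-X (P.trans (δ-neg (constantᵖ z₀)) (P.-‿cong (derivativeᵖ-constant z₀))))))
      (SP.solve 2 (λ w o → w SP.:* (SP.:1 SP.:- SP.:0) SP.:= w) P.refl w Xᵖ)

  evaluate-multiple : ∀ z n → evaluate z (n ×ᵖ P.1#) ≈ n × 1#
  evaluate-multiple z zero    = IsRingHomomorphism.0#-homo (evaluate-isRingHomomorphism z)
  evaluate-multiple z (suc n) =
    trans (evaluate-+ z P.1# (n ×ᵖ P.1#)) (+-cong (evaluate-constant z 1#) (evaluate-multiple z n))

  module _ (p : ℕ) (characteristic : ∀ n → suc n < p → ¬ (suc n × 1# ≈ 0#)) where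

    -- D divisions by X - z, each lowering the order at z by one; D < p keeps the integers that
    -- arise nonzero. At any other point X - z does not vanish, so orders there survive.
    divide-power : ∀ D z N f → D < p → ¬ (z ≈ 0#) → ¬ (z ≈ 1#) →
      DegBelow N (coef f) → ¬ (f P.≈ P.0#) → Vanishes z D f →
      D ≤ N ∧ ∃[ g ] (DegBelow (N ℕ.∸ D) (coef g) ∧ ¬ (g P.≈ P.0#) ∧
        (∀ z′ → ¬ (z′ ≈ z) → ∀ k → Vanishes z′ k f → Vanishes z′ k g))
    divide-power zero    z N f D<p z≢0 z≢1 df f≢0 V = z≤n , f , df , f≢0 , λ z′ _ k V′ → V′
    divide-power (suc D) z zero f D<p z≢0 z≢1 df f≢0 V =
      ⊥-elim (f≢0 (coefwise (λ n → trans (df n z≤n) (sym (coef-0 n)))))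
    divide-power (suc D) z (suc N) f D<p z≢0 z≢1 df f≢0 V =
      let D≤N , g , dg , g≢0 , transfer =
            divide-power D z N q (ℕ.<⇒≤ D<p) z≢0 z≢1 (deg-quotient z f N df) q≢0 Vq
      in s≤s D≤N , g , dg , g≢0 , λ z′ z′≢z k V′ →
        transfer z′ z′≢z k (Order.vanishes-cancel-* z′ no-zero-divisors k x
          (λ e → z′≢z (x∙y⁻¹≈ε⇒x≈y _ _ (trans (sym (evaluate-linear z′ z)) e)))
          (Order.vanishes-cong z′ k f≈xq V′))
      where
      x = Xᵖ P.- constantᵖ z
      q = quotient z f
      f≈xq : f P.≈ x P.* q
      f≈xq = factor z f (proj₁ V)
      q≢0 : ¬ (q P.≈ P.0#)
      q≢0 q≈0 = f≢0 (P.trans f≈xq (P.trans (P.*-congˡ q≈0) (P.zeroʳ x)))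
      θx≢0 : ¬ (evaluate z (θ x) ≈ 0#)
      θx≢0 e = z≢1 (sym (x∙y⁻¹≈ε⇒x≈y _ _ (no-zero-divisors (trans (sym (evaluate-θ-linear z z)) e) z≢0)))
      Vq : Vanishes z D q
      Vq = Order.vanishes-factor z no-zero-divisors D x
        (trans (evaluate-linear z z) (-‿inverseʳ z)) θx≢0
        (λ j j<D e → characteristic j (ℕ.≤-trans (s≤s j<D) (ℕ.<⇒≤ D<p)) (trans (sym (evaluate-multiple z (suc j))) e))
        (Order.vanishes-cong z (suc D) f≈xq V)

    -- The points are divided out one after another, and each takes D from the degree bound.
    root-count : ∀ D zs N f → D < p →
      AllPairs (λ x y → ¬ (x ≈ y)) zs → All (λ z → ¬ (z ≈ 0#) ∧ ¬ (z ≈ 1#)) zs →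
      DegBelow N (coef f) → ¬ (f P.≈ P.0#) → All (λ z → Vanishes z D f) zs →
      length zs ℕ.* D ≤ N
    root-count D []       N f D<p _ _ _ _ _ = z≤n
    root-count D (z ∷ zs) N f D<p (z≢zs ∷ distinct) ((z≢0 , z≢1) ∷ nz) df f≢0 (V ∷ Vs) =
      let D≤N , g , dg , g≢0 , transfer = divide-power D z N f D<p z≢0 z≢1 df f≢0 V
          transfer-all : ∀ {ys} → All (λ y → ¬ (z ≈ y)) ys →
            All (λ y → Vanishes y D f) ys → All (λ y → Vanishes y D g) ys
          transfer-all = λ n v → All.zipWith {P = λ y → ¬ (z ≈ y)} {Q = λ y → Vanishes y D f} {R = λ y → Vanishes y D g}
            (λ {y} (z≢y , V′) → transfer y (λ e → z≢y (sym e)) D V′) (n , v)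
      in ℕ.≤-trans
        (ℕ.+-monoʳ-≤ D (root-count D zs (N ℕ.∸ D) g D<p distinct nz dg g≢0 (transfer-all z≢zs Vs)))
        (ℕ.≤-reflexive (ℕ.m+[n∸m]≡n D≤N))

-- Independence of the products X ^ (t b) * (1 - X) ^ (t c) over polynomials of small degree.

module Independence (K : CommutativeRing 0ℓ 0ℓ)
  (no-zero-divisors : ∀ {x y} → CommutativeRing._≈_ K (CommutativeRing._*_ K x y) (CommutativeRing.0# K) →
    ¬ CommutativeRing._≈_ K x (CommutativeRing.0# K) → CommutativeRing._≈_ K y (CommutativeRing.0# K))
  (p : ℕ)
  (characteristic : ∀ n → suc n < p → ¬ CommutativeRing._≈_ K
    (Algebra.Properties.Semiring.Mult._×_ (CommutativeRing.semiring K) (suc n) (CommutativeRing.1# K)) (CommutativeRing.0# K))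
  where
  open CommutativeRing K hiding (zero)
  open PowerSeries K
  open Polynomials K
  open import Algebra.Properties.Semiring.Mult semiring using (_×_)
  open import Relation.Binary.Reasoning.Setoid setoid
  private
    module P = CommutativeRing polynomialRing
    module S = IntegerSolver K
    module SP = IntegerSolver polynomialRing
    module D = Derivations polynomialRing derivativeᵖ derivativeᵖ-isDerivation
  open import Algebra.Properties.Semiring.Mult P.semiring using () renaming (_×_ to _×ᵖ_)
  open import Algebra.Properties.Semiring.Exp P.semiring using (_^_; ^-homo-*; ^-congʳ)
  open import Algebra.Properties.Semiring.Sum P.semiring using (sum; sum-cong-≋; *-distribˡ-sum)

  u : Polynomial
  u = P.1# P.- Xᵖ

  δ-u : derivativeᵖ u P.≈ P.- P.1#
  δ-u = P.trans (D.δ-+ P.1# (P.- Xᵖ)) (P.trans (P.+-cong D.δ-1 (P.trans (D.δ-neg Xᵖ) (P.-‿cong derivativeᵖ-X)))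
    (P.+-identityˡ _))

  coef-multiple : ∀ n f i → coef ((n ×ᵖ P.1#) P.* f) i ≈ (n × 1#) * coef f i
  coef-multiple zero f i = trans (at (P.zeroˡ f) i) (trans (coef-0 i) (sym (zeroˡ _)))
  coef-multiple (suc n) f i = begin
    coef ((P.1# P.+ (n ×ᵖ P.1#)) P.* f) i           ≈⟨ at (P.distribʳ f P.1# (n ×ᵖ P.1#)) i ⟩
    coef (P.1# P.* f P.+ (n ×ᵖ P.1#) P.* f) i       ≈⟨ coef-+ _ _ i ⟩
    coef (P.1# P.* f) i + coef ((n ×ᵖ P.1#) P.* f) i ≈⟨ +-cong (at (P.*-identityˡ f) i) (coef-multiple n f i) ⟩
    coef f i + (n × 1#) * coef f i                  ≈⟨ S.solve 2 (λ c n → c S.:+ n S.:* c S.:= (S.:1 S.:+ n) S.:* c) refl _ _ ⟩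
    (1# + n × 1#) * coef f i                        ∎

  coef-u* : ∀ f i → coef (u P.* f) i ≈ coef f i - coef (Xᵖ P.* f) i
  coef-u* f i = begin
    coef (u P.* f) i                ≈⟨ at (SP.solve 2 (λ x f → (SP.:1 SP.:- x) SP.:* f SP.:= f SP.:- x SP.:* f) P.refl Xᵖ f) i ⟩
    coef (f P.- Xᵖ P.* f) i         ≈⟨ coef-+ _ _ i ⟩
    coef f i + coef (P.- (Xᵖ P.* f)) i ≈⟨ +-congˡ (coef-neg _ i) ⟩
    coef f i - coef (Xᵖ P.* f) i    ∎

  coef-X*-zero : ∀ f → coef (Xᵖ P.* f) 0 ≈ 0#
  coef-X*-zero f = trans (coef-* Xᵖ f 0) (trans (*-congʳ (coef-X 0)) (zeroˡ _))

  coef-X*-suc : ∀ f i → coef (Xᵖ P.* f) (suc i) ≈ coef f i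
  coef-X*-suc f i = trans (coef-* Xᵖ f (suc i))
    (trans (*ˢ-cong coef-X (λ _ → refl) (suc i)) (X-*-suc (coef f) i))

  multiple : ∀ n x → n × x ≈ (n × 1#) * x
  multiple zero    x = sym (zeroˡ x)
  multiple (suc n) x = trans (+-cong (sym (*-identityˡ x)) (multiple n x)) (sym (distribʳ _ _ _))

  coef-X*derivative : ∀ f i → coef (Xᵖ P.* derivativeᵖ f) i ≈ (i × 1#) * coef f i
  coef-X*derivative f zero    = trans (coef-X*-zero (derivativeᵖ f)) (sym (zeroˡ _))
  coef-X*derivative f (suc i) = trans (coef-X*-suc (derivativeᵖ f) i)
    (trans (coef-derivative f i) (multiple (suc i) _))

  -- derivativeᵖ (u ^ suc s * f) = u ^ s * twist s f
  twist : ℕ → Polynomial → Polynomial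
  twist s f = u P.* derivativeᵖ f P.- (suc s ×ᵖ P.1#) P.* f

  coef-twist : ∀ s f i →
    coef (twist s f) i ≈ (suc i × 1#) * coef f (suc i) - ((i × 1#) + (suc s × 1#)) * coef f i
  coef-twist s f i = begin
    coef (twist s f) i
      ≈⟨ trans (coef-+ _ _ i) (+-congˡ (coef-neg _ i)) ⟩
    coef (u P.* derivativeᵖ f) i - coef ((suc s ×ᵖ P.1#) P.* f) i
      ≈⟨ +-cong (trans (coef-u* (derivativeᵖ f) i)
           (+-cong (trans (coef-derivative f i) (multiple (suc i) _)) (-‿cong (coef-X*derivative f i))))
           (-‿cong (coef-multiple (suc s) f i)) ⟩
    (suc i × 1#) * coef f (suc i) - (i × 1#) * coef f i - (suc s × 1#) * coef f i
      ≈⟨ S.solve 5 (λ a b c d e → a S.:* b S.:- c S.:* d S.:- e S.:* d S.:= a S.:* b S.:- (c S.:+ e) S.:* d) refl _ _ _ _ _ ⟩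
    (suc i × 1#) * coef f (suc i) - ((i × 1#) + (suc s × 1#)) * coef f i ∎

  deg-twist : ∀ s A f → DegBelow A (coef f) → DegBelow A (coef (twist s f))
  deg-twist s A f df i A≤i = trans (coef-twist s f i) (trans
    (+-cong (trans (*-congˡ (df (suc i) (ℕ.m≤n⇒m≤1+n A≤i))) (zeroʳ _))
            (-‿cong (trans (*-congˡ (df i A≤i)) (zeroʳ _))))
    (-‿inverseʳ 0#))

  -- If f has degree at most A, then `twist s f` has coefficient A equal to -(A + s + 1) times that
  -- of f, and A + s + 1 < p is nonzero in K. So the coefficients of f vanish from the top down.
  twist-injective : ∀ s A f → A ℕ.+ s < p → DegBelow A (coef f) → twist s f P.≈ P.0# → f P.≈ P.0#
  twist-injective s zero    f _   df _  = coefwise (λ n → trans (df n z≤n) (sym (coef-0 n)))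
  twist-injective s (suc A) f A<p df Tf≈0 = twist-injective s A f (ℕ.<⇒≤ A<p) df′ Tf≈0
    where
    open import Algebra.Properties.Semiring.Mult semiring using (×-homo-+)
    top : coef f A ≈ 0#
    top = no-zero-divisors {(A ℕ.+ suc s) × 1#} (begin
      ((A ℕ.+ suc s) × 1#) * coef f A
        ≈⟨ *-congʳ (×-homo-+ 1# A (suc s)) ⟩
      ((A × 1#) + (suc s × 1#)) * coef f A
        ≈⟨ S.solve 3 (λ a b c → c S.:= a S.:* S.:0 S.:- (a S.:* S.:0 S.:- c)) refl (suc A × 1#) 0# _ ⟩
      (suc A × 1#) * 0# - ((suc A × 1#) * 0# - ((A × 1#) + (suc s × 1#)) * coef f A)
        ≈⟨ +-cong (zeroʳ _) (-‿cong (trans (+-congʳ (*-congˡ (sym (df (suc A) ℕ.≤-refl))))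
             (trans (sym (coef-twist s f A)) (trans (at Tf≈0 A) (coef-0 A))))) ⟩
      0# - 0#
        ≈⟨ -‿inverseʳ 0# ⟩
      0# ∎)
      (≡.subst (λ m → ¬ (m × 1# ≈ 0#)) (≡.sym (ℕ.+-suc A s)) (characteristic (A ℕ.+ s) A<p))
    df′ : DegBelow A (coef f)
    df′ n A≤n with n ℕ.≟ A
    ... | yes ≡.refl = top
    ... | no  n≢A    = df n (ℕ.≤∧≢⇒< A≤n (λ e → n≢A (≡.sym e)))

  derivative-power : ∀ s → derivativeᵖ (u ^ suc s) P.≈ P.- ((suc s ×ᵖ P.1#) P.* u ^ s)
  derivative-power zero = P.trans (D.δ-cong (P.*-identityʳ u)) (P.trans δ-u
    (SP.solve 1 (λ o → SP.:- SP.:1 SP.:= SP.:- ((SP.:1 SP.:+ SP.:0) SP.:* SP.:1)) P.refl u))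
  derivative-power (suc s) = P.trans (D.δ-* u (u ^ suc s)) (P.trans
    (P.+-cong (P.*-congʳ δ-u) (P.*-congˡ (derivative-power s)))
    (SP.solve 3 (λ u v n → (SP.:- SP.:1) SP.:* (u SP.:* v) SP.:+ u SP.:* (SP.:- (n SP.:* v)) SP.:=
      SP.:- ((SP.:1 SP.:+ n) SP.:* (u SP.:* v))) P.refl u (u ^ s) (suc s ×ᵖ P.1#)))

  derivative-twist : ∀ s f → derivativeᵖ (u ^ suc s P.* f) P.≈ u ^ s P.* twist s f
  derivative-twist s f = P.trans (D.δ-* (u ^ suc s) f) (P.trans
    (P.+-congʳ (P.*-congʳ (derivative-power s)))
    (SP.solve 5 (λ n v f u g → (SP.:- (n SP.:* v)) SP.:* f SP.:+ u SP.:* v SP.:* g SP.:= v SP.:* (u SP.:* g SP.:- n SP.:* f))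
      P.refl (suc s ×ᵖ P.1#) (u ^ s) f u (derivativeᵖ f)))

  derivatives : ℕ → Polynomial → Polynomial
  derivatives zero    f = f
  derivatives (suc k) f = derivatives k (derivativeᵖ f)

  twists : ℕ → ℕ → Polynomial → Polynomial
  twists e zero    f = f
  twists e (suc k) f = twists e k (twist (k ℕ.+ e) f)

  derivatives-cong : ∀ k {f g} → f P.≈ g → derivatives k f P.≈ derivatives k g
  derivatives-cong zero    p = p
  derivatives-cong (suc k) p = derivatives-cong k (D.δ-cong p)

  derivatives-+ : ∀ k f g → derivatives k (f P.+ g) P.≈ derivatives k f P.+ derivatives k g
  derivatives-+ zero    f g = P.refl
  derivatives-+ (suc k) f g = P.trans (derivatives-cong k (D.δ-+ f g)) (derivatives-+ k _ _)

  derivatives-sum : ∀ k {n} (f : Fin n → Polynomial) →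
    derivatives k (sum f) P.≈ sum (λ i → derivatives k (f i))
  derivatives-sum zero    f = P.refl
  derivatives-sum (suc k) f = P.trans (derivatives-cong k (D.δ-sum f)) (derivatives-sum k (λ i → derivativeᵖ (f i)))

  -- Each derivative takes one factor u and twists f with the exponent that remains, so the twists
  -- run from k + e - 1 down to e.
  derivatives-twists : ∀ e k f → derivatives k (u ^ (k ℕ.+ e) P.* f) P.≈ u ^ e P.* twists e k f
  derivatives-twists e zero    f = P.refl
  derivatives-twists e (suc k) f = P.trans
    (derivatives-cong k (derivative-twist (k ℕ.+ e) f)) (derivatives-twists e k (twist (k ℕ.+ e) f))

  deg-twists : ∀ e k A f → DegBelow A (coef f) → DegBelow A (coef (twists e k f))
  deg-twists e zero    A f df = df
  deg-twists e (suc k) A f df = deg-twists e k A _ (deg-twist (k ℕ.+ e) A f df)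

  twists-injective : ∀ e k A f → A ℕ.+ (k ℕ.+ e) ≤ p → DegBelow A (coef f) →
    twists e k f P.≈ P.0# → f P.≈ P.0#
  twists-injective e zero    A f _  df Tf≈0 = Tf≈0
  twists-injective e (suc k) A f le df Tf≈0 = twist-injective (k ℕ.+ e) A f lt df
    (twists-injective e k A _ (ℕ.<⇒≤ lt) (deg-twist (k ℕ.+ e) A f df) Tf≈0)
    where
    lt : A ℕ.+ (k ℕ.+ e) < p
    lt = ≡.subst (_≤ p) (ℕ.+-suc A (k ℕ.+ e)) le

  derivatives-deg : ∀ A f → DegBelow A (coef f) → derivatives A f P.≈ P.0#
  derivatives-deg zero    f df = coefwise (λ n → trans (df n z≤n) (sym (coef-0 n)))
  derivatives-deg (suc A) f df = derivatives-deg A _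
    (λ n A≤n → trans (coef-derivative f n) (deg-derivative df n A≤n))

  derivatives-ord : ∀ k n f → OrdFrom (k ℕ.+ n) (coef f) → OrdFrom n (coef (derivatives k f))
  derivatives-ord zero    n f of = of
  derivatives-ord (suc k) n f of = derivatives-ord k n (derivativeᵖ f)
    (λ i i< → trans (coef-derivative f i) (×-zero (suc i) (of (suc i) (s≤s i<))))

  ord-cong : ∀ n {f g} → f P.≈ g → OrdFrom n (coef f) → OrdFrom n (coef g)
  ord-cong n f≈g of i i<n = trans (sym (at f≈g i)) (of i i<n)

  -- 1 - X is invertible as a power series: coefficient i of f is that of u * f plus coefficient i -
  -- 1 of f.
  ord-u* : ∀ n f → OrdFrom n (coef (u P.* f)) → OrdFrom n (coef f)
  ord-u* n f of zero    i<n = trans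
    (S.solve 2 (λ a b → a S.:= (a S.:- b) S.:+ b) refl _ _)
    (trans (+-cong (trans (sym (coef-u* f 0)) (of 0 i<n)) (coef-X*-zero f)) (+-identityˡ 0#))
  ord-u* n f of (suc i) i<n = trans
    (S.solve 2 (λ a b → a S.:= (a S.:- b) S.:+ b) refl _ _)
    (trans (+-cong (trans (sym (coef-u* f (suc i))) (of (suc i) i<n))
                   (trans (coef-X*-suc f i) (ord-u* n f of i (ℕ.<⇒≤ i<n)))) (+-identityˡ 0#))

  ord-u^ : ∀ s n f → OrdFrom n (coef (u ^ s P.* f)) → OrdFrom n (coef f)
  ord-u^ zero    n f of = ord-cong n (P.*-identityˡ f) of
  ord-u^ (suc s) n f of = ord-u^ s n f (ord-u* n (u ^ s P.* f) (ord-cong n (P.*-assoc u (u ^ s) f) of))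

  ord-X^ : ∀ s f → OrdFrom s (coef (Xᵖ ^ s P.* f))
  ord-X^ (suc s) f zero    _         = trans (at (P.*-assoc Xᵖ (Xᵖ ^ s) f) 0) (coef-X*-zero _)
  ord-X^ (suc s) f (suc i) (s≤s i<s) = trans (at (P.*-assoc Xᵖ (Xᵖ ^ s) f) (suc i))
    (trans (coef-X*-suc _ i) (ord-X^ s f i i<s))

  cancel-X^ : ∀ s f → Xᵖ ^ s P.* f P.≈ P.0# → f P.≈ P.0#
  cancel-X^ zero    f e = P.trans (P.sym (P.*-identityˡ f)) e
  cancel-X^ (suc s) f e = cancel-X^ s f (coefwise (λ n → trans (sym (coef-X*-suc (Xᵖ ^ s P.* f) n))
    (trans (at (P.sym (P.*-assoc Xᵖ (Xᵖ ^ s) f)) (suc n)) (trans (at e (suc n)) (trans (coef-0 _) (sym (coef-0 n)))))))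

  sum-zero : ∀ {n} (f : Fin n → Polynomial) → (∀ i → f i P.≈ P.0#) → sum f P.≈ P.0#
  sum-zero {zero}  f z = P.refl
  sum-zero {suc n} f z = P.trans (P.+-cong (z zero) (sum-zero (λ i → f (suc i)) (λ i → z (suc i)))) (P.+-identityˡ _)

  -- Differentiating A times removes the term f 0 and costs A orders of
  -- vanishing at 0; the other terms keep their shape after division by a power of u.
  independent-u : ∀ t A m (f : Fin m → Polynomial) → A ≤ t → t ℕ.* m ≤ p →
    (∀ j → DegBelow A (coef (f j))) →
    OrdFrom (A ℕ.* m) (coef (sum (λ j → u ^ (t ℕ.* toℕ j) P.* f j))) →
    ∀ j → f j P.≈ P.0#
  independent-u t A (suc m) f A≤t tm≤p df of = λ where
      zero    → f₀≈0
      (suc j) → later j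
    where
    -- The exponent of u left in term j + 1 after A derivatives. It always contains t - A, so u ^ (t
    -- - A) is a common factor and can be divided out.
    e : Fin m → ℕ
    e j = (t ℕ.∸ A) ℕ.+ t ℕ.* toℕ j
    A+e : ∀ j → t ℕ.* suc (toℕ j) ≡.≡ A ℕ.+ e j
    A+e j = ≡.trans (ℕ.*-suc t (toℕ j)) (≡.trans (≡.cong (ℕ._+ t ℕ.* toℕ j) (≡.sym (ℕ.m+[n∸m]≡n A≤t)))
      (ℕ.+-assoc A (t ℕ.∸ A) (t ℕ.* toℕ j)))
    g : Fin m → Polynomial
    g j = twists (e j) A (f (suc j))
    G = sum (λ j → u ^ (t ℕ.* toℕ j) P.* f j)
    first : u ^ (t ℕ.* 0) P.* f zero P.≈ f zero
    first = P.trans (P.*-congʳ (^-congʳ u (ℕ.*-zeroʳ t))) (P.*-identityˡ _)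
    term : ∀ j → derivatives A (u ^ (t ℕ.* suc (toℕ j)) P.* f (suc j)) P.≈
                 u ^ (t ℕ.∸ A) P.* (u ^ (t ℕ.* toℕ j) P.* g j)
    term j = P.trans (derivatives-cong A (P.*-congʳ (^-congʳ u (A+e j))))
      (P.trans (derivatives-twists (e j) A (f (suc j)))
      (P.trans (P.*-congʳ (^-homo-* u (t ℕ.∸ A) (t ℕ.* toℕ j))) (P.*-assoc _ _ _)))
    G′ : derivatives A G P.≈ u ^ (t ℕ.∸ A) P.* sum (λ j → u ^ (t ℕ.* toℕ j) P.* g j)
    G′ = P.trans (derivatives-+ A _ _) (P.trans
      (P.+-cong (P.trans (derivatives-cong A first) (derivatives-deg A _ (df zero)))
        (P.trans (derivatives-sum A (λ j → u ^ (t ℕ.* suc (toℕ j)) P.* f (suc j)))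
          (P.trans (sum-cong-≋ term) (P.sym (*-distribˡ-sum (u ^ (t ℕ.∸ A)) (λ j → u ^ (t ℕ.* toℕ j) P.* g j))))))
      (P.+-identityˡ _))
    g≈0 : ∀ j → g j P.≈ P.0#
    g≈0 = independent-u t A m g A≤t (ℕ.≤-trans (ℕ.*-monoʳ-≤ t (ℕ.n≤1+n m)) tm≤p)
      (λ j → deg-twists (e j) A A _ (df (suc j)))
      (ord-u^ (t ℕ.∸ A) (A ℕ.* m) _ (ord-cong (A ℕ.* m) G′
        (derivatives-ord A (A ℕ.* m) G (≡.subst (λ k → OrdFrom k (coef G)) (ℕ.*-suc A m) of))))
    -- A + e j is t (j + 1), and a further A ≤ t stays within t times the number of terms; this is
    -- the smallness required for undoing the twists.
    bound-e : ∀ j → A ℕ.+ (A ℕ.+ e j) ≤ p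
    bound-e j = ℕ.≤-trans (ℕ.+-mono-≤ A≤t (ℕ.≤-reflexive (≡.sym (A+e j))))
      (ℕ.≤-trans (ℕ.≤-reflexive (≡.sym (ℕ.*-suc t (suc (toℕ j)))))
        (ℕ.≤-trans (ℕ.*-monoʳ-≤ t (s≤s (Fin.toℕ<n j))) tm≤p))
    later : ∀ j → f (suc j) P.≈ P.0#
    later j = twists-injective (e j) A A (f (suc j)) (bound-e j) (df (suc j)) (g≈0 j)
    G≈f₀ : G P.≈ f zero
    G≈f₀ = P.trans (P.+-cong first (sum-zero _ (λ j → P.trans (P.*-congˡ (later j)) (P.zeroʳ _))))
      (P.+-identityʳ _)
    -- With the other terms gone the sum is f 0: its coefficients below A vanish by the order
    -- hypothesis, those from A on by the degree.
    f₀≈0 : f zero P.≈ P.0#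
    f₀≈0 = coefwise (λ n → trans (f₀ n) (sym (coef-0 n)))
      where
      f₀ : ∀ n → coef (f zero) n ≈ 0#
      f₀ n with n ℕ.<? A
      ... | yes n<A = trans (sym (at G≈f₀ n))
        (of n (ℕ.≤-trans n<A (ℕ.≤-trans (ℕ.m≤m+n A (A ℕ.* m)) (ℕ.≤-reflexive (≡.sym (ℕ.*-suc A m))))))
      ... | no  n≮A = df zero n (ℕ.≮⇒≥ n≮A)

  -- Modulo X ^ t only b = 0 contributes, so the sum over c for b = 0 has order at least t ≥ A m at
  -- 0 and `independent-u` applies to it. The rest is divided by X ^ t.
  independent : ∀ t A n m (f : Fin n → Fin m → Polynomial) → A ≤ t → A ℕ.* m ≤ t → t ℕ.* m ≤ p →
    (∀ b c → DegBelow A (coef (f b c))) →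
    sum (λ b → Xᵖ ^ (t ℕ.* toℕ b) P.* sum (λ c → u ^ (t ℕ.* toℕ c) P.* f b c)) P.≈ P.0# →
    ∀ b c → f b c P.≈ P.0#
  independent t A (suc n) m f A≤t Am≤t tm≤p df e = λ where
      zero    c → f₀≈0 c
      (suc b) c → independent t A n m (λ b → f (suc b)) A≤t Am≤t tm≤p (λ b → df (suc b)) rest≈0 b c
    where
    G : Fin (suc n) → Polynomial
    G b = sum (λ c → u ^ (t ℕ.* toℕ c) P.* f b c)
    rest : Polynomial
    rest = sum (λ b → Xᵖ ^ (t ℕ.* toℕ b) P.* G (suc b))
    split : sum (λ b → Xᵖ ^ (t ℕ.* toℕ b) P.* G b) P.≈ G zero P.+ Xᵖ ^ t P.* rest
    split = P.+-cong (P.trans (P.*-congʳ (^-congʳ Xᵖ (ℕ.*-zeroʳ t))) (P.*-identityˡ _))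
      (P.trans (sum-cong-≋ {n} (λ b → P.trans (P.*-congʳ (P.trans (^-congʳ Xᵖ (ℕ.*-suc t (toℕ b))) (^-homo-* Xᵖ t (t ℕ.* toℕ b)))) (P.*-assoc _ _ _)))
        (P.sym (*-distribˡ-sum (Xᵖ ^ t) (λ b → Xᵖ ^ (t ℕ.* toℕ b) P.* G (suc b)))))
    f₀≈0 : ∀ c → f zero c P.≈ P.0#
    f₀≈0 = independent-u t A m (f zero) A≤t tm≤p (df zero) (λ i i< → begin
      coef (G zero) i
        ≈⟨ at (SP.solve 2 (λ a b → a SP.:= (a SP.:+ b) SP.:- b) P.refl (G zero) (Xᵖ ^ t P.* rest)) i ⟩
      coef ((G zero P.+ Xᵖ ^ t P.* rest) P.- Xᵖ ^ t P.* rest) i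
        ≈⟨ trans (coef-+ _ _ i) (+-congˡ (coef-neg _ i)) ⟩
      coef (G zero P.+ Xᵖ ^ t P.* rest) i - coef (Xᵖ ^ t P.* rest) i
        ≈⟨ +-cong (trans (at (P.trans (P.sym split) e) i) (coef-0 i)) (-‿cong (ord-X^ t rest i (ℕ.≤-trans i< Am≤t))) ⟩
      0# - 0#
        ≈⟨ -‿inverseʳ 0# ⟩
      0# ∎)
    rest≈0 : rest P.≈ P.0#
    rest≈0 = cancel-X^ t rest (P.trans (P.sym (P.+-identityˡ _))
      (P.trans (P.+-congʳ (P.sym (sum-zero _ (λ c → P.trans (P.*-congˡ (f₀≈0 c)) (P.zeroʳ _)))))
        (P.trans (P.sym split) e)))

-- The field of residues modulo p.

module PrimeField where

  open import Defs
  open import Algebra.Bundles using (CommutativeRing)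
  open import Data.Nat using (ℕ; zero; suc; _≤_; _<_; z≤n; s≤s; NonZero; _%_)
  open import Data.Nat.Primality using (Prime; euclidsLemma; prime⇒nonTrivial)
  open import Data.Nat.DivMod using (_mod_)
  open import Data.Nat.Divisibility using (_∣_; m%n≡0⇒n∣m; >⇒∤)
  import Data.Nat.DivMod as ℕ
  open import Level using (0ℓ)
  import Data.Nat as ℕ
  import Data.Nat.Properties as ℕ
  import Data.Nat.Coprimality as Coprime
  import Data.Nat.GCD as GCD
  open import Data.Fin using (Fin; zero; suc; toℕ; fromℕ<; combine; remQuot; funToFin; finToFun)
  import Data.Fin.Properties as Fin
  open import Data.Product using (_,_; proj₁; proj₂; ∃-syntax; _×_)
  open import Data.Sum using (inj₁; inj₂)
  open import Relation.Nullary using (¬_; yes; no; contradiction; ¬?)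
  open import Relation.Binary.PropositionalEquality hiding ([_])
  open import Data.List using (List; length; lookup)
  open import Data.List.Membership.Propositional using (_∈_)
  open import Data.List.Relation.Unary.Any using (index)
  open import Data.List.Relation.Unary.Any.Properties using (lookup-index)
  open import Data.List.Relation.Unary.All as All using (All)
  open import Data.List.Relation.Unary.Unique.Propositional using (Unique)
  open import Relation.Nullary.Decidable using (decidable-stable)
  import Algebra.Properties.Semiring.Mult
  import Algebra.Properties.Semiring.Exp
  import Algebra.Properties.Semiring.Sum
  open import Algebra.Morphism.Structures using (IsRingHomomorphism)

  module Residues (p : ℕ) .{{_ : NonZero p}} where

    neg : Fin p → Fin p
    neg x = (p ℕ.∸ toℕ x) mod p

    opaque

      -- The same as `_mod p`, but opaque, so that the ring laws are reduced to those of ℕ through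
      -- `[]-+` and `[]-*` without unfolding remainders.
      [_] : ℕ → Fin p
      [ m ] = m mod p

      toℕ-[] : ∀ m → toℕ [ m ] ≡ m % p
      toℕ-[] m = Fin.toℕ-fromℕ< (ℕ.m%n<n m p)

      []-cong : ∀ {m n} → m % p ≡ n % p → [ m ] ≡ [ n ]
      []-cong {m} {n} e = Fin.toℕ-injective (trans (toℕ-[] m) (trans e (sym (toℕ-[] n))))

      [toℕ] : ∀ x → [ toℕ x ] ≡ x
      [toℕ] x = Fin.toℕ-injective (trans (toℕ-[] (toℕ x)) (ℕ.m<n⇒m%n≡m (Fin.toℕ<n x)))

      []-+ : ∀ m n → [ m ] +ₚ [ n ] ≡ [ m ℕ.+ n ]
      []-+ m n = []-cong (trans (cong₂ (λ a b → (a ℕ.+ b) % p) (toℕ-[] m) (toℕ-[] n)) (sym (ℕ.%-distribˡ-+ m n p)))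

      []-* : ∀ m n → [ m ] *ₚ [ n ] ≡ [ m ℕ.* n ]
      []-* m n = []-cong (trans (cong₂ (λ a b → (a ℕ.* b) % p) (toℕ-[] m) (toℕ-[] n)) (sym (ℕ.%-distribˡ-* m n p)))

      []-0 : [ 0 ] ≡ 0ₚ
      []-0 = refl

      []-1 : [ 1 ] ≡ 1ₚ
      []-1 = refl

      []-neg : ∀ x → [ p ℕ.∸ toℕ x ] ≡ neg x
      []-neg x = refl

      []-p : [ p ] ≡ 0ₚ
      []-p = []-cong {p} {0} (trans (ℕ.n%n≡0 p) (sym (ℕ.m<n⇒m%n≡m (ℕ.>-nonZero⁻¹ p))))

      []≡0 : ∀ {m} → [ m ] ≡ 0ₚ → p ∣ m
      []≡0 {m} e = m%n≡0⇒n∣m m p (trans (sym (toℕ-[] m))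
        (trans (cong toℕ e) (trans (toℕ-[] 0) (ℕ.m<n⇒m%n≡m (ℕ.>-nonZero⁻¹ p)))))

      +ₚ-[] : ∀ x y → x +ₚ y ≡ [ toℕ x ℕ.+ toℕ y ]
      +ₚ-[] x y = refl

      *ₚ-[] : ∀ x y → x *ₚ y ≡ [ toℕ x ℕ.* toℕ y ]
      *ₚ-[] x y = refl

      sub-[] : ∀ x y → x -ₚ y ≡ [ toℕ x ℕ.+ (p ℕ.∸ toℕ y) ]
      sub-[] x y = refl

    open ≡-Reasoning

    +ₚ-comm : ∀ x y → x +ₚ y ≡ y +ₚ x
    +ₚ-comm x y = cong (_mod p) (ℕ.+-comm (toℕ x) (toℕ y))

    *ₚ-comm : ∀ x y → x *ₚ y ≡ y *ₚ x
    *ₚ-comm x y = cong (_mod p) (ℕ.*-comm (toℕ x) (toℕ y))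

    +ₚ-assoc : ∀ x y z → (x +ₚ y) +ₚ z ≡ x +ₚ (y +ₚ z)
    +ₚ-assoc x y z = begin
      (x +ₚ y) +ₚ z                        ≡⟨ cong₂ _+ₚ_ (+ₚ-[] x y) (sym ([toℕ] z)) ⟩
      [ toℕ x ℕ.+ toℕ y ] +ₚ [ toℕ z ]     ≡⟨ []-+ _ _ ⟩
      [ toℕ x ℕ.+ toℕ y ℕ.+ toℕ z ]        ≡⟨ cong [_] (ℕ.+-assoc (toℕ x) (toℕ y) (toℕ z)) ⟩
      [ toℕ x ℕ.+ (toℕ y ℕ.+ toℕ z) ]      ≡⟨ []-+ _ _ ⟨
      [ toℕ x ] +ₚ [ toℕ y ℕ.+ toℕ z ]     ≡⟨ cong₂ _+ₚ_ ([toℕ] x) (sym (+ₚ-[] y z)) ⟩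
      x +ₚ (y +ₚ z)                        ∎

    *ₚ-assoc : ∀ x y z → (x *ₚ y) *ₚ z ≡ x *ₚ (y *ₚ z)
    *ₚ-assoc x y z = begin
      (x *ₚ y) *ₚ z                        ≡⟨ cong₂ _*ₚ_ (*ₚ-[] x y) (sym ([toℕ] z)) ⟩
      [ toℕ x ℕ.* toℕ y ] *ₚ [ toℕ z ]     ≡⟨ []-* _ _ ⟩
      [ toℕ x ℕ.* toℕ y ℕ.* toℕ z ]        ≡⟨ cong [_] (ℕ.*-assoc (toℕ x) (toℕ y) (toℕ z)) ⟩
      [ toℕ x ℕ.* (toℕ y ℕ.* toℕ z) ]      ≡⟨ []-* _ _ ⟨
      [ toℕ x ] *ₚ [ toℕ y ℕ.* toℕ z ]     ≡⟨ cong₂ _*ₚ_ ([toℕ] x) (sym (*ₚ-[] y z)) ⟩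
      x *ₚ (y *ₚ z)                        ∎

    *ₚ-distribˡ : ∀ x y z → x *ₚ (y +ₚ z) ≡ x *ₚ y +ₚ x *ₚ z
    *ₚ-distribˡ x y z = begin
      x *ₚ (y +ₚ z)                               ≡⟨ cong₂ _*ₚ_ (sym ([toℕ] x)) (+ₚ-[] y z) ⟩
      [ toℕ x ] *ₚ [ toℕ y ℕ.+ toℕ z ]            ≡⟨ []-* _ _ ⟩
      [ toℕ x ℕ.* (toℕ y ℕ.+ toℕ z) ]             ≡⟨ cong [_] (ℕ.*-distribˡ-+ (toℕ x) (toℕ y) (toℕ z)) ⟩
      [ toℕ x ℕ.* toℕ y ℕ.+ toℕ x ℕ.* toℕ z ]     ≡⟨ []-+ _ _ ⟨
      [ toℕ x ℕ.* toℕ y ] +ₚ [ toℕ x ℕ.* toℕ z ]  ≡⟨ cong₂ _+ₚ_ (sym (*ₚ-[] x y)) (sym (*ₚ-[] x z)) ⟩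
      x *ₚ y +ₚ x *ₚ z                            ∎

    +ₚ-identityˡ : ∀ x → 0ₚ +ₚ x ≡ x
    +ₚ-identityˡ x = begin
      0ₚ +ₚ x            ≡⟨ cong₂ _+ₚ_ (sym []-0) (sym ([toℕ] x)) ⟩
      [ 0 ] +ₚ [ toℕ x ] ≡⟨ []-+ _ _ ⟩
      [ toℕ x ]          ≡⟨ [toℕ] x ⟩
      x                  ∎

    *ₚ-identityˡ : ∀ x → 1ₚ *ₚ x ≡ x
    *ₚ-identityˡ x = begin
      1ₚ *ₚ x            ≡⟨ cong₂ _*ₚ_ (sym []-1) (sym ([toℕ] x)) ⟩
      [ 1 ] *ₚ [ toℕ x ] ≡⟨ []-* _ _ ⟩
      [ 1 ℕ.* toℕ x ]    ≡⟨ cong [_] (ℕ.*-identityˡ (toℕ x)) ⟩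
      [ toℕ x ]          ≡⟨ [toℕ] x ⟩
      x                  ∎

    -ₚ-inverseʳ : ∀ x → x +ₚ (neg x) ≡ 0ₚ
    -ₚ-inverseʳ x = begin
      x +ₚ (neg x)                       ≡⟨ cong₂ _+ₚ_ (sym ([toℕ] x)) (sym ([]-neg x)) ⟩
      [ toℕ x ] +ₚ [ p ℕ.∸ toℕ x ]      ≡⟨ []-+ _ _ ⟩
      [ toℕ x ℕ.+ (p ℕ.∸ toℕ x) ]       ≡⟨ cong [_] (ℕ.m+[n∸m]≡n (ℕ.<⇒≤ (Fin.toℕ<n x))) ⟩
      [ p ]                             ≡⟨ []-p ⟩
      0ₚ                                ∎

    -ₚ-def : ∀ x y → x -ₚ y ≡ x +ₚ (neg y)
    -ₚ-def x y = begin
      x -ₚ y                            ≡⟨ sub-[] x y ⟩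
      [ toℕ x ℕ.+ (p ℕ.∸ toℕ y) ]       ≡⟨ []-+ _ _ ⟨
      [ toℕ x ] +ₚ [ p ℕ.∸ toℕ y ]      ≡⟨ cong₂ _+ₚ_ ([toℕ] x) ([]-neg y) ⟩
      x +ₚ (neg y)                       ∎

    residueRing : CommutativeRing 0ℓ 0ℓ
    residueRing = record
      { Carrier = Fin p
      ; _≈_ = _≡_
      ; _+_ = _+ₚ_
      ; _*_ = _*ₚ_
      ; -_  = neg
      ; 0#  = 0ₚ
      ; 1#  = 1ₚ
      ; isCommutativeRing = record
        { isRing = record
          { +-isAbelianGroup = record
            { isGroup = record
              { isMonoid = record
                { isSemigroup = record
                  { isMagma = record { isEquivalence = isEquivalence ; ∙-cong = cong₂ _+ₚ_ }
                  ; assoc = +ₚ-assoc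
                  }
                ; identity = +ₚ-identityˡ , λ x → trans (+ₚ-comm x 0ₚ) (+ₚ-identityˡ x)
                }
              ; inverse = (λ x → trans (+ₚ-comm (neg x) x) (-ₚ-inverseʳ x)) , -ₚ-inverseʳ
              ; ⁻¹-cong = cong neg
              }
            ; comm = +ₚ-comm
            }
          ; *-cong = cong₂ _*ₚ_
          ; *-assoc = *ₚ-assoc
          ; *-identity = *ₚ-identityˡ , λ x → trans (*ₚ-comm x 1ₚ) (*ₚ-identityˡ x)
          ; distrib = *ₚ-distribˡ , λ x y z → trans (*ₚ-comm (y +ₚ z) x)
              (trans (*ₚ-distribˡ x y z) (cong₂ _+ₚ_ (*ₚ-comm x y) (*ₚ-comm x z)))
          }
        ; *-comm = *ₚ-comm
        }
      }

    open CommutativeRing residueRing using (semiring)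
    open import Algebra.Properties.Semiring.Mult semiring using () renaming (_×_ to _×ₚ_)

    multiple-[] : ∀ n → n ×ₚ 1ₚ ≡ [ n ]
    multiple-[] zero    = sym []-0
    multiple-[] (suc n) = trans (cong₂ _+ₚ_ (sym []-1) (multiple-[] n)) ([]-+ 1 n)

    characteristic : ∀ n → suc n < p → ¬ (suc n ×ₚ 1ₚ ≡ 0ₚ)
    characteristic n n<p e = >⇒∤ n<p ([]≡0 (trans (sym (multiple-[] (suc n))) e))

    toℕ≡0 : ∀ {x} → toℕ x ≡ 0 → x ≡ 0ₚ
    toℕ≡0 {x} e = trans (sym ([toℕ] x)) (trans (cong [_] e) []-0)

    module _ (prime : Prime p) where

      ∣toℕ⇒≡0 : ∀ x → p ∣ toℕ x → x ≡ 0ₚ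
      ∣toℕ⇒≡0 x d with toℕ x in e
      ... | zero  = toℕ≡0 e
      ... | suc n = contradiction d (>⇒∤ (subst (_< p) e (Fin.toℕ<n x)))

      no-zero-divisors : ∀ {x y} → x *ₚ y ≡ 0ₚ → ¬ (x ≡ 0ₚ) → y ≡ 0ₚ
      no-zero-divisors {x} {y} e x≢0
        with euclidsLemma (toℕ x) (toℕ y) prime ([]≡0 (trans (sym (*ₚ-[] x y)) e))
      ... | inj₁ d = contradiction (∣toℕ⇒≡0 x d) x≢0
      ... | inj₂ d = ∣toℕ⇒≡0 y d

      1≢0 : ¬ (1ₚ ≡ 0ₚ)
      1≢0 e = >⇒∤ (ℕ.nonTrivial⇒n>1 p {{prime⇒nonTrivial prime}}) ([]≡0 (trans []-1 e))

      -- Bézout's identity over ℕ comes with two sign patterns: either b x = 1 modulo p, or b x = -1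
      -- and the inverse is -b.
      inverse : ∀ x → ¬ (x ≡ 0ₚ) → ∃[ y ] x *ₚ y ≡ 1ₚ
      inverse x x≢0 = invert (Coprime.coprime-Bézout (Coprime.prime⇒coprime prime {{x>0}} (Fin.toℕ<n x)))
        where
        open CommutativeRing residueRing using (zeroʳ)
        open IntegerSolver residueRing
        x>0 : NonZero (toℕ x)
        x>0 = ℕ.≢-nonZero (λ e → x≢0 (toℕ≡0 e))
        multiple-of-p : ∀ a → [ a ℕ.* p ] ≡ 0ₚ
        multiple-of-p a = trans (sym ([]-* a p)) (trans (cong ([ a ] *ₚ_) []-p) (zeroʳ [ a ]))
        one+ : ∀ m → 1ₚ +ₚ [ m ] ≡ [ 1 ℕ.+ m ]
        one+ m = trans (cong (_+ₚ [ m ]) (sym []-1)) ([]-+ 1 m)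
        product : ∀ b → [ b ] *ₚ x ≡ [ b ℕ.* toℕ x ]
        product b = trans (cong ([ b ] *ₚ_) (sym ([toℕ] x))) ([]-* b (toℕ x))
        invert : GCD.Bézout.Identity 1 p (toℕ x) → ∃[ y ] x *ₚ y ≡ 1ₚ
        invert (GCD.Bézout.+- a b eq) = neg [ b ] , (begin
          x *ₚ (neg [ b ])
            ≡⟨ solve 2 (λ x b → x :* (:- b) := :1 :- (:1 :+ b :* x)) refl x [ b ] ⟩
          1ₚ +ₚ (neg (1ₚ +ₚ [ b ] *ₚ x))
            ≡⟨ cong (λ y → 1ₚ +ₚ (neg y)) (trans (cong (1ₚ +ₚ_) (product b)) (trans (one+ _) (trans (cong [_] eq) (multiple-of-p a)))) ⟩
          1ₚ +ₚ (neg 0ₚ)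
            ≡⟨ solve 0 (:1 :- :0 := :1) refl ⟩
          1ₚ ∎)
        invert (GCD.Bézout.-+ a b eq) = [ b ] , (begin
          x *ₚ [ b ]            ≡⟨ *ₚ-comm x [ b ] ⟩
          [ b ] *ₚ x            ≡⟨ product b ⟩
          [ b ℕ.* toℕ x ]       ≡⟨ cong [_] eq ⟨
          [ 1 ℕ.+ a ℕ.* p ]     ≡⟨ one+ _ ⟨
          1ₚ +ₚ [ a ℕ.* p ]     ≡⟨ cong (1ₚ +ₚ_) (multiple-of-p a) ⟩
          1ₚ +ₚ 0ₚ              ≡⟨ solve 0 (:1 :+ :0 := :1) refl ⟩
          1ₚ                    ∎)

  -- Nonzero solutions of linear systems.

  module Kernel (p : ℕ) .{{_ : NonZero p}} (1<p : 1 < p) where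
    open Residues p

    open import Algebra.Properties.Group (CommutativeRing.+-group residueRing) using (x∙y⁻¹≈ε⇒x≈y)

    -- Counting instead of elimination: since p ^ m < p ^ n, two of the vectors, numbered through
    -- `finToFun`, have the same image, and their difference lies in the kernel. Hence linearity is
    -- asked for as compatibility with subtraction.
    kernel : ∀ {m n} (L : (Fin n → Fin p) → Fin m → Fin p) → m < n →
      (∀ v w j → L (λ i → v i +ₚ neg (w i)) j ≡ L v j +ₚ neg (L w j)) →
      ∃[ v ] ((∃[ i ] v i ≢ 0ₚ) × (∀ j → L v j ≡ 0ₚ))
    kernel {m} {n} L m<n L-sub
      with i , j , i<j , e ← Fin.pigeonhole (ℕ.^-monoʳ-< p 1<p m<n) (λ i → funToFin (L (finToFun i)))
      = (λ k → v k +ₚ neg (w k)) , nonzero , λ k → trans (L-sub v w k)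
          (trans (cong (λ y → L v k +ₚ neg y) (sym (Lv≡Lw k))) (-ₚ-inverseʳ _))
      where
      v w : Fin n → Fin p
      v = finToFun i
      w = finToFun j
      Lv≡Lw : ∀ k → L v k ≡ L w k
      Lv≡Lw k = trans (sym (Fin.finToFun-funToFin (L v) k))
        (trans (cong (λ c → finToFun c k) e) (Fin.finToFun-funToFin (L w) k))
      funToFin-cong : ∀ {k} (f g : Fin k → Fin p) → (∀ x → f x ≡ g x) → funToFin f ≡ funToFin g
      funToFin-cong {zero}  f g f≗g = refl
      funToFin-cong {suc k} f g f≗g = cong₂ combine (f≗g zero) (funToFin-cong _ _ (λ x → f≗g (suc x)))
      nonzero : ∃[ k ] v k +ₚ neg (w k) ≢ 0ₚ
      nonzero with Fin.any? (λ k → ¬? (v k +ₚ neg (w k) Fin.≟ 0ₚ))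
      ... | yes r = r
      ... | no ¬r = contradiction
        (trans (sym (Fin.funToFin-finToFin {n} i)) (trans (funToFin-cong v w
          (λ k → x∙y⁻¹≈ε⇒x≈y _ _ (decidable-stable (_ Fin.≟ _) (λ ne → ¬r (k , ne))))) (Fin.funToFin-finToFin {n} j)))
        (Fin.<⇒≢ i<j)

  -- Stepanov's method.

  module Stepanov (p : ℕ) .{{_ : NonZero p}} (prime : Prime p) where
    open Residues p
    open PowerSeries residueRing using (Series; DegBelow; deg-mono; constant-*)
    open Polynomials residueRing
    open RootCounting residueRing (no-zero-divisors prime)
    open Independence residueRing (no-zero-divisors prime) p characteristic
      using (u; δ-u; coef-u*; coef-X*-zero; coef-X*-suc; coef-X*derivative; independent)
    open Kernel p (ℕ.nonTrivial⇒n>1 p {{prime⇒nonTrivial prime}})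
    private
      module P = CommutativeRing polynomialRing
      module F = CommutativeRing residueRing
      module S = IntegerSolver residueRing
      module SP = IntegerSolver polynomialRing
      module D = Derivations polynomialRing derivativeᵖ derivativeᵖ-isDerivation
      module Θ = Derivations polynomialRing θ θ-isDerivation
    open Algebra.Properties.Semiring.Mult P.semiring using () renaming (_×_ to _×ᵖ_)
    open Algebra.Properties.Semiring.Mult F.semiring using () renaming (_×_ to _×ᶠ_)
    open Algebra.Properties.Semiring.Exp P.semiring using () renaming (_^_ to _^ᵖ_)
    open Algebra.Properties.Semiring.Exp F.semiring using (_^_; ^-assocʳ)
    open Algebra.Properties.Semiring.Sum P.semiring using (sum; sum-cong-≋; *-distribˡ-sum; ∑-distrib-+)

    -- `l` is the logarithmic derivative of x. It is 1 - X for X and -X for 1 - X, both polynomials;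
    -- this is what θ is chosen for.
    power-rule : ∀ x l n → θ x P.≈ x P.* l → θ (x ^ᵖ n) P.≈ x ^ᵖ n P.* ((n ×ᵖ P.1#) P.* l)
    power-rule x l zero    e = P.trans Θ.δ-1 (SP.solve 1 (λ l → SP.:0 SP.:= SP.:1 SP.:* (SP.:0 SP.:* l)) P.refl l)
    power-rule x l (suc n) e = P.trans (Θ.δ-* x (x ^ᵖ n)) (P.trans
      (P.+-cong (P.*-congʳ e) (P.*-congˡ (power-rule x l n e)))
      (SP.solve 4 (λ x l v n → x SP.:* l SP.:* v SP.:+ x SP.:* (v SP.:* (n SP.:* l)) SP.:=
        x SP.:* v SP.:* ((SP.:1 SP.:+ n) SP.:* l)) P.refl x l (x ^ᵖ n) (n ×ᵖ P.1#)))

    product-power-rule : ∀ x l n f → θ x P.≈ x P.* l →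
      θ (x ^ᵖ n P.* f) P.≈ x ^ᵖ n P.* (θ f P.+ (n ×ᵖ P.1#) P.* l P.* f)
    product-power-rule x l n f e = P.trans (Θ.δ-* (x ^ᵖ n) f) (P.trans
      (P.+-congʳ (P.*-congʳ (power-rule x l n e)))
      (SP.solve 5 (λ v n l f g → v SP.:* (n SP.:* l) SP.:* f SP.:+ v SP.:* g SP.:= v SP.:* (g SP.:+ n SP.:* l SP.:* f))
        P.refl (x ^ᵖ n) (n ×ᵖ P.1#) l f (θ f)))

    θ-X : θ Xᵖ P.≈ Xᵖ P.* u
    θ-X = P.trans (P.*-congˡ derivativeᵖ-X) (P.*-identityʳ w)

    θ-u : θ u P.≈ u P.* (P.- Xᵖ)
    θ-u = P.trans (P.*-congˡ δ-u) (SP.solve 2 (λ x u → x SP.:* u SP.:* (SP.:- SP.:1) SP.:= u SP.:* (SP.:- x)) P.refl Xᵖ u)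

    -- θ (X ^ m * u ^ n * f) = X ^ m * u ^ n * conjugate m n f
    conjugate : ℕ → ℕ → Polynomial → Polynomial
    conjugate m n f = (θ f P.+ (n ×ᵖ P.1#) P.* (P.- Xᵖ) P.* f) P.+ (m ×ᵖ P.1#) P.* u P.* f

    conjugate-cong : ∀ m n {f g} → f P.≈ g → conjugate m n f P.≈ conjugate m n g
    conjugate-cong m n e = P.+-cong (P.+-cong (Θ.δ-cong e) (P.*-congˡ e)) (P.*-congˡ e)

    θ-sub : ∀ f g → θ (f P.- g) P.≈ θ f P.- θ g
    θ-sub f g = P.trans (Θ.δ-+ f (P.- g)) (P.+-congˡ (Θ.δ-neg g))

    conjugate-sub : ∀ m n f g → conjugate m n (f P.- g) P.≈ conjugate m n f P.- conjugate m n g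
    conjugate-sub m n f g = P.trans (P.+-congʳ (P.+-congʳ (θ-sub f g)))
      (SP.solve 6 (λ f g f′ g′ a b → (f′ SP.:- g′ SP.:+ a SP.:* (f SP.:- g)) SP.:+ b SP.:* (f SP.:- g) SP.:=
          ((f′ SP.:+ a SP.:* f) SP.:+ b SP.:* f) SP.:- ((g′ SP.:+ a SP.:* g) SP.:+ b SP.:* g))
        P.refl f g (θ f) (θ g) ((n ×ᵖ P.1#) P.* (P.- Xᵖ)) ((m ×ᵖ P.1#) P.* u))

    deg-cong : ∀ N {f g} → f P.≈ g → DegBelow N (coef f) → DegBelow N (coef g)
    deg-cong N e d n N≤n = trans (sym (at e n)) (d n N≤n)

    deg-sum₂ : ∀ N f g → DegBelow N (coef f) → DegBelow N (coef g) → DegBelow N (coef (f P.+ g))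
    deg-sum₂ N f g df dg n N≤n = trans (coef-+ f g n) (trans (cong₂ _+ₚ_ (df n N≤n) (dg n N≤n)) (+ₚ-identityˡ 0ₚ))

    deg-sum : ∀ N {k} (f : Fin k → Polynomial) → (∀ i → DegBelow N (coef (f i))) → DegBelow N (coef (sum f))
    deg-sum N {zero}  f d n _ = coef-0 n
    deg-sum N {suc k} f d = deg-sum₂ N (f zero) _ (d zero) (deg-sum N (λ i → f (suc i)) (λ i → d (suc i)))

    deg-X* : ∀ N f → DegBelow N (coef f) → DegBelow (suc N) (coef (Xᵖ P.* f))
    deg-X* N f d (suc n) (s≤s N≤n) = trans (coef-X*-suc f n) (d n N≤n)

    deg-u* : ∀ N f → DegBelow N (coef f) → DegBelow (suc N) (coef (u P.* f))
    deg-u* N f d n N<n = trans (coef-u* f n) (trans (cong₂ (λ a b → a +ₚ neg b) (d n (ℕ.<⇒≤ N<n)) (deg-X* N f d n N<n)) (-ₚ-inverseʳ 0ₚ))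

    deg-X^ : ∀ m N f → DegBelow N (coef f) → DegBelow (m ℕ.+ N) (coef (Xᵖ ^ᵖ m P.* f))
    deg-X^ zero    N f d = deg-cong N (P.sym (P.*-identityˡ f)) d
    deg-X^ (suc m) N f d = deg-cong (suc m ℕ.+ N) (P.sym (P.*-assoc Xᵖ _ f)) (deg-X* (m ℕ.+ N) _ (deg-X^ m N f d))

    deg-u^ : ∀ m N f → DegBelow N (coef f) → DegBelow (m ℕ.+ N) (coef (u ^ᵖ m P.* f))
    deg-u^ zero    N f d = deg-cong N (P.sym (P.*-identityˡ f)) d
    deg-u^ (suc m) N f d = deg-cong (suc m ℕ.+ N) (P.sym (P.*-assoc u _ f)) (deg-u* (m ℕ.+ N) _ (deg-u^ m N f d))

    deg-constant* : ∀ c N f → DegBelow N (coef f) → DegBelow N (coef (constantᵖ c P.* f))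
    deg-constant* c N f d n N≤n = trans (coef-* (constantᵖ c) f n)
      (trans (PowerSeries.*ˢ-cong residueRing (coef-constant c) (λ _ → refl) n)
      (trans (constant-* c (coef f) n) (trans (cong (c *ₚ_) (d n N≤n)) (F.zeroʳ c))))

    deg-multiple : ∀ k N f → DegBelow N (coef f) → DegBelow N (coef ((k ×ᵖ P.1#) P.* f))
    deg-multiple zero    N f d n _ = trans (at (P.zeroˡ f) n) (coef-0 n)
    deg-multiple (suc k) N f d = deg-cong N (P.sym (P.trans (P.distribʳ f P.1# (k ×ᵖ P.1#)) (P.+-congʳ (P.*-identityˡ f))))
      (deg-sum₂ N f _ d (deg-multiple k N f d))

    deg-neg* : ∀ N f → DegBelow N (coef f) → DegBelow N (coef (P.- f))
    deg-neg* N f d n N≤n = trans (coef-neg f n) (trans (cong neg (d n N≤n)) neg-0)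
      where
      neg-0 : neg 0ₚ ≡ 0ₚ
      neg-0 = S.solve 0 (S.:- S.:0 S.:= S.:0) refl

    deg-θ : ∀ N f → DegBelow N (coef f) → DegBelow (suc N) (coef (θ f))
    deg-θ N f d = deg-cong (suc N)
      (SP.solve 3 (λ x u g → u SP.:* (x SP.:* g) SP.:= x SP.:* u SP.:* g) P.refl Xᵖ u (derivativeᵖ f))
      (deg-u* N (Xᵖ P.* derivativeᵖ f) (λ n N≤n → trans (coef-X*derivative f n) (trans (F.*-congˡ {n ×ᶠ 1ₚ} (d n N≤n)) (F.zeroʳ (n ×ᶠ 1ₚ)))))

    -- Each of the three terms has one extra factor X or u, also θ f = u (X f′). The growth does not
    -- depend on the exponents m and n.
    deg-conjugate : ∀ m n N f → DegBelow N (coef f) → DegBelow (suc N) (coef (conjugate m n f))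
    deg-conjugate m n N f d = deg-sum₂ (suc N) _ _ (deg-sum₂ (suc N) _ _ (deg-θ N f d)
        (deg-cong (suc N) (SP.solve 3 (λ n x f → n SP.:* (SP.:- (x SP.:* f)) SP.:= n SP.:* (SP.:- x) SP.:* f) P.refl (n ×ᵖ P.1#) Xᵖ f)
          (deg-multiple n (suc N) _ (deg-neg* (suc N) _ (deg-X* N f d)))))
        (deg-cong (suc N) (P.sym (P.*-assoc _ _ _)) (deg-multiple m (suc N) _ (deg-u* N f d)))

    module _ {B : ℕ} where

      Family : Set
      Family = Fin B → Fin B → Polynomial

      -- The factors are parameters because two kinds occur: powers of X and u in the auxiliary
      -- polynomial, and constants in its restriction to a class. `evaluate-combination` exchanges
      -- them at a point.
      combination : (x y : Fin B → Polynomial) → Family → Polynomial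
      combination x y g = sum (λ b → x b P.* sum (λ c → y c P.* g b c))

      evaluate-sum : ∀ z {k} (f g : Fin k → Polynomial) →
        (∀ i → evaluate z (f i) ≡ evaluate z (g i)) → evaluate z (sum f) ≡ evaluate z (sum g)
      evaluate-sum z {zero}  f g e = refl
      evaluate-sum z {suc k} f g e = trans (evaluate-+ z (f zero) _)
        (trans (cong₂ _+ₚ_ (e zero) (evaluate-sum z (λ i → f (suc i)) (λ i → g (suc i)) (λ i → e (suc i))))
          (sym (evaluate-+ z (g zero) _)))

      evaluate-combination : ∀ z x y x′ y′ g →
        (∀ b → evaluate z (x b) ≡ evaluate z (x′ b)) → (∀ c → evaluate z (y c) ≡ evaluate z (y′ c)) →
        evaluate z (combination x y g) ≡ evaluate z (combination x′ y′ g)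
      evaluate-combination z x y x′ y′ g ex ey = evaluate-sum z _ _ (λ b →
        product (ex b) (evaluate-sum z _ _ (λ c → product (ey c) refl)))
        where
        product : ∀ {f f′ g g′} → evaluate z f ≡ evaluate z f′ → evaluate z g ≡ evaluate z g′ →
          evaluate z (f P.* g) ≡ evaluate z (f′ P.* g′)
        product {f} {f′} {g} {g′} e e′ = trans (evaluate-* z f g) (trans (cong₂ _*ₚ_ e e′) (sym (evaluate-* z f′ g′)))

      sum-sub : ∀ {k} (f g : Fin k → Polynomial) → sum (λ i → f i P.- g i) P.≈ sum f P.- sum g
      sum-sub {zero}  f g = P.sym (P.-‿inverseʳ P.0#)
      sum-sub {suc k} f g = P.trans (P.+-congˡ (sum-sub (λ i → f (suc i)) (λ i → g (suc i))))
        (SP.solve 4 (λ a b c d → (a SP.:- b) SP.:+ (c SP.:- d) SP.:= (a SP.:+ c) SP.:- (b SP.:+ d)) P.refl _ _ _ _)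

      combination-cong : ∀ x y {f g : Family} → (∀ b c → f b c P.≈ g b c) → combination x y f P.≈ combination x y g
      combination-cong x y e = sum-cong-≋ (λ b → P.*-congˡ (sum-cong-≋ (λ c → P.*-congˡ (e b c))))

      *-sub : ∀ x f g → x P.* (f P.- g) P.≈ x P.* f P.- x P.* g
      *-sub = SP.solve 3 (λ x f g → x SP.:* (f SP.:- g) SP.:= x SP.:* f SP.:- x SP.:* g) P.refl

      combination-sub : ∀ x y (f g : Family) →
        combination x y (λ b c → f b c P.- g b c) P.≈ combination x y f P.- combination x y g
      combination-sub x y f g = P.trans
        (sum-cong-≋ (λ b → P.trans
          (P.*-congˡ (P.trans (sum-cong-≋ (λ c → *-sub (y c) (f b c) (g b c))) (sum-sub (λ c → y c P.* f b c) (λ c → y c P.* g b c))))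
          (*-sub (x b) (sum (λ c → y c P.* f b c)) (sum (λ c → y c P.* g b c)))))
        (sum-sub (λ b → x b P.* sum (λ c → y c P.* f b c)) (λ b → x b P.* sum (λ c → y c P.* g b c)))

      module _ (t : ℕ) where

        Ψ : Family → Polynomial
        Ψ = combination (λ b → Xᵖ ^ᵖ (t ℕ.* toℕ b)) (λ c → u ^ᵖ (t ℕ.* toℕ c))

        conjugates : ℕ → Family → Family
        conjugates zero    g = g
        conjugates (suc k) g = conjugates k (λ b c → conjugate (t ℕ.* toℕ b) (t ℕ.* toℕ c) (g b c))

        conjugates-cong : ∀ k {f g : Family} → (∀ b c → f b c P.≈ g b c) →
          ∀ b c → conjugates k f b c P.≈ conjugates k g b c
        conjugates-cong zero    e = e
        conjugates-cong (suc k) e = conjugates-cong k (λ b c → conjugate-cong (t ℕ.* toℕ b) (t ℕ.* toℕ c) (e b c))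

        conjugates-sub : ∀ k f g b c →
          conjugates k (λ b c → f b c P.- g b c) b c P.≈ conjugates k f b c P.- conjugates k g b c
        conjugates-sub zero    f g b c = P.refl
        conjugates-sub (suc k) f g b c = P.trans
          (conjugates-cong k (λ b c → conjugate-sub (t ℕ.* toℕ b) (t ℕ.* toℕ c) (f b c) (g b c)) b c)
          (conjugates-sub k _ _ b c)

        deg-conjugates : ∀ k N g → (∀ b c → DegBelow N (coef (g b c))) →
          ∀ b c → DegBelow (N ℕ.+ k) (coef (conjugates k g b c))
        deg-conjugates zero    N g d b c = subst (λ M → DegBelow M (coef (g b c))) (sym (ℕ.+-identityʳ N)) (d b c)
        deg-conjugates (suc k) N g d b c = subst (λ M → DegBelow M (coef (conjugates (suc k) g b c))) (sym (ℕ.+-suc N k))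
          (deg-conjugates k (suc N) _ (λ b c → deg-conjugate (t ℕ.* toℕ b) (t ℕ.* toℕ c) N (g b c) (d b c)) b c)

        θ-Ψ : ∀ g → θ (Ψ g) P.≈ Ψ (conjugates 1 g)
        θ-Ψ g = P.trans (Θ.δ-sum (λ b → Xᵖ ^ᵖ (t ℕ.* toℕ b) P.* G b)) (sum-cong-≋ (λ b →
          P.trans (product-power-rule Xᵖ u (t ℕ.* toℕ b) (G b) θ-X) (P.*-congˡ (inner b))))
          where
          U : Fin B → Polynomial
          U c = u ^ᵖ (t ℕ.* toℕ c)
          G : Fin B → Polynomial
          G b = sum (λ c → U c P.* g b c)
          g₁ : Family
          g₁ b c = θ (g b c) P.+ ((t ℕ.* toℕ c) ×ᵖ P.1#) P.* (P.- Xᵖ) P.* g b c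
          inner : ∀ b → θ (G b) P.+ ((t ℕ.* toℕ b) ×ᵖ P.1#) P.* u P.* G b P.≈ sum (λ c → U c P.* conjugates 1 g b c)
          inner b = P.trans
            (P.+-cong
              (P.trans (Θ.δ-sum (λ c → U c P.* g b c))
                (sum-cong-≋ (λ c → product-power-rule u (P.- Xᵖ) (t ℕ.* toℕ c) (g b c) θ-u)))
              (*-distribˡ-sum (((t ℕ.* toℕ b) ×ᵖ P.1#) P.* u) (λ c → U c P.* g b c)))
            (P.trans (P.sym (∑-distrib-+ (λ c → U c P.* g₁ b c) (λ c → ((t ℕ.* toℕ b) ×ᵖ P.1#) P.* u P.* (U c P.* g b c))))
              (sum-cong-≋ (λ c → SP.solve 4 (λ v a m f → v SP.:* a SP.:+ m SP.:* (v SP.:* f) SP.:= v SP.:* (a SP.:+ m SP.:* f))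
                P.refl (U c) (g₁ b c) (((t ℕ.* toℕ b) ×ᵖ P.1#) P.* u) (g b c))))

        vanishes-Ψ : ∀ z k g → (∀ j → j < k → evaluate z (Ψ (conjugates j g)) ≡ 0ₚ) → Vanishes z k (Ψ g)
        vanishes-Ψ z zero    g e = _
        vanishes-Ψ z (suc k) g e = e 0 (s≤s z≤n) ,
          Order.vanishes-cong z k (P.sym (θ-Ψ g)) (vanishes-Ψ z k (conjugates 1 g) (λ j j<k → e (suc j) (s≤s j<k)))

        deg-Ψ : ∀ N g → (∀ b c → DegBelow N (coef (g b c))) →
          DegBelow (t ℕ.* B ℕ.+ (t ℕ.* B ℕ.+ N)) (coef (Ψ g))
        deg-Ψ N g d = deg-sum _ _ (λ b →
          raise (Xᵖ ^ᵖ (t ℕ.* toℕ b) P.* G b) b (deg-X^ (t ℕ.* toℕ b) (t ℕ.* B ℕ.+ N) (G b)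
            (deg-sum _ _ (λ c → raise (u ^ᵖ (t ℕ.* toℕ c) P.* g b c) c (deg-u^ (t ℕ.* toℕ c) N (g b c) (d b c))))))
          where
          G : Fin B → Polynomial
          G b = sum (λ c → u ^ᵖ (t ℕ.* toℕ c) P.* g b c)
          raise : ∀ f {M} (b : Fin B) → DegBelow (t ℕ.* toℕ b ℕ.+ M) (coef f) → DegBelow (t ℕ.* B ℕ.+ M) (coef f)
          raise f {M} b = deg-mono {f = coef f} (ℕ.+-monoˡ-≤ M (ℕ.*-monoʳ-≤ t (ℕ.<⇒≤ (Fin.toℕ<n b))))

    fromCoefficients : ∀ A → (Fin A → Fin p) → Series
    fromCoefficients zero    v n       = 0ₚ
    fromCoefficients (suc A) v zero    = v zero
    fromCoefficients (suc A) v (suc n) = fromCoefficients A (λ i → v (suc i)) n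

    fromCoefficients-deg : ∀ A v → DegBelow A (fromCoefficients A v)
    fromCoefficients-deg zero    v n       _       = refl
    fromCoefficients-deg (suc A) v (suc n) (s≤s l) = fromCoefficients-deg A (λ i → v (suc i)) n l

    fromCoefficients-toℕ : ∀ A v a → fromCoefficients A v (toℕ a) ≡ v a
    fromCoefficients-toℕ (suc A) v zero    = refl
    fromCoefficients-toℕ (suc A) v (suc a) = fromCoefficients-toℕ A (λ i → v (suc i)) a

    fromCoefficients-sub : ∀ A v w n →
      fromCoefficients A (λ i → v i +ₚ neg (w i)) n ≡ fromCoefficients A v n +ₚ neg (fromCoefficients A w n)
    fromCoefficients-sub zero    v w n       = sym (-ₚ-inverseʳ 0ₚ)
    fromCoefficients-sub (suc A) v w zero    = refl
    fromCoefficients-sub (suc A) v w (suc n) = fromCoefficients-sub A (λ i → v (suc i)) (λ i → w (suc i)) n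

    class : ℕ → Fin p → Fin p × Fin p
    class t z = z ^ t , (1ₚ +ₚ neg z) ^ t

    evaluate-^ : ∀ z f n → evaluate z (f ^ᵖ n) ≡ evaluate z f ^ n
    evaluate-^ z f zero    = evaluate-constant z 1ₚ
    evaluate-^ z f (suc n) = trans (evaluate-* z f (f ^ᵖ n)) (cong (evaluate z f *ₚ_) (evaluate-^ z f n))

    module _ (t A B D : ℕ) (cs : List (Fin p × Fin p)) where

      h : ℕ
      h = length cs

      deg-family : ∀ (v : Fin (B ℕ.* (B ℕ.* A)) → Fin p) (b c : Fin B) → DegBelow A (fromCoefficients A (λ a → v (combine {B} b (combine {B} {A} c a))))
      deg-family v b c = fromCoefficients-deg A (λ a → v (combine {B} b (combine {B} {A} c a)))

      -- The B * B * A unknowns form one vector, as `kernel` requires; the index encodes b, c and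
      -- the degree a.
      family : (Fin (B ℕ.* (B ℕ.* A)) → Fin p) → Family {B}
      family v b c = polynomial (fromCoefficients A (λ a → v (combine b (combine c a)))) A (deg-family v b c)

      -- At a point of class (α , β) the factors X ^ (t b) and u ^ (t c) have the values α ^ b and β
      -- ^ c, so the k-th θ-derivative of `Ψ` agrees there with this polynomial of degree below A +
      -- k. Requiring it to be zero gives conditions whose number does not depend on the number of
      -- points in the class.
      restriction : Fin h → ℕ → (Fin (B ℕ.* (B ℕ.* A)) → Fin p) → Polynomial
      restriction i k v = combination (λ b → constantᵖ (proj₁ (lookup cs i) ^ toℕ b))
        (λ c → constantᵖ (proj₂ (lookup cs i) ^ toℕ c)) (conjugates t k (family v))

      restriction-sub : ∀ i k v w →
        restriction i k (λ j → v j +ₚ neg (w j)) P.≈ restriction i k v P.- restriction i k w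
      restriction-sub i k v w = P.trans
        (combination-cong _ _ (λ b c → P.trans
          (conjugates-cong t k (λ b c → coefwise (λ n → trans (fromCoefficients-sub A (λ a → v (combine b (combine c a))) (λ a → w (combine b (combine c a))) n)
            (sym (trans (coef-+ _ _ n) (F.+-congˡ (coef-neg _ n)))))) b c)
          (conjugates-sub t k (family v) (family w) b c)))
        (combination-sub _ _ (conjugates t k (family v)) (conjugates t k (family w)))

      deg-restriction : ∀ i k v → DegBelow (A ℕ.+ k) (coef (restriction i k v))
      deg-restriction i k v = deg-sum _ _ (λ b → deg-constant* _ _ _ (deg-sum _ _ (λ c → deg-constant* _ _ _
        (deg-conjugates t k A (family v) (deg-family v) b c))))

      condition : (Fin (B ℕ.* (B ℕ.* A)) → Fin p) → Fin h → Fin D × Fin (A ℕ.+ D) → Fin p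
      condition v i (k , n) = coef (restriction i (toℕ k) v) (toℕ n)

      conditions : (Fin (B ℕ.* (B ℕ.* A)) → Fin p) → Fin (h ℕ.* (D ℕ.* (A ℕ.+ D))) → Fin p
      conditions v j =
        let i , kn = remQuot {h} (D ℕ.* (A ℕ.+ D)) j in condition v i (remQuot {D} (A ℕ.+ D) kn)

      conditions-combine : ∀ v i k n → conditions v (combine i (combine k n)) ≡ coef (restriction i (toℕ k) v) (toℕ n)
      conditions-combine v i k n = trans
        (cong (λ (i , kn) → condition v i (remQuot {D} (A ℕ.+ D) kn)) (Fin.remQuot-combine {h} i (combine {D} k n)))
        (cong (condition v i) (Fin.remQuot-combine {D} k n))

      condition-sub : ∀ v w i kn → condition (λ i → v i +ₚ neg (w i)) i kn ≡ condition v i kn +ₚ neg (condition w i kn)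
      condition-sub v w i (k , n) = trans (at (restriction-sub i (toℕ k) v w) (toℕ n))
        (trans (coef-+ (restriction i (toℕ k) v) (P.- restriction i (toℕ k) w) (toℕ n))
          (F.+-congˡ {coef (restriction i (toℕ k) v) (toℕ n)} (coef-neg (restriction i (toℕ k) w) (toℕ n))))

      conditions-sub : ∀ v w j → conditions (λ i → v i +ₚ neg (w i)) j ≡ conditions v j +ₚ neg (conditions w j)
      conditions-sub v w j = condition-sub v w (proj₁ (remQuot {h} (D ℕ.* (A ℕ.+ D)) j))
        (remQuot {D} (A ℕ.+ D) (proj₂ (remQuot {h} (D ℕ.* (A ℕ.+ D)) j)))

      -- A nonzero unknown is a nonzero coefficient of one member of the family, whereas
      -- `independent` would make all members zero.
      Ψ≢0 : ∀ v → (∃[ i ] v i ≢ 0ₚ) → A ≤ t → A ℕ.* B ≤ t → t ℕ.* B ≤ p → ¬ (Ψ t (family v) P.≈ P.0#)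
      Ψ≢0 v (i , vi≢0) A≤t AB≤t tB≤p e with Fin.combine-surjective {B} {B ℕ.* A} i
      ... | b , ca , refl with Fin.combine-surjective {B} {A} ca
      ... | c , a , refl = vi≢0 (trans (sym (fromCoefficients-toℕ A (λ a → v (combine b (combine c a))) a))
        (trans (at (independent t A B B (family v) A≤t AB≤t tB≤p (deg-family v) e b c) (toℕ a)) (coef-0 _)))

      restriction≈0 : ∀ v → (∀ j → conditions v j ≡ 0ₚ) → ∀ i k → k < D → restriction i k v P.≈ P.0#
      restriction≈0 v e i k k<D = coefwise (λ n → trans (zero-at n) (sym (coef-0 n)))
        where
        zero-at : ∀ n → coef (restriction i k v) n ≡ 0ₚ
        zero-at n with n ℕ.<? A ℕ.+ D
        ... | no  n≮ = deg-restriction i k v n (ℕ.≤-trans (ℕ.+-monoʳ-≤ A (ℕ.<⇒≤ k<D)) (ℕ.≮⇒≥ n≮))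
        ... | yes n< = trans (cong₂ (λ k n → coef (restriction i k v) n) (sym (Fin.toℕ-fromℕ< k<D)) (sym (Fin.toℕ-fromℕ< n<)))
          (trans (sym (conditions-combine v i (fromℕ< k<D) (fromℕ< n<))) (e (combine i (combine (fromℕ< k<D) (fromℕ< n<)))))

      vanishes : ∀ v → (∀ j → conditions v j ≡ 0ₚ) → ∀ {z} → class t z ∈ cs → Vanishes z D (Ψ t (family v))
      vanishes v e {z} z∈ = vanishes-Ψ t z D (family v) (λ j j<D → trans
        (evaluate-combination z _ _ _ _ (conjugates t j (family v))
          (λ b → power-of Xᵖ (cong proj₁ class≡) (evaluate-X z) (toℕ b))
          (λ c → power-of u (cong proj₂ class≡) evaluate-u (toℕ c)))
        (trans (evaluate-cong z (restriction≈0 v e i j j<D)) (IsRingHomomorphism.0#-homo (evaluate-isRingHomomorphism z))))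
        where
        i = index z∈
        class≡ : class t z ≡ lookup cs i
        class≡ = lookup-index z∈
        evaluate-u : evaluate z u ≡ 1ₚ +ₚ neg z
        evaluate-u = trans (evaluate-sub z P.1# Xᵖ) (cong₂ (λ a b → a +ₚ neg b) (evaluate-constant z 1ₚ) (evaluate-X z))
        power-of : ∀ g {x α} → x ^ t ≡ α → evaluate z g ≡ x → ∀ n →
          evaluate z (g ^ᵖ (t ℕ.* n)) ≡ evaluate z (constantᵖ (α ^ n))
        power-of g {x} refl refl n = trans (evaluate-^ z g (t ℕ.* n))
          (trans (sym (^-assocʳ x t n)) (sym (evaluate-constant z _)))

      -- Stepanov's method, with a polynomial of the form Σ f b c * X ^ (t b) * (1 - X) ^ (t c), deg f b c < A.
      -- On a class, all powers of θ map it to a polynomial of degree < A + D, so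
      -- that its vanishing to order D costs only D (A + D) linear conditions.
      stepanov : (zs : List (Fin p)) → A ≤ t → A ℕ.* B ≤ t → t ℕ.* B ≤ p → D < p →
        length cs ℕ.* (D ℕ.* (A ℕ.+ D)) < B ℕ.* (B ℕ.* A) →
        Unique zs → All (λ z → z ≢ 0ₚ × z ≢ 1ₚ) zs → All (λ z → class t z ∈ cs) zs →
        length zs ℕ.* D ≤ t ℕ.* B ℕ.+ (t ℕ.* B ℕ.+ A)
      stepanov zs A≤t AB≤t tB≤p D<p count unique nz classes =
        let v , v≢0 , solved = kernel conditions count conditions-sub
        in root-count p characteristic D zs _ (Ψ t (family v)) D<p unique nz (deg-Ψ t A (family v) (deg-family v))
          (Ψ≢0 v v≢0 A≤t AB≤t tB≤p) (All.map (vanishes v solved) classes)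

module Counting where

  open import Defs
  open import Algebra.Bundles using (CommutativeRing)
  open import Data.Nat using (ℕ; zero; suc; _≤_; _<_; _≤?_; _<?_; z≤n; s≤s; NonZero; >-nonZero)
  open import Data.Nat.Primality using (Prime)
  import Data.Nat as ℕ
  import Data.Nat.Properties as ℕ
  import Data.Nat.Solver as ℕ
  open import Data.Fin using (Fin; zero; suc; _≟_)
  import Data.Fin.Properties as Fin
  open import Data.Fin.Subset using (Subset; ∣_∣) renaming (_∈_ to _∈ˢ_)
  open import Data.Fin.Subset.Properties using () renaming (_∈?_ to _∈ˢ?_)
  open import Data.List using (List; []; _∷_; length; map; filter; concatMap; foldr; _++_; cartesianProduct; allFin; take; deduplicate)
  open import Data.List.Properties using (length-++; length-map; length-take; length-filter; ++-identityʳ; map-cong)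
  open import Data.Nat.ListAction using (sum)
  open import Data.List.Membership.Propositional using (_∈_; lose)
  open import Data.List.Membership.Propositional.Properties
  import Data.List.Membership.DecPropositional as DecMembership
  open import Data.List.Relation.Unary.Any using (here; there)
  open import Data.List.Relation.Unary.All as All using (All; []; _∷_)
  import Data.List.Relation.Unary.All.Properties as All
  open import Data.List.Relation.Unary.Unique.Propositional using (Unique)
  import Data.List.Relation.Unary.Unique.Propositional.Properties as Unique
  open import Data.List.Relation.Unary.Unique.DecPropositional.Properties using (deduplicate-!)
  open import Data.List.Relation.Binary.Permutation.Propositional using (_↭_)
  open import Data.List.Relation.Binary.Permutation.Propositional.Properties using (↭-length)
  open import Data.Product using (_,_; proj₁; proj₂; ∃-syntax; _×_)
  open import Data.Product.Properties using (≡-dec; ,-injectiveˡ; ,-injectiveʳ)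
  open import Data.Sum using (inj₁; inj₂)
  open import Relation.Nullary using (¬_; Dec; yes; no; contradiction; ¬?)
  open import Relation.Nullary.Decidable using (_×-dec_)
  open import Relation.Unary using (Decidable; _⊆_; _∪_; ｛_｝)
  open import Relation.Binary.PropositionalEquality hiding ([_]; J)
  import Algebra.Properties.CommutativeSemiring.Exp
  open import Function using (_∘_)
  open import Data.List.Relation.Unary.AllPairs using ([]; _∷_)

  open PrimeField
  open NaturalBounds
  open FiniteLists

  -- Multiplicative subgroups and their orders.

  module Subgroups (p : ℕ) .{{_ : NonZero p}} (prime : Prime p) where
    open Residues p
    open Stepanov p prime using (class)
    private
      module F = CommutativeRing residueRing
      module S = IntegerSolver residueRing
    open Algebra.Properties.CommutativeSemiring.Exp F.commutativeSemiring using (_^_; ^-distrib-*)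
    open import Algebra.Properties.Group F.+-group using (x∙y⁻¹≈ε⇒x≈y)

    infixl 6 _-_
    _-_ : Fin p → Fin p → Fin p
    x - y = x +ₚ neg y

    -≡0 : ∀ {x y} → x - y ≡ 0ₚ → x ≡ y
    -≡0 = x∙y⁻¹≈ε⇒x≈y _ _

    -≢0 : ∀ {x y} → x ≢ y → x - y ≢ 0ₚ
    -≢0 x≢y e = x≢y (-≡0 e)

    *-≢0 : ∀ {x y} → x ≢ 0ₚ → y ≢ 0ₚ → x *ₚ y ≢ 0ₚ
    *-≢0 x≢0 y≢0 e = y≢0 (no-zero-divisors prime e x≢0)

    *-cancelˡ : ∀ {x y z} → x ≢ 0ₚ → x *ₚ y ≡ x *ₚ z → y ≡ z
    *-cancelˡ {x} {y} {z} x≢0 e = -≡0 (no-zero-divisors prime {x} {y - z}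
      (trans (S.solve 3 (λ x y z → x S.:* (y S.:- z) S.:= x S.:* y S.:- x S.:* z) refl x y z)
        (trans (cong (_- x *ₚ z) e) (-ₚ-inverseʳ (x *ₚ z)))) x≢0)

    -- The default 0 at 0 makes `inv` total, so that quotients need not carry proofs; the laws
    -- assume a nonzero argument.
    inv : Fin p → Fin p
    inv x with x ≟ 0ₚ
    ... | yes _   = 0ₚ
    ... | no x≢0 = proj₁ (inverse prime x x≢0)

    *-inv : ∀ {x} → x ≢ 0ₚ → x *ₚ inv x ≡ 1ₚ
    *-inv {x} x≢0 with x ≟ 0ₚ
    ... | yes x≡0 = contradiction x≡0 x≢0
    ... | no  x≢0 = proj₂ (inverse prime x x≢0)

    inv-≢0 : ∀ {x} → x ≢ 0ₚ → inv x ≢ 0ₚ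
    inv-≢0 {x} x≢0 e = 1≢0 prime (trans (sym (*-inv x≢0)) (trans (cong (x *ₚ_) e) (F.zeroʳ x)))

    product : List (Fin p) → Fin p
    product = foldr _*ₚ_ 1ₚ

    product-↭ : ∀ {xs ys} → xs ↭ ys → product xs ≡ product ys
    product-↭ _↭_.refl         = refl
    product-↭ (_↭_.prep x r)   = cong (x *ₚ_) (product-↭ r)
    product-↭ {_ ∷ _ ∷ _} {_ ∷ _ ∷ ys} (_↭_.swap x y r) = trans (cong (λ z → x *ₚ (y *ₚ z)) (product-↭ r))
      (S.solve 3 (λ x y z → x S.:* (y S.:* z) S.:= y S.:* (x S.:* z)) refl x y (product ys))
    product-↭ (_↭_.trans r s)  = trans (product-↭ r) (product-↭ s)

    product-map : ∀ x ys → product (map (x *ₚ_) ys) ≡ x ^ length ys *ₚ product ys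
    product-map x []       = sym (*ₚ-identityˡ 1ₚ)
    product-map x (y ∷ ys) = trans (cong (x *ₚ y *ₚ_) (product-map x ys))
      (S.solve 4 (λ x y a b → x S.:* y S.:* (a S.:* b) S.:= x S.:* a S.:* (y S.:* b)) refl x y (x ^ length ys) (product ys))

    product-≢0 : ∀ {xs} → All (_≢ 0ₚ) xs → product xs ≢ 0ₚ
    product-≢0 []           = 1≢0 prime
    product-≢0 (x≢0 ∷ xs≢0) = *-≢0 x≢0 (product-≢0 xs≢0)

    module Subgroup {G : Subset p} (isSubgroup : IsMultiplicativeSubgroup G) where
      open IsMultiplicativeSubgroup isSubgroup public

      ∈⇒≢0 : ∀ {x} → x ∈ˢ G → x ≢ 0ₚ
      ∈⇒≢0 x∈ refl = 0∉ x∈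

      inv-closed : ∀ {x} → x ∈ˢ G → inv x ∈ˢ G
      inv-closed x∈ with ⁻¹-closed x∈
      ... | y , y∈ , xy≡1 = subst (_∈ˢ G) (*-cancelˡ (∈⇒≢0 x∈) (trans xy≡1 (sym (*-inv (∈⇒≢0 x∈))))) y∈

      -- Multiplication by x permutes G, hence fixes the product of its elements.
      ^-order : ∀ {x} → x ∈ˢ G → x ^ ∣ G ∣ ≡ 1ₚ
      ^-order {x} x∈ = let zs , r = unique-⊆-↭ {ys = xs} scaled-unique scaled-⊆ in order zs r
        where
        xs = elements G
        scaled-unique : Unique (map (x *ₚ_) xs)
        scaled-unique = Unique.map⁺ (*-cancelˡ (∈⇒≢0 x∈)) (elements-unique G)
        scaled-⊆ : ∀ {y} → y ∈ map (x *ₚ_) xs → y ∈ xs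
        scaled-⊆ y∈ with ∈-map⁻ (x *ₚ_) y∈
        ... | z , z∈ , refl = ∈-elements⁺ (*-closed x∈ (∈-elements⁻ z∈))
        xs≢0 : product xs ≢ 0ₚ
        xs≢0 = product-≢0 (All.tabulate (λ y∈ → ∈⇒≢0 (∈-elements⁻ y∈)))
        order : ∀ zs → xs ↭ map (x *ₚ_) xs ++ zs → x ^ ∣ G ∣ ≡ 1ₚ
        order [] r = *-cancelˡ xs≢0 (begin
          product xs *ₚ x ^ ∣ G ∣          ≡⟨ F.*-comm (product xs) (x ^ ∣ G ∣) ⟩
          x ^ ∣ G ∣ *ₚ product xs          ≡⟨ cong (λ n → x ^ n *ₚ product xs) (length-elements G) ⟨
          x ^ length xs *ₚ product xs      ≡⟨ product-map x xs ⟨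
          product (map (x *ₚ_) xs)         ≡⟨ cong product (++-identityʳ (map (x *ₚ_) xs)) ⟨
          product (map (x *ₚ_) xs ++ [])   ≡⟨ product-↭ r ⟨
          product xs                       ≡⟨ F.*-identityʳ (product xs) ⟨
          product xs *ₚ 1ₚ                 ∎)
          where open ≡-Reasoning
        -- Multiplication by x preserves the length, so nothing can be left over.
        order (z ∷ zs) r = contradiction
          (trans (↭-length r) (trans (length-++ (map (x *ₚ_) xs)) (cong (ℕ._+ suc (length zs)) (length-map (x *ₚ_) xs))))
          (ℕ.m≢1+m+n (length xs) ∘ λ e → trans e (ℕ.+-suc (length xs) (length zs)))

    -- From x to x y the first coordinate gains the factor y ^ t and the second the factor v ^ t,
    -- both equal to 1.
    class-* : ∀ t {x y u v} → y ^ t ≡ 1ₚ → v ^ t ≡ 1ₚ → 1ₚ - x *ₚ y ≡ u *ₚ v → 1ₚ - x ≡ u → class t (x *ₚ y) ≡ class t x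
    class-* t {x} {y} {u} {v} yᵗ vᵗ e e′ = cong₂ _,_
      (trans (^-distrib-* x y t) (trans (cong (x ^ t *ₚ_) yᵗ) (F.*-identityʳ _)))
      (trans (cong (_^ t) e) (trans (^-distrib-* u v t) (trans (cong (u ^ t *ₚ_) vᵗ)
        (trans (F.*-identityʳ _) (cong (_^ t) (sym e′))))))

  -- Points on classes, multiplicities and their level sets.

  module Differences (p : ℕ) .{{_ : NonZero p}} (prime : Prime p)
    (a : ℕ) (1≤a : 1 ≤ a) (27≤a³ : 27 ≤ cube a) (8Q≤a³ : 8 ℕ.* (4 ℕ.* a ℕ.* (a ℕ.+ 1)) ≤ cube a) where
    open Residues p
    open Stepanov p prime using (class; stepanov)
    open Subgroups p prime
    open Parameters a 1≤a 27≤a³ 8Q≤a³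
    private
      module F = CommutativeRing residueRing
      module S = IntegerSolver residueRing

    _≟²_ : (c d : Fin p × Fin p) → Dec (c ≡ d)
    _≟²_ = ≡-dec _≟_ _≟_

    open DecMembership _≟²_ using (_∈?_)
    open ℕ.+-*-Solver

    Generic : Fin p → Set
    Generic z = z ≢ 0ₚ × z ≢ 1ₚ

    generic? : Decidable Generic
    generic? z = ¬? (z ≟ 0ₚ) ×-dec ¬? (z ≟ 1ₚ)

    classUnion : ℕ → List (Fin p × Fin p) → List (Fin p)
    classUnion t cs = filter (λ z → class t z ∈? cs) (filter generic? (allFin p))

    ∈-classUnion⁺ : ∀ {t cs z} → Generic z → class t z ∈ cs → z ∈ classUnion t cs
    ∈-classUnion⁺ {t} {cs} {z} gz c∈ =
      ∈-filter⁺ (λ z → class t z ∈? cs) (∈-filter⁺ generic? (∈-tabulate⁺ z) gz) c∈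

    classUnion-unique : ∀ t cs → Unique (classUnion t cs)
    classUnion-unique t cs = Unique.filter⁺ (λ z → class t z ∈? cs) (Unique.filter⁺ generic? (Unique.allFin⁺ p))

    -- The bound (h t)^(2/3) in cubed form: `stepanov` with the parameters of `choice`. D < p
    -- follows from D ≤ A ≤ t < p.
    classUnion-bound : ∀ t cs → 1 ≤ length cs → t < p → Q ℕ.* length cs < t ℕ.* t →
      length cs ℕ.* (t ℕ.* t ℕ.* (t ℕ.* t)) ≤ cube p →
      cube (length (classUnion t cs)) ≤ K ℕ.* (length cs ℕ.* length cs ℕ.* (t ℕ.* t))
    classUnion-bound t cs 1≤h t<p Qh<t² ht⁴≤p³ = outcome (length zs)
      (stepanov t A B D cs zs A≤t AB≤t tB≤p (ℕ.≤-<-trans (ℕ.≤-trans D≤A A≤t) t<p) count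
        (classUnion-unique t cs)
        (All.tabulate (λ z∈ → proj₂ (∈-filter⁻ generic? {xs = allFin p} (proj₁ (∈-filter⁻ class∈? z∈)))))
        (All.tabulate (λ z∈ → proj₂ (∈-filter⁻ class∈? {xs = filter generic? (allFin p)} z∈))))
      where
      open Choice (choice t (length cs) p 1≤h Qh<t² ht⁴≤p³)
      zs = classUnion t cs
      class∈? = λ z → class t z ∈? cs

    module _ {G : Subset p} (isSubgroup : IsMultiplicativeSubgroup G) where
      open Subgroup isSubgroup

      private
        t : ℕ
        t = ∣ G ∣

      1≤order : 1 ≤ t
      1≤order = ℕ.≤-trans (unique-⊆-length {xs = 1ₚ ∷ []} {ys = elements G} ([] ∷ []) (λ { (here refl) → ∈-elements⁺ 1∈ }))
        (ℕ.≤-reflexive (length-elements G))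

      affine : Fin p → Fin p → Fin p
      affine r v = 1ₚ - r *ₚ (1ₚ - v)

      IsSolution : Fin p → Fin p → Set
      IsSolution r v = v ≢ 1ₚ × affine r v ∈ˢ G

      isSolution? : ∀ r → Decidable (IsSolution r)
      isSolution? r v = ¬? (v ≟ 1ₚ) ×-dec (affine r v ∈ˢ? G)

      solutions : Fin p → List (Fin p)
      solutions r = filter (isSolution? r) (elements G)

      ∈-solutions⁻ : ∀ {r v} → v ∈ solutions r → v ∈ˢ G × IsSolution r v
      ∈-solutions⁻ {r} v∈ with ∈-filter⁻ (isSolution? r) v∈
      ... | v∈G , s = ∈-elements⁻ v∈G , s

      solutions-unique : ∀ r → Unique (solutions r)
      solutions-unique r = Unique.filter⁺ (isSolution? r) (elements-unique G)

      multiplicity : Fin p → ℕ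
      multiplicity r = length (solutions r)

      multiplicity≤order : ∀ r → multiplicity r ≤ t
      multiplicity≤order r = ℕ.≤-trans (length-filter (isSolution? r) (elements G)) (ℕ.≤-reflexive (length-elements G))

      -- A solution v of ratio r is the pair (v , affine r v) in G × G, which determines r.
      sum-multiplicity : ∀ rs → Unique rs → sum (map multiplicity rs) ≤ t ℕ.* t
      sum-multiplicity rs unique = ℕ.≤-trans
        (ℕ.≤-reflexive (cong sum (map-cong (λ r → sym (length-map (pair r) (solutions r))) rs)))
        (ℕ.≤-trans
          (disjoint-union-length (λ r → map (pair r) (solutions r)) {ys = cartesianProduct (elements G) (elements G)} unique
            (λ {r} _ → Unique.map⁺ ,-injectiveˡ (solutions-unique r)) (λ _ _ → disjoint) (λ {r} _ → sub {r}))
          (ℕ.≤-reflexive (trans (length-cartesianProduct (elements G) (elements G)) (cong₂ ℕ._*_ (length-elements G) (length-elements G)))))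
        where
        pair : Fin p → Fin p → Fin p × Fin p
        pair r v = v , affine r v
        disjoint : ∀ {r s x} → x ∈ map (pair r) (solutions r) → x ∈ map (pair s) (solutions s) → r ≡ s
        disjoint {r} {s} x∈ x∈′ with ∈-map⁻ (pair r) x∈ | ∈-map⁻ (pair s) x∈′
        ... | v , v∈ , refl | v′ , v′∈ , e with ,-injectiveˡ e
        ... | refl = *-cancelˡ (-≢0 (λ e → proj₁ (proj₂ (∈-solutions⁻ {r} v∈)) (sym e))) (begin
          (1ₚ - v) *ₚ r         ≡⟨ S.solve 2 (λ r v → (S.:1 S.:- v) S.:* r S.:= S.:1 S.:- (S.:1 S.:- r S.:* (S.:1 S.:- v))) refl r v ⟩
          1ₚ - affine r v       ≡⟨ cong (1ₚ -_) (,-injectiveʳ e) ⟩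
          1ₚ - affine s v       ≡⟨ S.solve 2 (λ r v → (S.:1 S.:- v) S.:* r S.:= S.:1 S.:- (S.:1 S.:- r S.:* (S.:1 S.:- v))) refl s v ⟨
          (1ₚ - v) *ₚ s         ∎)
          where open ≡-Reasoning
        sub : ∀ {r x} → x ∈ map (pair r) (solutions r) → x ∈ cartesianProduct (elements G) (elements G)
        sub {r} x∈ with ∈-map⁻ (pair r) x∈
        ... | v , v∈ , refl with ∈-solutions⁻ {r} v∈
        ... | v∈G , _ , u∈G = ∈-cartesianProduct⁺ (∈-elements⁺ v∈G) (∈-elements⁺ u∈G)

      -- The lines u = affine r v through (1 , 1) are normalised to u = i (1 - z) by v = z / base r.
      base : Fin p → Fin p
      base r = neg (r *ₚ inv (1ₚ - r))

      1-base : ∀ {r} → r ≢ 1ₚ → 1ₚ - base r ≡ inv (1ₚ - r)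
      1-base {r} r≢1 = trans
        (cong (_- base r) (sym (*-inv (-≢0 (r≢1 ∘ sym)))))
        (S.solve 2 (λ r i → (S.:1 S.:- r) S.:* i S.:- (S.:- (r S.:* i)) S.:= i) refl r (inv (1ₚ - r)))

      -- This is the purpose of `base`: for z = `base r *ₚ v` both z and 1 - z are elements of G
      -- multiplied by constants that depend on r only.
      1-base* : ∀ {r} v → r ≢ 1ₚ → 1ₚ - base r *ₚ v ≡ inv (1ₚ - r) *ₚ affine r v
      1-base* {r} v r≢1 = trans
        (cong (_- base r *ₚ v) (sym (*-inv (-≢0 (r≢1 ∘ sym)))))
        (S.solve 3 (λ r i v → (S.:1 S.:- r) S.:* i S.:- (S.:- (r S.:* i)) S.:* v S.:=
          i S.:* (S.:1 S.:- r S.:* (S.:1 S.:- v))) refl r (inv (1ₚ - r)) v)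

      base-≢0 : ∀ {r} → Generic r → base r ≢ 0ₚ
      base-≢0 {r} (r≢0 , r≢1) e = *-≢0 r≢0 (inv-≢0 (-≢0 (r≢1 ∘ sym)))
        (trans (S.solve 1 (λ x → x S.:= S.:- (S.:- x)) refl (r *ₚ inv (1ₚ - r)))
          (trans (cong neg e) (S.solve 0 (S.:- S.:0 S.:= S.:0) refl)))

      1-≢0⇒≢1 : ∀ {z} → 1ₚ - z ≢ 0ₚ → z ≢ 1ₚ
      1-≢0⇒≢1 1-z≢0 refl = 1-z≢0 (-ₚ-inverseʳ 1ₚ)

      base-generic : ∀ {r} → Generic r → Generic (base r)
      base-generic g@(_ , r≢1) = base-≢0 g ,
        1-≢0⇒≢1 (λ e → inv-≢0 (-≢0 (r≢1 ∘ sym)) (trans (sym (1-base r≢1)) e))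

      -- 1 - `base r` is the inverse of 1 - r, which determines r.
      base-injective : ∀ {r s} → Generic r → Generic s → base r ≡ base s → r ≡ s
      base-injective {r} {s} (_ , r≢1) (_ , s≢1) e = sym (-≡0 (begin
        s - r                               ≡⟨ S.solve 2 (λ r s → s S.:- r S.:= (S.:1 S.:- r) S.:- (S.:1 S.:- s)) refl r s ⟩
        (1ₚ - r) - (1ₚ - s)                 ≡⟨ cong (_- (1ₚ - s)) (*-cancelˡ (inv-≢0 1-r≢0) (begin
          inv (1ₚ - r) *ₚ (1ₚ - r)          ≡⟨ F.*-comm (inv (1ₚ - r)) (1ₚ - r) ⟩
          (1ₚ - r) *ₚ inv (1ₚ - r)          ≡⟨ *-inv 1-r≢0 ⟩
          1ₚ                                ≡⟨ *-inv 1-s≢0 ⟨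
          (1ₚ - s) *ₚ inv (1ₚ - s)          ≡⟨ F.*-comm (1ₚ - s) (inv (1ₚ - s)) ⟩
          inv (1ₚ - s) *ₚ (1ₚ - s)          ≡⟨ cong (_*ₚ (1ₚ - s)) (trans (sym (1-base s≢1)) (trans (cong (1ₚ -_) (sym e)) (1-base r≢1))) ⟩
          inv (1ₚ - r) *ₚ (1ₚ - s)          ∎)) ⟩
        (1ₚ - s) - (1ₚ - s)                 ≡⟨ -ₚ-inverseʳ _ ⟩
        0ₚ                                  ∎))
        where
        open ≡-Reasoning
        1-r≢0 = -≢0 (r≢1 ∘ sym)
        1-s≢0 = -≢0 (s≢1 ∘ sym)

      solution-generic : ∀ {r v} → Generic r → v ∈ solutions r → Generic (base r *ₚ v)
      solution-generic {r} {v} g@(_ , r≢1) v∈ with ∈-solutions⁻ {r} v∈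
      ... | v∈G , _ , u∈G = *-≢0 (base-≢0 g) (∈⇒≢0 v∈G) ,
        1-≢0⇒≢1 (λ e → *-≢0 (inv-≢0 (-≢0 (r≢1 ∘ sym))) (∈⇒≢0 u∈G) (trans (sym (1-base* v r≢1)) e))

      solution-class : ∀ {r v} → Generic r → v ∈ solutions r → class t (base r *ₚ v) ≡ class t (base r)
      solution-class {r} {v} (_ , r≢1) v∈ with ∈-solutions⁻ {r} v∈
      ... | v∈G , _ , u∈G = class-* t {base r} {v} {inv (1ₚ - r)} {affine r v} (^-order v∈G) (^-order u∈G) (1-base* v r≢1) (1-base r≢1)

      -- Multiplication by base r maps the solutions of ratio r into the class of base r.
      classUnion-large : ∀ τ cs → Unique cs →
        (∀ {c} → c ∈ cs → ∃[ r ] (Generic r × τ ≤ multiplicity r × class t (base r) ≡ c)) →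
        length cs ℕ.* τ ≤ length (classUnion t cs)
      classUnion-large τ cs unique represented = ℕ.≤-trans
        (sum-lower (λ c → length (fibre c)) τ cs large)
        (disjoint-union-length fibre {ys = classUnion t cs} unique
          (λ {c} _ → Unique.filter⁺ (λ z → class t z ≟² c) (classUnion-unique t cs))
          (λ {c} {d} _ _ z∈ z∈′ → trans (sym (proj₂ (∈-fibre⁻ c z∈))) (proj₂ (∈-fibre⁻ d z∈′)))
          (λ {c} _ z∈ → proj₁ (∈-fibre⁻ c z∈)))
        where
        fibre : Fin p × Fin p → List (Fin p)
        fibre c = filter (λ z → class t z ≟² c) (classUnion t cs)
        ∈-fibre⁻ : ∀ c {z} → z ∈ fibre c → z ∈ classUnion t cs × class t z ≡ c
        ∈-fibre⁻ c = ∈-filter⁻ (λ z → class t z ≟² c)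
        large : ∀ {c} → c ∈ cs → τ ≤ length (fibre c)
        large {c} c∈ with represented c∈
        ... | r , gr , τ≤ , refl = ℕ.≤-trans τ≤ (ℕ.≤-trans
          (ℕ.≤-reflexive (sym (length-map (base r *ₚ_) (solutions r))))
          (unique-⊆-length (Unique.map⁺ (*-cancelˡ (base-≢0 gr)) (solutions-unique r)) sub))
          where
          sub : ∀ {z} → z ∈ map (base r *ₚ_) (solutions r) → z ∈ fibre c
          sub z∈ with ∈-map⁻ (base r *ₚ_) z∈
          ... | v , v∈ , refl = ∈-filter⁺ (λ z → class t z ≟² c)
            (∈-classUnion⁺ {t} {cs} (solution-generic gr v∈) (subst (_∈ cs) (sym (solution-class gr v∈)) c∈))
            (solution-class gr v∈)

    module _ {G : Subset p} (isSubgroup : IsMultiplicativeSubgroup G) (t²<p : ∣ G ∣ ℕ.* ∣ G ∣ < p) where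
      private
        t : ℕ
        t = ∣ G ∣
        1≤t : 1 ≤ t
        1≤t = 1≤order isSubgroup
        t≤t² : t ≤ t ℕ.* t
        t≤t² = ℕ.m≤m*n t t {{>-nonZero 1≤t}}
        mult : Fin p → ℕ
        mult = multiplicity isSubgroup

      -- Here |A| < √p enters: h ≤ Q h < t² < p and t⁴ ≤ p² give h t⁴ ≤ p³.
      union-bound : ∀ cs → 1 ≤ length cs → Q ℕ.* length cs < t ℕ.* t →
        cube (length (classUnion t cs)) ≤ K ℕ.* (length cs ℕ.* length cs ℕ.* (t ℕ.* t))
      union-bound cs 1≤h Qh<t² = classUnion-bound t cs 1≤h (ℕ.≤-<-trans t≤t² t²<p) Qh<t²
        (ℕ.*-mono-≤ (ℕ.≤-trans (ℕ.m≤n*m (length cs) Q {{>-nonZero 1≤Q}}) (ℕ.≤-trans (ℕ.<⇒≤ Qh<t²) (ℕ.<⇒≤ t²<p)))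
          (square-mono (ℕ.<⇒≤ t²<p)))

      -- `base` embeds `rs` into the union of the h classes it meets, and each of them has at least
      -- τ points, so `scale-out` applies to the size of the union. This needs Q h < t²; in the
      -- remaining cases τ is at most the constant `M`.
      level-bound : ∀ τ rs → Unique rs → (∀ {r} → r ∈ rs → Generic r) → (∀ {r} → r ∈ rs → τ ≤ mult r) →
        length rs ℕ.* (τ ℕ.* τ) ≤ M ℕ.* (t ℕ.* t)
      level-bound τ [] _ _ _ = z≤n
      level-bound τ rs@(r₀ ∷ _) unique generic large = by-size (Q ℕ.* h <? t ℕ.* t)
        where
        open ℕ.≤-Reasoning
        B : Fin p → Fin p
        B = base isSubgroup
        cs : List (Fin p × Fin p)
        cs = deduplicate _≟²_ (map (λ r → class t (B r)) rs)
        h : ℕ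
        h = length cs

        class∈cs : ∀ {r} → r ∈ rs → class t (B r) ∈ cs
        class∈cs r∈ = ∈-deduplicate⁺ _≟²_ (∈-map⁺ (λ r → class t (B r)) r∈)

        1≤h : 1 ≤ h
        1≤h = nonempty (class∈cs (here refl))
          where
          nonempty : ∀ {c cs} → c ∈ cs → 1 ≤ length {A = Fin p × Fin p} cs
          nonempty (here _)  = s≤s z≤n
          nonempty (there _) = s≤s z≤n

        represented : ∀ {c} → c ∈ cs → ∃[ r ] (Generic r × τ ≤ mult r × class t (B r) ≡ c)
        represented c∈ with ∈-map⁻ (λ r → class t (B r)) (∈-deduplicate⁻ _≟²_ (map (λ r → class t (B r)) rs) c∈)
        ... | r , r∈ , e = r , generic r∈ , large r∈ , sym e

        size : ∀ cs′ → Unique cs′ → (∀ {c} → c ∈ cs′ → c ∈ cs) → length cs′ ℕ.* τ ≤ length (classUnion t cs′)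
        size cs′ unique′ sub = classUnion-large isSubgroup τ cs′ unique′ (λ c∈ → represented (sub c∈))

        cs-unique : Unique cs
        cs-unique = deduplicate-! _≟²_ (map (λ r → class t (B r)) rs)

        rs≤ : length rs ≤ length (classUnion t cs)
        rs≤ = ℕ.≤-trans (ℕ.≤-reflexive (sym (length-map B rs)))
          (unique-⊆-length (map-unique unique (λ r∈ s∈ → base-injective isSubgroup (generic r∈) (generic s∈))) sub)
          where
          sub : ∀ {z} → z ∈ map B rs → z ∈ classUnion t cs
          sub z∈ with ∈-map⁻ B z∈
          ... | r , r∈ , refl = ∈-classUnion⁺ {t} {cs} (base-generic isSubgroup (generic r∈)) (class∈cs r∈)

        -- If there are too many classes for stepanov, then truncating their list shows
        -- that τ is bounded, and the trivial estimate Σ mult ≤ t² suffices.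
        from-small : τ ≤ M → length rs ℕ.* (τ ℕ.* τ) ≤ M ℕ.* (t ℕ.* t)
        from-small τ≤M = begin
          length rs ℕ.* (τ ℕ.* τ)      ≡⟨ solve 2 (λ n u → n :* (u :* u) := u :* (n :* u)) refl (length rs) τ ⟩
          τ ℕ.* (length rs ℕ.* τ)      ≤⟨ ℕ.*-mono-≤ τ≤M (ℕ.≤-trans (sum-lower mult τ rs large) (sum-multiplicity isSubgroup rs unique)) ⟩
          M ℕ.* (t ℕ.* t)              ∎

        truncated : Q ℕ.* 1 < t ℕ.* t → ¬ (Q ℕ.* h < t ℕ.* t) → τ ≤ M
        truncated Q<t² Qh≮t² with last-true {λ k → Q ℕ.* k < t ℕ.* t} (λ k → Q ℕ.* k <? t ℕ.* t) h Q<t²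
          (λ lt → Qh≮t² (ℕ.≤-<-trans (ℕ.*-monoʳ-≤ Q (ℕ.n≤1+n h)) lt))
        -- k classes are still admissible and k + 1 are not, so t² ≤ Q (k + 1) ≤ 2 Q k.
        ... | k , 1≤k , Qk<t² , ¬Qk′ = scale-small (length (classUnion t cs′)) k τ (t ℕ.* t)
            (subst (λ l → cube (length (classUnion t cs′)) ≤ K ℕ.* (l ℕ.* l ℕ.* (t ℕ.* t))) length-cs′
              (union-bound cs′ (subst (1 ≤_) (sym length-cs′) 1≤k) (subst (λ l → Q ℕ.* l < t ℕ.* t) (sym length-cs′) Qk<t²)))
            (subst (λ l → l ℕ.* τ ≤ length (classUnion t cs′)) length-cs′ (size cs′ (Unique.take⁺ k cs-unique) (take-⊆ k cs)))
            1≤k (begin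
              t ℕ.* t                  ≤⟨ ℕ.≮⇒≥ ¬Qk′ ⟩
              Q ℕ.* (1 ℕ.+ k)          ≤⟨ ℕ.*-monoʳ-≤ Q (ℕ.+-monoˡ-≤ k 1≤k) ⟩
              Q ℕ.* (k ℕ.+ k)          ≡⟨ solve 2 (λ q k → q :* (k :+ k) := con 2 :* (q :* k)) refl Q k ⟩
              2 ℕ.* (Q ℕ.* k)          ∎)
          where
          cs′ = take k cs
          k≤h : k ≤ h
          k≤h = ℕ.≮⇒≥ (λ h<k → Qh≮t² (ℕ.≤-<-trans (ℕ.*-monoʳ-≤ Q (ℕ.<⇒≤ h<k)) Qk<t²))
          length-cs′ : length cs′ ≡ k
          length-cs′ = trans (length-take k cs) (ℕ.m≤n⇒m⊓n≡m k≤h)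
          take-⊆ : ∀ k (xs : List (Fin p × Fin p)) {x} → x ∈ take k xs → x ∈ xs
          take-⊆ (suc k) (x ∷ xs) (here e)   = here e
          take-⊆ (suc k) (x ∷ xs) (there x∈) = there (take-⊆ k xs x∈)

        by-size : Dec (Q ℕ.* h < t ℕ.* t) → length rs ℕ.* (τ ℕ.* τ) ≤ M ℕ.* (t ℕ.* t)
        by-size (yes Qh<t²) = ℕ.≤-trans
          (scale-out (length (classUnion t cs)) h τ (length rs) (t ℕ.* t) (union-bound cs 1≤h Qh<t²) (size cs cs-unique (λ c∈ → c∈)) rs≤)
          (ℕ.*-monoˡ-≤ (t ℕ.* t) K≤M)
        by-size (no Qh≮t²) with Q ℕ.* 1 <? t ℕ.* t
        ... | yes Q<t² = from-small (truncated Q<t² Qh≮t²)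
        -- Not even one class is admissible, but then t itself is bounded by Q.
        ... | no  Q≮t² = from-small (begin
          τ            ≤⟨ large (here refl) ⟩
          mult r₀      ≤⟨ multiplicity≤order isSubgroup r₀ ⟩
          t            ≤⟨ t≤t² ⟩
          t ℕ.* t      ≤⟨ ℕ.≮⇒≥ Q≮t² ⟩
          Q ℕ.* 1      ≡⟨ ℕ.*-identityʳ Q ⟩
          Q            ≤⟨ Q≤M ⟩
          M            ∎)

      energy : ∀ k rs → Unique rs → (∀ {r} → r ∈ rs → Generic r) → t < 2 ℕ.^ k →
        sum (map (λ r → mult r ℕ.* mult r) rs) ≤ k ℕ.* (4 ℕ.* (M ℕ.* (t ℕ.* t)))
      energy k rs unique generic t<2^k = dyadic mult (M ℕ.* (t ℕ.* t)) rs k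
        (λ {r} _ → ℕ.≤-<-trans (multiplicity≤order isSubgroup r) t<2^k)
        (λ j → level-bound (2 ℕ.^ j) (filter (λ r → 2 ℕ.^ j ≤? mult r) rs)
          (Unique.filter⁺ (λ r → 2 ℕ.^ j ≤? mult r) unique)
          (λ r∈ → generic (proj₁ (∈-filter⁻ (λ r → 2 ℕ.^ j ≤? mult r) {xs = rs} r∈)))
          (λ r∈ → proj₂ (∈-filter⁻ (λ r → 2 ℕ.^ j ≤? mult r) {xs = rs} r∈)))

    -- The size of Γ ∩ (1 - Γ).

    module Ratios {Γ : Subset p} (isSubgroup : IsMultiplicativeSubgroup Γ) where
      open Subgroup isSubgroup

      private
        γ : ℕ
        γ = ∣ Γ ∣

      IsRatio : Fin p → Set
      IsRatio r = r ∈ˢ Γ × (1ₚ - r) ∈ˢ Γ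

      isRatio? : Decidable IsRatio
      isRatio? r = (r ∈ˢ? Γ) ×-dec ((1ₚ - r) ∈ˢ? Γ)

      ratios : List (Fin p)
      ratios = filter isRatio? (allFin p)

      ratios-unique : Unique ratios
      ratios-unique = Unique.filter⁺ isRatio? (Unique.allFin⁺ p)

      ∈-ratios⁻ : ∀ {r} → r ∈ ratios → IsRatio r
      ∈-ratios⁻ r∈ = proj₂ (∈-filter⁻ isRatio? {xs = allFin p} r∈)

      ratio-generic : ∀ {r} → IsRatio r → Generic r
      ratio-generic (r∈ , 1-r∈) = ∈⇒≢0 r∈ , λ { refl → ∈⇒≢0 1-r∈ (-ₚ-inverseʳ 1ₚ) }

      1≤γ : 1 ≤ γ
      1≤γ = 1≤order isSubgroup

      Q≤K : Q ≤ K
      Q≤K = ℕ.≤-trans (ℕ.m≤n*m Q 8) (ℕ.m≤m*n (8 ℕ.* Q) (8 ℕ.* Q) {{>-nonZero (ℕ.*-mono-≤ {1} {8} {1} (s≤s z≤n) 1≤Q)}})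

      -- r and 1 - r have γ-th power 1, so all ratios lie in the class (1 , 1), and for h = 1 the
      -- condition of the method is |Γ| < p^(3/4). If γ² ≤ Q, the trivial bound by γ ≤ K is enough.
      length-ratios : γ ℕ.* γ ℕ.* (γ ℕ.* γ) < cube p → cube (length ratios) ≤ K ℕ.* (γ ℕ.* γ)
      length-ratios γ⁴<p³ with Q ℕ.* 1 <? γ ℕ.* γ
      ... | yes Q<γ² = ℕ.≤-trans (cube-mono (unique-⊆-length ratios-unique sub)) (ℕ.≤-trans
          (classUnion-bound γ cs (s≤s z≤n) γ<p Q<γ² (ℕ.≤-trans (ℕ.≤-reflexive (ℕ.+-identityʳ _)) (ℕ.<⇒≤ γ⁴<p³)))
          (ℕ.≤-reflexive (cong (K ℕ.*_) (ℕ.+-identityʳ (γ ℕ.* γ)))))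
        where
        cs : List (Fin p × Fin p)
        cs = (1ₚ , 1ₚ) ∷ []
        γ<p : γ < p
        γ<p = ℕ.≰⇒> (λ p≤γ → ℕ.<⇒≱ γ⁴<p³ (ℕ.≤-trans (cube-mono p≤γ)
          (ℕ.≤-trans (ℕ.m≤n*m (cube γ) γ {{>-nonZero 1≤γ}})
            (ℕ.≤-reflexive (solve 1 (λ g → g :* (g :* (g :* g)) := g :* g :* (g :* g)) refl γ)))))
        sub : ∀ {r} → r ∈ ratios → r ∈ classUnion γ cs
        sub {r} r∈ = ∈-classUnion⁺ {γ} {cs} (ratio-generic (∈-ratios⁻ r∈))
          (here (cong₂ _,_ (^-order (proj₁ (∈-ratios⁻ r∈))) (^-order (proj₂ (∈-ratios⁻ r∈)))))
      ... | no Q≮γ² = ℕ.*-mono-≤ (begin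
            length ratios   ≤⟨ ratios≤γ ⟩
            γ               ≤⟨ ℕ.m≤m*n γ γ {{>-nonZero 1≤γ}} ⟩
            γ ℕ.* γ         ≤⟨ ℕ.≮⇒≥ Q≮γ² ⟩
            Q ℕ.* 1         ≡⟨ ℕ.*-identityʳ Q ⟩
            Q               ≤⟨ Q≤K ⟩
            K               ∎) (square-mono ratios≤γ)
        where
        open ℕ.≤-Reasoning
        ratios≤γ : length ratios ≤ γ
        ratios≤γ = ℕ.≤-trans (unique-⊆-length {ys = elements Γ} ratios-unique (λ r∈ → ∈-elements⁺ (proj₁ (∈-ratios⁻ r∈))))
          (ℕ.≤-reflexive (length-elements Γ))

    -- Pairs of points of A′ and the resulting bound.

    module _ {A Γ : Subset p} (A-subgroup : IsMultiplicativeSubgroup A) (Γ-subgroup : IsMultiplicativeSubgroup Γ)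
      (t²<p : ∣ A ∣ ℕ.* ∣ A ∣ < p) (A′ : Subset p) (s ξ : Fin p) (ξ≢0 : ξ ≢ 0ₚ)
      (A′⊆A+s : (_∈ˢ A′) ⊆ A +ˢ s) (A′-A′⊆ξΓ : A′ -ˢ A′ ⊆ (ξ *ˢ Γ) ∪ ｛ 0ₚ ｝)
      where
      open Ratios Γ-subgroup
      private
        module A = Subgroup A-subgroup
        module Γ = Subgroup Γ-subgroup
        t n : ℕ
        t = ∣ A ∣
        n = ∣ A′ ∣
        mult : Fin p → ℕ
        mult = multiplicity A-subgroup

      translate∈ : ∀ {x} → x ∈ˢ A′ → x - s ∈ˢ A
      translate∈ x∈ with A′⊆A+s x∈
      ... | α , α∈ , refl = subst (_∈ˢ A) (S.solve 2 (λ a s → a S.:= (a S.:+ s) S.:- s) refl α s) α∈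

      difference∈ : ∀ {x y} → x ∈ˢ A′ → y ∈ˢ A′ → x ≢ y → ∃[ g ] (g ∈ˢ Γ × x - y ≡ ξ *ₚ g)
      difference∈ {x} {y} x∈ y∈ x≢y with A′-A′⊆ξΓ (x , y , x∈ , y∈ , refl)
      ... | inj₁ (g , g∈ , e) = g , g∈ , trans (sym (-ₚ-def x y)) e
      ... | inj₂ e            = contradiction (-≡0 (trans (sym (-ₚ-def x y)) (sym e))) x≢y

      -- The dilation ξ cancels: differences lie in ξ Γ, but their quotients lie in Γ.
      quotient∈ : ∀ {q x y} g h → g ∈ˢ Γ → h ∈ˢ Γ → x ≡ ξ *ₚ g → y ≡ ξ *ₚ h → q *ₚ y ≡ x → q ∈ˢ Γ
      quotient∈ {q} g h g∈ h∈ refl refl e = subst (_∈ˢ Γ) (sym q≡) (Γ.*-closed g∈ (Γ.inv-closed h∈))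
        where
        open ≡-Reasoning
        qh≡g : q *ₚ h ≡ g
        qh≡g = *-cancelˡ ξ≢0 (trans (S.solve 3 (λ x q h → x S.:* (q S.:* h) S.:= q S.:* (x S.:* h)) refl ξ q h) e)
        q≡ : q ≡ g *ₚ inv h
        q≡ = begin
          q                       ≡⟨ F.*-identityʳ q ⟨
          q *ₚ 1ₚ                 ≡⟨ cong (q *ₚ_) (*-inv (Γ.∈⇒≢0 h∈)) ⟨
          q *ₚ (h *ₚ inv h)       ≡⟨ F.*-assoc q h (inv h) ⟨
          q *ₚ h *ₚ inv h         ≡⟨ cong (_*ₚ inv h) qh≡g ⟩
          g *ₚ inv h              ∎

      translates : n ≤ t
      translates = ℕ.≤-trans (ℕ.≤-reflexive (trans (sym (length-elements A′)) (sym (length-map (_- s) (elements A′)))))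
        (ℕ.≤-trans (unique-⊆-length {ys = elements A} (Unique.map⁺ shift-injective (elements-unique A′)) sub)
          (ℕ.≤-reflexive (length-elements A)))
        where
        shift-injective : ∀ {x y} → x - s ≡ y - s → x ≡ y
        shift-injective {x} {y} e = trans (S.solve 2 (λ x s → x S.:= (x S.:- s) S.:+ s) refl x s)
          (trans (cong (_+ₚ s) e) (S.solve 2 (λ x s → (x S.:- s) S.:+ s S.:= x) refl y s))
        sub : ∀ {x} → x ∈ map (_- s) (elements A′) → x ∈ elements A
        sub x∈ with ∈-map⁻ (_- s) x∈
        ... | y , y∈ , refl = ∈-elements⁺ (translate∈ (∈-elements⁻ y∈))

      module _ {o : Fin p} (o∈ : o ∈ˢ A′) where

        ratio : Fin p → Fin p → Fin p
        ratio c b = (o - b) *ₚ inv (o - c)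

        coordinate : Fin p → Fin p
        coordinate c = (c - s) *ₚ inv (o - s)

        o-s≢0 : o - s ≢ 0ₚ
        o-s≢0 = A.∈⇒≢0 (translate∈ o∈)

        ratio-* : ∀ {c} b → o ≢ c → ratio c b *ₚ (o - c) ≡ o - b
        ratio-* {c} b o≢c = trans (S.solve 3 (λ x i y → x S.:* i S.:* y S.:= x S.:* (y S.:* i)) refl (o - b) (inv (o - c)) (o - c))
          (trans (cong ((o - b) *ₚ_) (*-inv (-≢0 o≢c))) (F.*-identityʳ (o - b)))

        -- 1 - r = (b - c) / (o - c), so r and 1 - r are quotients of differences of three distinct
        -- points.
        isRatio : ∀ {c b} → c ∈ˢ A′ → b ∈ˢ A′ → o ≢ c → o ≢ b → b ≢ c → IsRatio (ratio c b)
        isRatio {c} {b} c∈ b∈ o≢c o≢b b≢c with difference∈ o∈ c∈ o≢c | difference∈ o∈ b∈ o≢b | difference∈ b∈ c∈ b≢c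
        ... | h , h∈ , eh | g , g∈ , eg | g′ , g′∈ , eg′ =
          quotient∈ g h g∈ h∈ eg eh (ratio-* b o≢c) ,
          quotient∈ g′ h g′∈ h∈ eg′ eh (trans
            (S.solve 2 (λ r y → (S.:1 S.:- r) S.:* y S.:= y S.:- r S.:* y) refl (ratio c b) (o - c))
            (trans (cong ((o - c) -_) (ratio-* b o≢c))
              (S.solve 3 (λ o b c → (o S.:- c) S.:- (o S.:- b) S.:= b S.:- c) refl o b c)))

        -- The coordinate of o is 1, and 1 minus the coordinate of c is (o - c) / (o - s). The
        -- denominator o - s cancels in the ratio.
        affine-coordinate : ∀ {c} b → o ≢ c → affine A-subgroup (ratio c b) (coordinate c) ≡ coordinate b
        affine-coordinate {c} b o≢c = begin
          1ₚ - r *ₚ (1ₚ - (c - s) *ₚ i)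
            ≡⟨ cong (λ e → e - r *ₚ (e - (c - s) *ₚ i)) (sym (*-inv o-s≢0)) ⟩
          (o - s) *ₚ i - r *ₚ ((o - s) *ₚ i - (c - s) *ₚ i)
            ≡⟨ S.solve 5 (λ o s c i r → (o S.:- s) S.:* i S.:- r S.:* ((o S.:- s) S.:* i S.:- (c S.:- s) S.:* i) S.:=
                 ((o S.:- s) S.:- r S.:* (o S.:- c)) S.:* i) refl o s c i r ⟩
          ((o - s) - r *ₚ (o - c)) *ₚ i
            ≡⟨ cong (λ e → ((o - s) - e) *ₚ i) (ratio-* b o≢c) ⟩
          ((o - s) - (o - b)) *ₚ i
            ≡⟨ S.solve 4 (λ o s b i → ((o S.:- s) S.:- (o S.:- b)) S.:* i S.:= (b S.:- s) S.:* i) refl o s b i ⟩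
          coordinate b ∎
          where
          open ≡-Reasoning
          i = inv (o - s)
          r = ratio c b

        coordinate-injective : ∀ {c d} → coordinate c ≡ coordinate d → c ≡ d
        coordinate-injective {c} {d} e = begin
          c               ≡⟨ S.solve 2 (λ x s → x S.:= (x S.:- s) S.:+ s) refl c s ⟩
          (c - s) +ₚ s    ≡⟨ cong (_+ₚ s) (*-cancelˡ (inv-≢0 o-s≢0) (trans (F.*-comm (inv (o - s)) (c - s))
                               (trans e (F.*-comm (d - s) (inv (o - s)))))) ⟩
          (d - s) +ₚ s    ≡⟨ S.solve 2 (λ x s → (x S.:- s) S.:+ s S.:= x) refl d s ⟩
          d               ∎
          where open ≡-Reasoning

        coordinate∈ : ∀ {c} → c ∈ˢ A′ → coordinate c ∈ˢ A
        coordinate∈ c∈ = A.*-closed (translate∈ c∈) (A.inv-closed (translate∈ o∈))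

        isSolution : ∀ {c b} → c ∈ˢ A′ → b ∈ˢ A′ → o ≢ c → coordinate c ∈ solutions A-subgroup (ratio c b)
        isSolution {c} {b} c∈ b∈ o≢c = ∈-filter⁺ (isSolution? A-subgroup (ratio c b)) (∈-elements⁺ (coordinate∈ c∈))
          ((λ e → o≢c (coordinate-injective (trans (*-inv o-s≢0) (sym e)))) ,
           subst (_∈ˢ A) (sym (affine-coordinate b o≢c)) (coordinate∈ b∈))

        others : List (Fin p)
        others = remove _≟_ o (elements A′)

        ∈-others⁻ : ∀ {c} → c ∈ others → c ∈ˢ A′ × o ≢ c
        ∈-others⁻ c∈ with ∈-filter⁻ (λ x → ¬? (x ≟ o)) c∈
        ... | c∈A′ , c≢o = ∈-elements⁻ c∈A′ , λ e → c≢o (sym e)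

        others-unique : Unique others
        others-unique = Unique.filter⁺ (λ x → ¬? (x ≟ o)) (elements-unique A′)

        n≤1+others : n ≤ suc (length others)
        n≤1+others = ℕ.≤-trans (ℕ.≤-reflexive (sym (length-elements A′))) (length-remove _≟_ o (elements A′) (elements-unique A′))

        -- Divided by ξ, the differences o - c are distinct elements of Γ.
        others≤ : length others ≤ ∣ Γ ∣
        others≤ = ℕ.≤-trans (ℕ.≤-reflexive (sym (length-map (λ c → inv ξ *ₚ (o - c)) others)))
          (ℕ.≤-trans (unique-⊆-length {ys = elements Γ} (Unique.map⁺ injective others-unique) sub)
            (ℕ.≤-reflexive (length-elements Γ)))
          where
          injective : ∀ {c d} → inv ξ *ₚ (o - c) ≡ inv ξ *ₚ (o - d) → c ≡ d
          injective {c} {d} e = trans (S.solve 2 (λ o b → b S.:= o S.:- (o S.:- b)) refl o c)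
            (trans (cong (o -_) (*-cancelˡ (inv-≢0 ξ≢0) e)) (S.solve 2 (λ o b → o S.:- (o S.:- b) S.:= b) refl o d))
          sub : ∀ {x} → x ∈ map (λ c → inv ξ *ₚ (o - c)) others → x ∈ elements Γ
          sub x∈ with ∈-map⁻ (λ c → inv ξ *ₚ (o - c)) x∈
          ... | c , c∈ , refl with ∈-others⁻ c∈
          ... | c∈A′ , o≢c with difference∈ o∈ c∈A′ o≢c
          ... | g , g∈ , e = ∈-elements⁺ (subst (_∈ˢ Γ) (sym (begin
            inv ξ *ₚ (o - c)     ≡⟨ cong (inv ξ *ₚ_) e ⟩
            inv ξ *ₚ (ξ *ₚ g)    ≡⟨ S.solve 3 (λ i x g → i S.:* (x S.:* g) S.:= (x S.:* i) S.:* g) refl (inv ξ) ξ g ⟩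
            (ξ *ₚ inv ξ) *ₚ g    ≡⟨ cong (_*ₚ g) (*-inv ξ≢0) ⟩
            1ₚ *ₚ g              ≡⟨ *ₚ-identityˡ g ⟩
            g                    ∎)) g∈)
            where open ≡-Reasoning

        -- (c , b) ↦ (ratio c b , coordinate c) is injective.
        pairs≤ : length others ℕ.* (length others ℕ.∸ 1) ≤ sum (map mult ratios)
        pairs≤ = ℕ.≤-trans (sum-lower (λ c → length (f c)) (length others ℕ.∸ 1) others (λ {c} _ → large c))
          (ℕ.≤-trans (disjoint-union-length f {ys = ys} others-unique f-unique disjoint sub)
            (ℕ.≤-reflexive (trans (length-concatMap (λ r → map (r ,_) (solutions A-subgroup r)) ratios)
              (cong sum (map-cong (λ r → length-map (r ,_) (solutions A-subgroup r)) ratios)))))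
          where
          f : Fin p → List (Fin p × Fin p)
          f c = map (λ b → ratio c b , coordinate c) (remove _≟_ c others)
          ys : List (Fin p × Fin p)
          ys = concatMap (λ r → map (r ,_) (solutions A-subgroup r)) ratios
          large : ∀ c → length others ℕ.∸ 1 ≤ length (f c)
          large c = ℕ.≤-trans (ℕ.∸-monoˡ-≤ 1 (length-remove _≟_ c others others-unique))
            (ℕ.≤-reflexive (sym (length-map _ (remove _≟_ c others))))
          f-unique : ∀ {c} → c ∈ others → Unique (f c)
          f-unique {c} c∈ = Unique.map⁺ injective (Unique.filter⁺ (λ x → ¬? (x ≟ c)) others-unique)
            where
            injective : ∀ {b d} → (ratio c b , coordinate c) ≡ (ratio c d , coordinate c) → b ≡ d
            injective {b} {d} e = begin
              b             ≡⟨ S.solve 2 (λ o b → b S.:= o S.:- (o S.:- b)) refl o b ⟩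
              o - (o - b)   ≡⟨ cong (o -_) (trans (sym (ratio-* b o≢c)) (trans (cong (_*ₚ (o - c)) (,-injectiveˡ e)) (ratio-* d o≢c))) ⟩
              o - (o - d)   ≡⟨ S.solve 2 (λ o b → o S.:- (o S.:- b) S.:= b) refl o d ⟩
              d             ∎
              where
              open ≡-Reasoning
              o≢c = proj₂ (∈-others⁻ c∈)
          disjoint : ∀ {c d z} → c ∈ others → d ∈ others → z ∈ f c → z ∈ f d → c ≡ d
          disjoint {c} {d} _ _ z∈ z∈′ with ∈-map⁻ (λ b → ratio c b , coordinate c) z∈ | ∈-map⁻ (λ b → ratio d b , coordinate d) z∈′
          ... | _ , _ , e | _ , _ , e′ = coordinate-injective (,-injectiveʳ (trans (sym e) e′))
          sub : ∀ {c z} → c ∈ others → z ∈ f c → z ∈ ys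
          sub {c} c∈ z∈ with ∈-map⁻ (λ b → ratio c b , coordinate c) z∈
          ... | b , b∈ , refl with ∈-filter⁻ (λ x → ¬? (x ≟ c)) {xs = others} b∈ | ∈-others⁻ c∈
          ... | b∈′ , b≢c | c∈A′ , o≢c with ∈-others⁻ b∈′
          ... | b∈A′ , o≢b = ∈-concatMap⁺ (λ r → map (r ,_) (solutions A-subgroup r))
            (lose (∈-filter⁺ isRatio? (∈-tabulate⁺ (ratio c b)) (isRatio c∈A′ b∈A′ o≢c o≢b b≢c))
              (∈-map⁺ (ratio c b ,_) (isSolution c∈A′ b∈A′ o≢c)))

        square-bound : ∀ k → t < 2 ℕ.^ k →
          length others ℕ.* (length others ℕ.∸ 1) ℕ.* (length others ℕ.* (length others ℕ.∸ 1)) ≤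
          length ratios ℕ.* (k ℕ.* (4 ℕ.* (M ℕ.* (t ℕ.* t))))
        square-bound k t<2^k = ℕ.≤-trans (square-mono pairs≤) (ℕ.≤-trans (cauchy-schwarz mult ratios)
          (ℕ.*-monoʳ-≤ (length ratios) (energy A-subgroup t²<p k ratios ratios-unique (λ r∈ → ratio-generic (∈-ratios⁻ r∈)) t<2^k)))

      -- Serves to replace log |A| by log |Γ| in the case A′ = A, at the cost of a factor 2. The
      -- bound 1 + |Γ| is weakened to a power for this.
      order≤ : 1 < ∣ Γ ∣ → n ≤ ∣ Γ ∣ ℕ.* ∣ Γ ∣
      order≤ 1<γ with elements A′ in eq
      ... | [] = ℕ.≤-trans (ℕ.≤-reflexive (trans (sym (length-elements A′)) (cong length eq))) z≤n
      ... | o ∷ _ = begin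
        n                          ≤⟨ n≤1+others o∈ ⟩
        1 ℕ.+ length (others o∈)   ≤⟨ ℕ.+-mono-≤ (ℕ.<⇒≤ 1<γ) (others≤ o∈) ⟩
        γ ℕ.+ γ                    ≡⟨ solve 1 (λ g → g :+ g := con 2 :* g) refl γ ⟩
        2 ℕ.* γ                    ≤⟨ ℕ.*-monoˡ-≤ γ 1<γ ⟩
        γ ℕ.* γ                    ∎
        where
        open ℕ.≤-Reasoning
        γ = ∣ Γ ∣
        o∈ : o ∈ˢ A′
        o∈ = ∈-elements⁻ (subst (o ∈_) (sym eq) (here refl))

      -- At least 1, so that the trivial case n ≤ 2 obeys the same bound.
      ratioCount : ℕ
      ratioCount = length ratios ℕ.⊔ 1

      -- With k points besides o and k ≥ 2, n ≤ k + 1 ≤ 2 k and k ≤ 2 (k - 1), so n² ≤ 8 k (k - 1),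
      -- which `square-bound` controls. For k ≤ 1 the set has at most 2 elements.
      fourth-power-bound : ∀ j → 1 ≤ j → t < 2 ℕ.^ suc j →
        n ℕ.* n ℕ.* (n ℕ.* n) ≤ C ℕ.* (ratioCount ℕ.* (j ℕ.* (t ℕ.* t)))
      fourth-power-bound j 1≤j t<2^j with elements A′ in eq
      ... | [] rewrite trans (sym (length-elements A′)) (cong length eq) = z≤n
      ... | o ∷ _ = by-others (length (others o∈)) (n≤1+others o∈) (square-bound o∈ (suc j) t<2^j)
        where
        open ℕ.≤-Reasoning
        o∈ : o ∈ˢ A′
        o∈ = ∈-elements⁻ (subst (o ∈_) (sym eq) (here refl))
        T : ℕ
        T = t ℕ.* t
        1≤T : 1 ≤ T
        1≤T = ℕ.*-mono-≤ (1≤order A-subgroup) (1≤order A-subgroup)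
        trivial : n ≤ 2 → n ℕ.* n ℕ.* (n ℕ.* n) ≤ C ℕ.* (ratioCount ℕ.* (j ℕ.* T))
        trivial n≤2 = begin
          n ℕ.* n ℕ.* (n ℕ.* n)   ≤⟨ square-mono (square-mono n≤2) ⟩
          16                      ≤⟨ ℕ.*-mono-≤ {16} {C} {1} (subst (16 ≤_) (sym C-def) (ℕ.*-mono-≤ {16} {512} {1} (ℕ.≤ᵇ⇒≤ 16 512 _) (ℕ.≤-trans 1≤K K≤M)))
                                       (ℕ.*-mono-≤ (ℕ.m≤n⊔m (length ratios) 1) (ℕ.*-mono-≤ 1≤j 1≤T)) ⟩
          C ℕ.* (ratioCount ℕ.* (j ℕ.* T)) ∎
        by-others : ∀ k → n ≤ suc k → k ℕ.* (k ℕ.∸ 1) ℕ.* (k ℕ.* (k ℕ.∸ 1)) ≤ length ratios ℕ.* (suc j ℕ.* (4 ℕ.* (M ℕ.* T))) →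
          n ℕ.* n ℕ.* (n ℕ.* n) ≤ C ℕ.* (ratioCount ℕ.* (j ℕ.* T))
        by-others zero          n≤ _  = trivial (ℕ.≤-trans n≤ (s≤s z≤n))
        by-others (suc zero)    n≤ _  = trivial n≤
        by-others (suc (suc m)) n≤ le = begin
          n ℕ.* n ℕ.* (n ℕ.* n)
            ≤⟨ square-mono n²≤ ⟩
          8 ℕ.* (k ℕ.* suc m) ℕ.* (8 ℕ.* (k ℕ.* suc m))
            ≡⟨ solve 1 (λ x → con 8 :* x :* (con 8 :* x) := con 64 :* (x :* x)) refl (k ℕ.* suc m) ⟩
          64 ℕ.* (k ℕ.* suc m ℕ.* (k ℕ.* suc m))
            ≤⟨ ℕ.*-monoʳ-≤ 64 le ⟩
          64 ℕ.* (length ratios ℕ.* ((1 ℕ.+ j) ℕ.* (4 ℕ.* (M ℕ.* T))))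
            ≤⟨ ℕ.*-monoʳ-≤ 64 (ℕ.*-mono-≤ (ℕ.m≤m⊔n (length ratios) 1) (ℕ.*-monoˡ-≤ (4 ℕ.* (M ℕ.* T)) (ℕ.+-monoˡ-≤ j 1≤j))) ⟩
          64 ℕ.* (ratioCount ℕ.* ((j ℕ.+ j) ℕ.* (4 ℕ.* (M ℕ.* T))))
            ≡⟨ solve 4 (λ x j m u → con 64 :* (x :* ((j :+ j) :* (con 4 :* (m :* u)))) := con 512 :* m :* (x :* (j :* u))) refl ratioCount j M T ⟩
          512 ℕ.* M ℕ.* (ratioCount ℕ.* (j ℕ.* T))
            ≡⟨ cong (ℕ._* (ratioCount ℕ.* (j ℕ.* T))) (sym C-def) ⟩
          C ℕ.* (ratioCount ℕ.* (j ℕ.* T)) ∎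
          where
          k = suc (suc m)
          k≤2[k-1] : k ≤ 2 ℕ.* suc m
          k≤2[k-1] = ℕ.≤-trans (ℕ.m≤m+n k m) (ℕ.≤-reflexive (solve 1 (λ m → con 2 :+ m :+ m := con 2 :* (con 1 :+ m)) refl m))
          n≤2k : n ≤ 2 ℕ.* k
          n≤2k = ℕ.≤-trans n≤ (ℕ.≤-trans (ℕ.m≤m+n (suc k) (suc m)) (ℕ.≤-reflexive
            (solve 1 (λ m → con 3 :+ m :+ (con 1 :+ m) := con 2 :* (con 2 :+ m)) refl m)))
          n²≤ : n ℕ.* n ≤ 8 ℕ.* (k ℕ.* suc m)
          n²≤ = begin
            n ℕ.* n                               ≤⟨ square-mono n≤2k ⟩
            2 ℕ.* k ℕ.* (2 ℕ.* k)                 ≤⟨ ℕ.*-monoʳ-≤ (2 ℕ.* k) (ℕ.*-monoʳ-≤ 2 k≤2[k-1]) ⟩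
            2 ℕ.* k ℕ.* (2 ℕ.* (2 ℕ.* suc m))     ≡⟨ solve 2 (λ k m → con 2 :* k :* (con 2 :* (con 2 :* m)) := con 8 :* (k :* m)) refl k (suc m) ⟩
            8 ℕ.* (k ℕ.* suc m)                   ∎

      ratioCount-bound : ∣ Γ ∣ ℕ.* ∣ Γ ∣ ℕ.* (∣ Γ ∣ ℕ.* ∣ Γ ∣) < cube p → cube ratioCount ≤ K ℕ.* (∣ Γ ∣ ℕ.* ∣ Γ ∣)
      ratioCount-bound γ⁴<p³ with ℕ.⊔-sel (length ratios) 1
      ... | inj₁ e = ℕ.≤-trans (ℕ.≤-reflexive (cong cube e)) (length-ratios γ⁴<p³)
      ... | inj₂ e = ℕ.≤-trans (ℕ.≤-reflexive (cong cube e)) (ℕ.*-mono-≤ 1≤K (ℕ.*-mono-≤ 1≤γ 1≤γ))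

      -- The witness x hides the number of ratios, so that what follows is arithmetic of natural
      -- numbers only.
      summary : ∣ Γ ∣ ℕ.* ∣ Γ ∣ ℕ.* (∣ Γ ∣ ℕ.* ∣ Γ ∣) < cube p → ∃[ x ] (cube x ≤ K ℕ.* (∣ Γ ∣ ℕ.* ∣ Γ ∣) ×
        (∀ j → 1 ≤ j → t < 2 ℕ.^ suc j → n ℕ.* n ℕ.* (n ℕ.* n) ≤ C ℕ.* (x ℕ.* (j ℕ.* (t ℕ.* t)))) ×
        n ≤ t × (1 < ∣ Γ ∣ → n ≤ ∣ Γ ∣ ℕ.* ∣ Γ ∣))
      summary γ⁴<p³ = ratioCount , ratioCount-bound γ⁴<p³ , fourth-power-bound , translates , order≤

-- The two bounds and their constants.

open import Defs
open import Data.Fin using (Fin)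
open import Data.Fin.Subset using (Subset; ∣_∣; _∈_)
open import Data.Nat using (ℕ; NonZero; _<_; _^_)
open import Data.Nat.Primality using (Prime)
open import Data.Product using (_×_; ∃-syntax)
open import Relation.Binary.PropositionalEquality using (_≢_)
open import Relation.Unary using (_⊆_; _∪_; ｛_｝)

open import Data.Nat using (_+_; _*_; _<?_; _≤?_; >-nonZero)
open import Data.Nat.Properties
open import Data.Nat.Solver using (module +-*-Solver)
open import Relation.Binary.PropositionalEquality using (refl; sym; subst)

open PrimeField
open NaturalBounds
open Counting

-- While `a` is a variable, `K` and `C` stay symbolic; a numeral is substituted only at the very
-- end.
module Bounds (a : ℕ) (1≤a : 1 ≤ a) (27≤a³ : 27 ≤ cube a) (8Q≤a³ : 8 * (4 * a * (a + 1)) ≤ cube a) where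
  open Parameters a 1≤a 27≤a³ 8Q≤a³ using (K; C; 1≤K; 1≤C)
  open +-*-Solver

  n<2^n : ∀ n → n < 2 ^ n
  n<2^n 0       = s≤s z≤n
  n<2^n (suc n) = +-mono-≤ (≤-trans (s≤s z≤n) (n<2^n n)) (≤-trans (n<2^n n) (m≤m+n (2 ^ n) 0))

  -- j is the integer part of log₂ t. The lower inequality compares j with the logarithm, the upper
  -- one limits the number of dyadic levels to j + 1, and j ≥ 1 allows j + 1 ≤ 2 j.
  binary-length : ∀ t → 1 < t → ∃[ j ] (1 ≤ j × 2 ^ j ≤ t × t < 2 ^ suc j)
  binary-length t 1<t with last-true {λ j → 2 ^ j ≤ t} (λ j → 2 ^ j ≤? t) t 1<t
    (λ le → <⇒≱ (n<2^n (suc t)) (≤-trans le (n≤1+n t)))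
  ... | j , 1≤j , 2^j≤t , ¬2^[1+j]≤t = j , 1≤j , 2^j≤t , ≰⇒> ¬2^[1+j]≤t

  ^2 : ∀ n → n ^ 2 ≡ n * n
  ^2 = solve 1 (λ n → n :^ 2 := n :* n) refl

  ^4<^3 : ∀ m n → m ^ 4 < n ^ 3 → m * m * (m * m) < cube n
  ^4<^3 m n lt = begin-strict
    m * m * (m * m)   ≡⟨ solve 1 (λ m → m :* m :* (m :* m) := m :^ 4) refl m ⟩
    m ^ 4             <⟨ lt ⟩
    n ^ 3             ≡⟨ solve 1 (λ n → n :^ 3 := n :* (n :* n)) refl n ⟩
    cube n            ∎
    where open ≤-Reasoning

  SixthPowerBound : ℕ → Set
  SixthPowerBound c =
    ∀ (p : ℕ) .{{_ : NonZero p}} → Prime p →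
    (A Γ : Subset p) →
    IsMultiplicativeSubgroup A → IsMultiplicativeSubgroup Γ →
    ∣ A ∣ ^ 2 < p → ∣ Γ ∣ ^ 4 < p ^ 3 →
    1 < ∣ A ∣ →
    (A′ : Subset p) (s ξ : Fin p) → ξ ≢ 0ₚ →
    (_∈ A′) ⊆ A +ˢ s →
    A′ -ˢ A′ ⊆ (ξ *ˢ Γ) ∪ ｛ 0ₚ ｝ →
    ∣ A′ ∣ ^ 6 ≤ᴿ ⌜ c ⌝ · ⌜ ∣ A ∣ ^ 4 ⌝ · root 3 ⌜ ∣ Γ ∣ ^ 2 ⌝ · log₂ ∣ A ∣

  OrderBound : ℕ → Set
  OrderBound c =
    ∀ (p : ℕ) .{{_ : NonZero p}} → Prime p →
    (A Γ : Subset p) →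
    IsMultiplicativeSubgroup A → IsMultiplicativeSubgroup Γ →
    ∣ A ∣ ^ 2 < p → ∣ Γ ∣ ^ 4 < p ^ 3 →
    1 < ∣ Γ ∣ →
    (ξ : Fin p) → ξ ≢ 0ₚ →
    A -ˢ A ⊆ (ξ *ˢ Γ) ∪ ｛ 0ₚ ｝ →
    ∣ A ∣ ≤ᴿ ⌜ c ⌝ · root 3 ⌜ ∣ Γ ∣ ⌝ · root 2 (log₂ ∣ Γ ∣)

  sixth-power : ∀ n t c x j → n ≤ t → n * n * (n * n) ≤ c * (x * (j * (t * t))) → n ^ 6 ≤ c * (t ^ 4 * (x * j))
  sixth-power n t c x j n≤t n⁴≤ = begin
    n ^ 6                              ≡⟨ solve 1 (λ n → n :^ 6 := n :* n :* (n :* n :* (n :* n))) refl n ⟩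
    n * n * (n * n * (n * n))          ≤⟨ *-mono-≤ (square-mono n≤t) n⁴≤ ⟩
    t * t * (c * (x * (j * (t * t))))  ≡⟨ solve 4 (λ t c x j → t :* t :* (c :* (x :* (j :* (t :* t)))) := c :* (t :^ 4 :* (x :* j))) refl t c x j ⟩
    c * (t ^ 4 * (x * j))              ∎
    where open ≤-Reasoning

  sixthPowerBound : SixthPowerBound (C * K)
  sixthPowerBound p isPrime A Γ isA isΓ t²<p γ⁴<p³ 1<t A′ s ξ ξ≢0 A′⊆A+s A′-A′⊆ξΓ =
    let j , 1≤j , 2^j≤t , t<2^ = binary-length ∣ A ∣ 1<t
        x , x³≤ , n⁴≤ , n≤t , _ = Differences.summary p isPrime a 1≤a 27≤a³ 8Q≤a³ isA isΓ
          (subst (_< p) (^2 ∣ A ∣) t²<p) A′ s ξ ξ≢0 A′⊆A+s A′-A′⊆ξΓ (^4<^3 (∣ Γ ∣) p γ⁴<p³)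
    in UpperReals.sixth-power-bound C K (∣ A′ ∣) (∣ A ∣) (∣ Γ ∣) x j 1≤K
      (sixth-power (∣ A′ ∣) (∣ A ∣) C x j n≤t (n⁴≤ j 1≤j t<2^)) (subst (λ g → cube x ≤ K * g) (sym (^2 ∣ Γ ∣)) x³≤) 2^j≤t

  -- For A′ = A the bound for |A|⁴ has a factor |A|² on the right, which cancels.
  square : ∀ t c x j → 1 ≤ t → t * t * (t * t) ≤ c * (x * (j * (t * t))) → t * t ≤ c * (x * j)
  square t c x j 1≤t t⁴≤ = *-cancelʳ-≤ (t * t) (c * (x * j)) (t * t) {{m*n≢0 t t {{t≢0}} {{t≢0}}}} (≤-trans t⁴≤
    (≤-reflexive (solve 4 (λ t c x j → c :* (x :* (j :* (t :* t))) := c :* (x :* j) :* (t :* t)) refl t c x j)))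
    where
    t≢0 : NonZero t
    t≢0 = >-nonZero 1≤t

  orderBound : OrderBound (2 * (C * K))
  orderBound p isPrime A Γ isA isΓ t²<p γ⁴<p³ 1<γ ξ ξ≢0 A-A⊆ξΓ with 1 <? ∣ A ∣
  ... | yes 1<t =
    let j , 1≤j , 2^j≤t , t<2^ = binary-length ∣ A ∣ 1<t
        x , x³≤ , t⁴≤ , _ , t≤γ² = Differences.summary p isPrime a 1≤a 27≤a³ 8Q≤a³ isA isΓ
          (subst (_< p) (^2 ∣ A ∣) t²<p) A 0ₚ ξ ξ≢0 A⊆A+0 A-A⊆ξΓ (^4<^3 (∣ Γ ∣) p γ⁴<p³)
    in UpperReals.square-bound C K (∣ A ∣) (∣ Γ ∣) x j 1≤C 1≤K (square ∣ A ∣ C x j (<⇒≤ 1<t) (t⁴≤ j 1≤j t<2^)) x³≤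
      (≤-trans 2^j≤t (≤-trans (t≤γ² 1<γ) (≤-reflexive (sym (^2 ∣ Γ ∣)))))
    where
    A⊆A+0 : (_∈ A) ⊆ A +ˢ 0ₚ
    A⊆A+0 {x} x∈ = x , x∈ , sym (CommutativeRing.+-identityʳ (Residues.residueRing p) x)
  -- Here |A| ≤ 1, and x = j = 1 satisfy the same inequalities because |Γ| ≥ 2.
  ... | no 1≮t = UpperReals.square-bound C K (∣ A ∣) (∣ Γ ∣) 1 1 1≤C 1≤K
    (≤-trans (square-mono (≮⇒≥ 1≮t)) (≤-trans 1≤C (m≤m*n C 1)))
    (*-mono-≤ 1≤K (*-mono-≤ (<⇒≤ 1<γ) (<⇒≤ 1<γ)))
    (≤-trans 1<γ (≤-trans (m≤m*n (∣ Γ ∣) (∣ Γ ∣) {{>-nonZero (<⇒≤ 1<γ)}}) (≤-reflexive (sym (^2 ∣ Γ ∣)))))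

  theorem : (∃[ c ] (0 < c × SixthPowerBound c)) × (∃[ c ] (0 < c × OrderBound c))
  theorem = (C * K , *-mono-≤ 1≤C 1≤K , sixthPowerBound) ,
    (2 * (C * K) , *-mono-≤ {1} {2} {1} (s≤s z≤n) (*-mono-≤ 1≤C 1≤K) , orderBound)

theorem8 : (∃[ c ] (0 < c ×
    (∀ (p : ℕ) .{{_ : NonZero p}} → Prime p →
    (A Γ : Subset p) →
    IsMultiplicativeSubgroup A → IsMultiplicativeSubgroup Γ →
    ∣ A ∣ ^ 2 < p → ∣ Γ ∣ ^ 4 < p ^ 3 →
    1 < ∣ A ∣ →
    (A′ : Subset p) (s ξ : Fin p) → ξ ≢ 0ₚ →
    (_∈ A′) ⊆ A +ˢ s →
    A′ -ˢ A′ ⊆ (ξ *ˢ Γ) ∪ ｛ 0ₚ ｝ →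
    ∣ A′ ∣ ^ 6 ≤ᴿ ⌜ c ⌝ · ⌜ ∣ A ∣ ^ 4 ⌝ · root 3 ⌜ ∣ Γ ∣ ^ 2 ⌝ · log₂ ∣ A ∣)))
    ×
    (∃[ c ] (0 < c ×
    (∀ (p : ℕ) .{{_ : NonZero p}} → Prime p →
    (A Γ : Subset p) →
    IsMultiplicativeSubgroup A → IsMultiplicativeSubgroup Γ →
    ∣ A ∣ ^ 2 < p → ∣ Γ ∣ ^ 4 < p ^ 3 →
    1 < ∣ Γ ∣ →
    (ξ : Fin p) → ξ ≢ 0ₚ →
    A -ˢ A ⊆ (ξ *ˢ Γ) ∪ ｛ 0ₚ ｝ →
    ∣ A ∣ ≤ᴿ ⌜ c ⌝ · root 3 ⌜ ∣ Γ ∣ ⌝ · root 2 (log₂ ∣ Γ ∣))))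
-- The condition 8 Q ≤ a³ amounts to 32 (a + 1) ≤ a², which for a = 34 reads 1120 ≤ 1156.
theorem8 = Bounds.theorem 34 (s≤s z≤n) (≤ᵇ⇒≤ 27 (cube 34) _) (≤ᵇ⇒≤ (8 * (4 * 34 * (34 + 1))) (cube 34) _)
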